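{- Let $G$ be a simple loony endgame with at least two 3-chains. (a) If $cv(G)\ge2$ then $v(G)=cv(G)$. (b) If $cv(G)<2$ and $cv(G)$ is even, then $v(G)=2$, except if $G$ has a 4-loop and $cv(G\backslash 4_\ell)=4$, in which case $v(G)=0$. (c) If $cv(G)<2$ and $cv(G)$ is odd then $v(G)=1$.
   Context: Game. A dots and boxes game (position) $G$ consists of a finite set of unclaimed boxes and a finite set of undrawn lines, each undrawn line bordering either exactly one box or exactly two distinct boxes, each box being bordered by at least one and at most four undrawn lines. Two players play. The player to move draws (removes) an undrawn line; every box none of whose bordering lines is still undrawn is then claimed by that player. If the move claims at least one box the same player must move again (if a line remains); otherwise the other player moves. Claiming a box when possible is not compulsory. The game ends when no line remains. Each player maximises (own boxes) minus (opponent's boxes), counting only boxes claimed from $G$ onwards. Value. $v(G)$ is the net score, under optimal play, of the player who is NOT to move in $G$. Equivalently, $v(G)=0$ if $G$ has no undrawn lines, and otherwise $v(G)=\min_m v(G;m)$ over undrawn lines $m$, where, if drawing $m$ claims $k$ boxes and leaves the position $G_m$, then $v(G;m)=v(G_m)-k$ if $k\ge1$ and $v(G;m)=-v(G_m)$ if $k=0$. Chains and loops. An $n$-chain (denoted $n$) has boxes $b_1,\dots,b_n$ and lines $e_0,\dots,e_n$, where $e_i$ borders $b_i,b_{i+1}$ for $1\le i\le n-1$, $e_0$ borders only $b_1$ and $e_n$ borders only $b_n$. An $n$-loop ($n\ge4$, denoted $n_\ell$) has boxes $b_1,\dots,b_n$ and lines $e_1,\dots,e_n$, $e_i$ bordering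 $b_i,b_{i+1}$ (indices mod $n$). A simple loony endgame is a finite (possibly empty) disjoint union of chains of length at least 3 and loops of even length at least 4. $G\backslash 4_\ell$ is $G$ with one 4-loop removed. Controlled value. If $G$ is a simple loony endgame with chains of lengths $c_i$ and loops of lengths $\ell_j$, then $fcv(G)=\sum_i(c_i-4)+\sum_j(\ell_j-8)$ and $cv(G)=fcv(G)+tb(G)$, where the terminal bonus $tb(G)$ is: $0$ if $G$ is empty; $4$ if $G$ is non-empty and has a chain of length at least 4 or has no loops; $8$ if $G$ has loops but no chains; $6$ if $G$ has both chains and loops and all its chains are 3-chains. -}

module Defs where

open import Data.Bool using (true; false; if_then_else_)
open import Data.Empty using (⊥-elim)
open import Data.Fin using (Fin; zero; suc; toℕ; inject₁; fromℕ; _↑ˡ_; _↑ʳ_; splitAt)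
open import Data.Fin.Properties
  using (toℕ-inject₁; inject₁-injective; suc-injective; ↑ˡ-injective; ↑ʳ-injective;
         splitAt-↑ˡ; splitAt-↑ʳ; join-splitAt)
  renaming (_≟_ to _≟ᶠ_)
open import Data.Fin.Relation.Unary.Top using (view; ‵fromℕ; ‵inject₁)
open import Data.Integer using (ℤ; +_; _⊓_) renaming (_+_ to _+ℤ_; _-_ to _-ℤ_; -_ to -ℤ_)
open import Data.List using (List; []; _∷_; length; filter; map; foldr; allFin)
  renaming (_++_ to _++ᴸ_)
open import Data.List.Membership.Propositional using (_∈_)
open import Data.List.Relation.Unary.All using (All; reduce)
open import Data.List.Relation.Unary.All.Properties using (─⁺)
open import Data.List.Relation.Unary.Any using (any?; _─_)
open import Data.Nat using (ℕ; zero; suc; _+_; _≤_; z≤n; s≤s; _≟_; _≤?_)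
open import Data.Nat.Divisibility using (_∣_)
open import Data.Nat.Properties
  using (≤-refl; ≤-trans; ≤-reflexive; m≤m+n; m≤n⇒m≤1+n; +-suc; +-identityʳ; +-mono-≤; 1+n≢n)
open import Data.Product using (Σ-syntax; _×_; _,_; proj₁; proj₂)
open import Data.Sum using (_⊎_; inj₁; inj₂)
open import Data.Vec using (Vec; []; _∷_; _∷ʳ_; _++_; lookup; removeAt; tabulate; count)
  renaming (map to mapᵛ)
open import Data.Vec.Functional using (head; tail) renaming (foldr to foldrᶠ)
open import Function using (_∘_)
open import Function.Definitions using (Injective)
open import Relation.Binary.PropositionalEquality
  using (_≡_; _≢_; refl; sym; trans; cong; cong₂; subst)
open import Relation.Nullary using (¬_; Dec; yes; no; does)
open import Relation.Nullary.Decidable using (_×-dec_; _⊎-dec_)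

private
  variable
    n k : ℕ

data Line (n : ℕ) : Set where
  outer : Fin n → Line n
  inner : (b c : Fin n) → .(b ≢ c) → Line n

Borders : Line n → Fin n → Set
Borders (outer c)     b = b ≡ c
Borders (inner c d _) b = b ≡ c ⊎ b ≡ d

borders? : (b : Fin n) (l : Line n) → Dec (Borders l b)
borders? b (outer c)     = b ≟ᶠ c
borders? b (inner c d _) = (b ≟ᶠ c) ⊎-dec (b ≟ᶠ d)

degree : Fin n → Vec (Line n) k → ℕ
degree b = count (borders? b)

record Game : Set where
  constructor game
  field
    {boxes #lines} : ℕ
    lines          : Vec (Line boxes) #lines
    degree≥1       : ∀ b → 1 ≤ degree b lines
    degree≤4       : ∀ b → degree b lines ≤ 4

open Game public using (lines)

-- During play a position is the vector of undrawn lines, on a fixed set of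
-- box labels: a label is an unclaimed box iff it has positive degree.

claimed : Line n → Vec (Line n) k → ℕ
claimed {n} m rest =
  length (filter (λ b → borders? b m ×-dec (degree b rest ≟ 0)) (allFin n))

-- From the claimed boxes and the value of the resulting position to v(G;m).
moveValue : ℕ → ℤ → ℤ
moveValue zero      w = -ℤ w
moveValue c@(suc _) w = w -ℤ + c

minimum : (Fin (suc k) → ℤ) → ℤ
minimum f = foldrᶠ _⊓_ (head f) (tail f)

value : Vec (Line n) k → ℤ
value {k = zero}  _  = + 0
value {k = suc _} ls = minimum λ i →
  moveValue (claimed (lookup ls i) (removeAt ls i)) (value (removeAt ls i))

v : Game → ℤ
v G = value (lines G)

relabel : ∀ {m n} (f : Fin m → Fin n) → .(Injective _≡_ _≡_ f) → Line m → Line n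
relabel f inj (outer b)       = outer (f b)
relabel f inj (inner b c b≢c) = inner (f b) (f c) (λ eq → b≢c (inj eq))

_⊕ˡ_ : ∀ {m n j k} → Vec (Line m) j → Vec (Line n) k → Vec (Line (m + n)) (j + k)
_⊕ˡ_ {m} {n} ls ls′ =
  mapᵛ (relabel (_↑ˡ n) (↑ˡ-injective n _ _)) ls ++
  mapᵛ (relabel (m ↑ʳ_) (↑ʳ-injective m _ _)) ls′

private
  degree-++ : ∀ {j} (b : Fin n) (xs : Vec (Line n) j) (ys : Vec (Line n) k) →
              degree b (xs ++ ys) ≡ degree b xs + degree b ys
  degree-++ b []       ys = refl
  degree-++ b (x ∷ xs) ys with does (borders? b x)
  ... | true  = cong suc (degree-++ b xs ys)
  ... | false = degree-++ b xs ys

  module _ {m n} (f : Fin m → Fin n) (inj : Injective _≡_ _≡_ f) where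

    borders⁺ : ∀ b l → Borders l b → Borders (relabel f inj l) (f b)
    borders⁺ b (outer c)     refl        = refl
    borders⁺ b (inner c d _) (inj₁ refl) = inj₁ refl
    borders⁺ b (inner c d _) (inj₂ refl) = inj₂ refl

    borders⁻ : ∀ b l → Borders (relabel f inj l) (f b) → Borders l b
    borders⁻ b (outer c)     p        = inj p
    borders⁻ b (inner c d _) (inj₁ p) = inj₁ (inj p)
    borders⁻ b (inner c d _) (inj₂ p) = inj₂ (inj p)

    degree-relabel : ∀ b (ls : Vec (Line m) k) →
                     degree (f b) (mapᵛ (relabel f inj) ls) ≡ degree b ls
    degree-relabel b []       = refl
    degree-relabel b (l ∷ ls) with borders? b l | borders? (f b) (relabel f inj l)
    ... | yes _ | yes _ = cong suc (degree-relabel b ls)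
    ... | no _  | no _  = degree-relabel b ls
    ... | yes p | no ¬p = ⊥-elim (¬p (borders⁺ b l p))
    ... | no ¬p | yes p = ⊥-elim (¬p (borders⁻ b l p))

    degree-outside : ∀ c → (∀ b → c ≢ f b) → (ls : Vec (Line m) k) →
                     degree c (mapᵛ (relabel f inj) ls) ≡ 0
    degree-outside c c∉f []       = refl
    degree-outside c c∉f (l ∷ ls) with borders? c (relabel f inj l)
    ... | no _  = degree-outside c c∉f ls
    ... | yes p = ⊥-elim (outside l p)
      where
      outside : ∀ l → ¬ Borders (relabel f inj l) c
      outside (outer b)      p        = c∉f b p
      outside (inner b d _) (inj₁ p) = c∉f b p
      outside (inner b d _) (inj₂ p) = c∉f d p

  ↑ˡ≢↑ʳ : ∀ {m n} (b : Fin m) (c : Fin n) → b ↑ˡ n ≢ m ↑ʳ c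
  ↑ˡ≢↑ʳ {m} {n} b c eq
    with trans (sym (splitAt-↑ˡ m b n)) (trans (cong (splitAt m) eq) (splitAt-↑ʳ m n c))
  ... | ()

  module _ {m n j k} (ls : Vec (Line m) j) (ls′ : Vec (Line n) k) where

    degree-↑ˡ : ∀ b → degree (b ↑ˡ n) (ls ⊕ˡ ls′) ≡ degree b ls
    degree-↑ˡ b = trans (degree-++ (b ↑ˡ n) (mapᵛ _ ls) _) (trans
      (cong₂ _+_ (degree-relabel (_↑ˡ n) (↑ˡ-injective n _ _) b ls)
                 (degree-outside (m ↑ʳ_) (↑ʳ-injective m _ _) (b ↑ˡ n) (↑ˡ≢↑ʳ b) ls′))
      (+-identityʳ _))

    degree-↑ʳ : ∀ c → degree (m ↑ʳ c) (ls ⊕ˡ ls′) ≡ degree c ls′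
    degree-↑ʳ c = trans (degree-++ (m ↑ʳ c) (mapᵛ _ ls) _)
      (cong₂ _+_ (degree-outside (_↑ˡ n) (↑ˡ-injective n _ _) (m ↑ʳ c)
                                 (λ b eq → ↑ˡ≢↑ʳ b c (sym eq)) ls)
                 (degree-relabel (m ↑ʳ_) (↑ʳ-injective m _ _) c ls′))

    degree-⊕ : (P : ℕ → Set) → (∀ b → P (degree b ls)) → (∀ c → P (degree c ls′)) →
               ∀ d → P (degree d (ls ⊕ˡ ls′))
    degree-⊕ P p q d with splitAt m d | join-splitAt m n d
    ... | inj₁ b | refl = subst P (sym (degree-↑ˡ b)) (p b)
    ... | inj₂ c | refl = subst P (sym (degree-↑ʳ c)) (q c)

∅ : Game
∅ = game {0} [] (λ ()) (λ ())

_⊕_ : Game → Game → Game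
game ls p q ⊕ game ls′ p′ q′ =
  game (ls ⊕ˡ ls′) (degree-⊕ ls ls′ (1 ≤_) p p′) (degree-⊕ ls ls′ (_≤ 4) q q′)

private
  inject₁≢suc : (i : Fin n) → inject₁ i ≢ suc i
  inject₁≢suc i eq = 1+n≢n (trans (sym (cong toℕ eq)) (toℕ-inject₁ i))

link : Fin k → Line (suc k)
link i = inner (inject₁ i) (suc i) (inject₁≢suc i)

-- The first line is e₀, then come e₁, …, eₙ₋₁, and the last one is eₙ.
chainLines : ∀ m → Vec (Line (suc m)) (suc (suc m))
chainLines m = outer zero ∷ (tabulate link ∷ʳ outer (fromℕ m))

loopLines : ∀ m → Vec (Line (suc (suc m))) (suc (suc m))
loopLines m = tabulate link ∷ʳ inner (fromℕ (suc m)) zero (λ ())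

private
  degree-∷≥ : ∀ (b : Fin n) l (ls : Vec (Line n) k) → degree b ls ≤ degree b (l ∷ ls)
  degree-∷≥ b l ls with does (borders? b l)
  ... | true  = m≤n⇒m≤1+n ≤-refl
  ... | false = ≤-refl

  degree-∷≤ : ∀ (b : Fin n) l (ls : Vec (Line n) k) → degree b (l ∷ ls) ≤ suc (degree b ls)
  degree-∷≤ b l ls with does (borders? b l)
  ... | true  = ≤-refl
  ... | false = m≤n⇒m≤1+n ≤-refl

  degree-∷-yes : ∀ (b : Fin n) l (ls : Vec (Line n) k) → Borders l b → 1 ≤ degree b (l ∷ ls)
  degree-∷-yes b l ls p with borders? b l
  ... | yes _ = s≤s z≤n
  ... | no ¬p = ⊥-elim (¬p p)

  degree-∷ʳ≤ : ∀ (b : Fin n) (ls : Vec (Line n) k) l → degree b (ls ∷ʳ l) ≤ suc (degree b ls)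
  degree-∷ʳ≤ b []       l = degree-∷≤ b l []
  degree-∷ʳ≤ b (x ∷ ls) l with does (borders? b x)
  ... | true  = s≤s (degree-∷ʳ≤ b ls l)
  ... | false = degree-∷ʳ≤ b ls l

  degree-∷ʳ-yes : ∀ (b : Fin n) (ls : Vec (Line n) k) l → Borders l b → 1 ≤ degree b (ls ∷ʳ l)
  degree-∷ʳ-yes b []       l p = degree-∷-yes b l [] p
  degree-∷ʳ-yes b (x ∷ ls) l p =
    ≤-trans (degree-∷ʳ-yes b ls l p) (degree-∷≥ b x (ls ∷ʳ l))

  degree-tabulate-yes : ∀ (b : Fin n) (g : Fin k → Line n) l i → Borders (g i) b →
                        1 ≤ degree b (tabulate g ∷ʳ l)
  degree-tabulate-yes b g l zero    p =
    degree-∷-yes b (g zero) (tabulate (g ∘ suc) ∷ʳ l) p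
  degree-tabulate-yes b g l (suc i) p =
    ≤-trans (degree-tabulate-yes b (g ∘ suc) l i p)
            (degree-∷≥ b (g zero) (tabulate (g ∘ suc) ∷ʳ l))

  occurrences : Fin n → (Fin k → Fin n) → ℕ
  occurrences b f = count (b ≟ᶠ_) (tabulate f)

  occurrences-none : ∀ (b : Fin n) (f : Fin k → Fin n) → (∀ i → b ≢ f i) → occurrences b f ≡ 0
  occurrences-none {k = zero}  b f no-i = refl
  occurrences-none {k = suc k} b f no-i with b ≟ᶠ f zero
  ... | yes p = ⊥-elim (no-i zero p)
  ... | no _  = occurrences-none b (f ∘ suc) (no-i ∘ suc)

  occurrences≤1 : ∀ (b : Fin n) (f : Fin k → Fin n) → Injective _≡_ _≡_ f → occurrences b f ≤ 1
  occurrences≤1 {k = zero}  b f inj = z≤n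
  occurrences≤1 {k = suc k} b f inj with b ≟ᶠ f zero
  ... | no _  = occurrences≤1 b (f ∘ suc) (suc-injective ∘ inj)
  ... | yes p = s≤s (≤-reflexive (occurrences-none b (f ∘ suc)
                  λ i q → 0≢suc (inj (trans (sym p) q))))
    where
    0≢suc : ∀ {i : Fin k} → zero ≢ suc i
    0≢suc ()

  degree-tabulate : ∀ (b : Fin n) (f g : Fin k → Fin n) .(f≢g : ∀ i → f i ≢ g i) →
                    degree b (tabulate (λ i → inner (f i) (g i) (f≢g i)))
                      ≤ occurrences b f + occurrences b g
  degree-tabulate {k = zero}  b f g f≢g = z≤n
  degree-tabulate {k = suc k} b f g f≢g
    with degree-tabulate b (f ∘ suc) (g ∘ suc) (λ i → f≢g (suc i)) | b ≟ᶠ f zero | b ≟ᶠ g zero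
  ... | ih | yes _ | no _  = s≤s ih
  ... | ih | no _  | no _  = ih
  ... | ih | no _  | yes _ = ≤-trans (s≤s ih) (≤-reflexive (sym (+-suc _ _)))
  ... | ih | yes _ | yes _ =
    s≤s (≤-trans (m≤n⇒m≤1+n ih) (≤-reflexive (sym (+-suc _ _))))

  degree-links≤2 : ∀ (b : Fin (suc k)) → degree b (tabulate (link {k})) ≤ 2
  degree-links≤2 b = ≤-trans (degree-tabulate b inject₁ suc inject₁≢suc)
    (+-mono-≤ (occurrences≤1 b inject₁ inject₁-injective) (occurrences≤1 b suc suc-injective))

  degree-links∷ʳ≤3 : ∀ l (b : Fin (suc k)) → degree b (tabulate (link {k}) ∷ʳ l) ≤ 3
  degree-links∷ʳ≤3 l b = ≤-trans (degree-∷ʳ≤ b (tabulate link) l) (s≤s (degree-links≤2 b))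

  degree-links∷ʳ≥1 : ∀ l → Borders l (fromℕ k) → (b : Fin (suc k)) →
                     1 ≤ degree b (tabulate (link {k}) ∷ʳ l)
  degree-links∷ʳ≥1 l p b with view b
  ... | ‵fromℕ     = degree-∷ʳ-yes b (tabulate link) l p
  ... | ‵inject₁ i = degree-tabulate-yes b link l i (inj₁ refl)

chain : ∀ n → 1 ≤ n → Game
chain (suc m) _ = game (chainLines m)
  (λ b → ≤-trans (degree-links∷ʳ≥1 (outer (fromℕ m)) refl b)
                 (degree-∷≥ b (outer zero) (tabulate link ∷ʳ outer (fromℕ m))))
  (λ b → ≤-trans (degree-∷≤ b (outer zero) (tabulate link ∷ʳ outer (fromℕ m)))
                 (s≤s (degree-links∷ʳ≤3 (outer (fromℕ m)) b)))

loop : ∀ n → 4 ≤ n → Game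
loop (suc (suc m)) _ = game (loopLines m)
  (degree-links∷ʳ≥1 (inner (fromℕ (suc m)) zero (λ ())) (inj₁ refl))
  (λ b → m≤n⇒m≤1+n (degree-links∷ʳ≤3 (inner (fromℕ (suc m)) zero (λ ())) b))
loop (suc zero) (s≤s ())

-- The multisets of chain and loop lengths determine the endgame up to isomorphism.
record SimpleLoonyEndgame : Set where
  field
    chains  : List ℕ
    loops   : List ℕ
    chains≥ : All (3 ≤_) chains
    loops≥  : All (λ ℓ → 4 ≤ ℓ × 2 ∣ ℓ) loops

open SimpleLoonyEndgame public

⟦_⟧ : SimpleLoonyEndgame → Game
⟦ G ⟧ = foldr _⊕_ ∅
  (reduce (λ {c} 3≤c → chain c (≤-trans (s≤s z≤n) 3≤c)) (chains≥ G) ++ᴸ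
   reduce (λ {ℓ} p → loop ℓ (proj₁ p)) (loops≥ G))

#3-chains : SimpleLoonyEndgame → ℕ
#3-chains G = length (filter (_≟ 3) (chains G))

_∖4ℓ_ : (G : SimpleLoonyEndgame) → 4 ∈ loops G → SimpleLoonyEndgame
G ∖4ℓ p = record
  { chains  = chains G
  ; loops   = loops G ─ p
  ; chains≥ = chains≥ G
  ; loops≥  = ─⁺ p (loops≥ G)
  }

sumℤ : List ℤ → ℤ
sumℤ = foldr _+ℤ_ (+ 0)

fcv : SimpleLoonyEndgame → ℤ
fcv G = sumℤ (map (λ c → + c -ℤ + 4) (chains G)) +ℤ sumℤ (map (λ ℓ → + ℓ -ℤ + 8) (loops G))

terminalBonus : (chains loops : List ℕ) → ℤ
terminalBonus []         []      = + 0
terminalBonus (_ ∷ _)    []      = + 4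
terminalBonus []         (_ ∷ _) = + 8
terminalBonus cs@(_ ∷ _) (_ ∷ _) = if does (any? (4 ≤?_) cs) then + 4 else + 6

tb : SimpleLoonyEndgame → ℤ
tb G = terminalBonus (chains G) (loops G)

cv : SimpleLoonyEndgame → ℤ
cv G = fcv G +ℤ tb G

-- G has a 4-loop, and removing it leaves an endgame of controlled value 4.
Exceptional : SimpleLoonyEndgame → Set
Exceptional G = Σ[ p ∈ 4 ∈ loops G ] cv (G ∖4ℓ p) ≡ + 4

{-# OPTIONS --safe #-}

-- Opening a component of n boxes lets the opponent either take all of them and move on in
-- the rest, of value w, or leave the last two (chain) or four (loop) and make us move there.
-- The opening is therefore worth max (n − w, n − d + w) with d = 4 or 8, and W is the minimum
-- of these numbers over all components.  That unrestricted play obeys this recursion follows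
-- by evaluating every position that can arise: if the intact components have value w and k
-- other boxes are unclaimed, the position is worth the least of w − k, of 4 − w − k if two
-- boxes can be offered, and of 8 − w − k if four boxes can be offered.
--
-- By induction cv ≤ v, and cv = v if cv ≥ 2, since then, outside a few tiny endgames, some
-- component can be opened without changing the terminal bonus or losing control.  Moreover v ≤ 4 if cv ≤ 4,
-- and v ≤ 3 if cv ≤ 1 and there is a 3-chain.  So with two 3-chains and cv < 2, opening one of
-- them leaves a value between 0 and 3.  As v and cv have the same parity, this gives v ∈ {0, 2}
-- or v = 1; the value 0 is only reached by opening a 4-loop and leaving the value 4.
module Submission where

open import Defs
open import Data.Bool using (Bool; true; false; if_then_else_)
open import Data.Empty using (⊥; ⊥-elim)
open import Data.Fin using (Fin; zero; suc; inject₁; fromℕ; _↑ˡ_; _↑ʳ_; splitAt)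
open import Data.Fin.Properties using (↑ˡ-injective; ↑ʳ-injective; splitAt-↑ˡ; splitAt-↑ʳ)
open import Data.Integer using (ℤ; +_; -[1+_]; -_; _⊔_; _⊓_; _≤_; _<_; 0ℤ; +≤+; -≤+)
  renaming (_+_ to _+ℤ_; _-_ to _-ℤ_; _*_ to _*ℤ_)
open import Data.Integer.Divisibility using (_∣_)
import Data.Integer.Divisibility.Signed as Signed
open import Data.Integer.Properties
  using (≤-refl; ≤-trans; ≤-antisym; ≤-reflexive; ≤-total; <⇒≱; +-mono-≤; i≤j⇒0≤j-i; 0≤i-j⇒j≤i;
         i⊓j≤i; i⊓j≤j; ⊓-glb; ⊓-sel; i≤i⊔j; i≤j⊔i; ⊔-lub; ⊔-sel)
open import Data.Integer.Tactic.RingSolver using (solve-∀)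
open import Data.List using (List; []; _∷_; map; _++_; length; concatMap; filter; foldr; allFin; tabulate)
open import Data.List.Membership.Propositional using (_∈_; find)
open import Data.List.Membership.Propositional.Properties
  using (∈-++⁺ˡ; ∈-++⁺ʳ; ∈-++⁻; ∈-concatMap⁻; ∈-∃++; ∈-map⁺; ∈-map⁻; ∈-filter⁺; ∈-filter⁻; ∈-allFin)
open import Data.List.Membership.Propositional.Properties.WithK using (unique∧set⇒bag)
open import Data.List.Properties
  using (++-assoc; ++-identityʳ; length-++; length-map; length-tabulate; map-++; map-∘; map-cong; concatMap-++)
open import Data.List.Relation.Binary.BagAndSetEquality using (∼bag⇒↭)
open import Data.List.Relation.Binary.Disjoint.Propositional using (Disjoint)
open import Data.List.Relation.Binary.Permutation.Propositional
  using (_↭_; ↭-refl; ↭-sym; ↭-trans; ↭-reflexive; ↭⇒↭ₛ; refl; prep; swap)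
  renaming (trans to trans↭)
open import Data.List.Relation.Binary.Permutation.Propositional.Properties
  using (∈-resp-↭; Any-resp-↭; All-resp-↭; ↭-length; ↭-map-inv; ↭-empty-inv; ¬x∷xs↭[]; drop-∷; shift; shifts;
         map⁺; ++⁺; ++⁺ˡ; ++⁺ʳ; ++-comm; filter-↭)
open import Data.List.Relation.Binary.Permutation.Setoid.Properties using (Unique-resp-↭)
open import Data.List.Relation.Unary.All as All using (All; []; _∷_; reduce)
import Data.List.Relation.Unary.All.Properties as Allₚ
open import Data.List.Relation.Unary.AllPairs using ([]; _∷_)
open import Data.List.Relation.Unary.Any using (Any; here; there; any?; _─_)
import Data.List.Relation.Unary.Any.Properties as Anyₚ
open import Data.List.Relation.Unary.Unique.Propositional using (Unique)
import Data.List.Relation.Unary.Unique.Propositional.Properties as Unique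
open import Data.Nat using (ℕ; zero; suc; _+_; _≟_; _≤?_; z≤n; s≤s; s≤s⁻¹; pred) renaming (_≤_ to _≤ᴺ_)
open import Data.Nat.Divisibility using (_∣?_) renaming (_∣_ to _∣ᴺ_)
open import Data.Nat.ListAction using (sum)
open import Data.Nat.ListAction.Properties using (sum-↭; sum-++)
open import Data.Nat.Properties as ℕ
  using (suc-injective; +-suc; +-comm; +-assoc; +-identityʳ; m+n≡0⇒m≡0; m+n≡0⇒n≡0; m≤m+n; m≤n⇒m≤1+n; 1+n≰n; ≰⇒>; ≤∧≢⇒<)
open import Data.Product using (∃-syntax; _×_; _,_; proj₁; proj₂; map₂)
open import Data.Sum using (_⊎_; inj₁; inj₂; [_,_])
open import Data.Unit using (⊤; tt)
open import Data.Vec using (Vec; []; _∷_; _∷ʳ_; lookup; removeAt; toList) renaming (map to mapᵛ; tabulate to tabulateᵛ)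
open import Data.Vec.Properties using (toList-++; toList-∷ʳ)
open import Function using (_∘_; _⟨_⟩_)
open import Function.Bundles using (mk⇔)
open import Function.Definitions using (Injective)
open import Relation.Binary.PropositionalEquality
  using (_≡_; _≢_; refl; sym; trans; cong; cong₂; subst; subst₂; setoid; module ≡-Reasoning)
open import Relation.Nullary using (¬_; Dec; yes; no)
open import Relation.Nullary.Decidable using (_×-dec_; from-no; dec-true; dec-false)

-- The obstacle is that any line may be drawn: a line in a half-eaten chain, one that splits a piece
-- in the middle, or one in a fresh component while boxes are still there for the taking. None of
-- these beats the three numbers of the recursion. A capture never creates an offer. A move in a
-- broken piece that claims nothing concedes all available boxes, and such a move exists only where
-- an offer would do at least as well. Opening a component too early concedes the available boxes as
-- well. The minimal lengths 3 and 4 enter here: they ensure that every opening, wherever the line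
-- lies, leaves the replier an offer of the right size. Several of the later bounds rest on one
-- remark: max (n - w, n - d + w) is at least the mean n - d/2 of its two entries, whatever w is.
-- This mean is at least 1 for a chain, at least 2 for a loop of length 6 or more, and 0 for a
-- 4-loop, which is why a non-empty endgame can have the value 0 only through a 4-loop. There both
-- entries must vanish, so w = 4.

-- Certificates for linear inequalities: the equation is left to the ring solver.
≤-by : ∀ {a b x y} → a ≤ b → y -ℤ x ≡ b -ℤ a → x ≤ y
≤-by a≤b eq = 0≤i-j⇒j≤i (subst (0ℤ ≤_) (sym eq) (i≤j⇒0≤j-i a≤b))

-- The value of opening components

Component : Set
Component = ℕ × ℕ

opened : Component → ℤ → ℤ
opened (d , n) w = (+ n -ℤ w) ⊔ (+ n -ℤ + d +ℤ w)

module _ {A : Set} where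

  picks : List A → List (A × List A)
  picks []       = []
  picks (x ∷ xs) = (x , xs) ∷ map (map₂ (x ∷_)) (picks xs)

  picks⇒↭ : ∀ {x r} xs → (x , r) ∈ picks xs → xs ↭ x ∷ r
  picks⇒↭ (x ∷ xs) (here refl) = ↭-refl
  picks⇒↭ (x ∷ xs) (there p) with ∈-map⁻ _ p
  ... | (y , r) , q , refl = ↭-trans (prep x (picks⇒↭ xs q)) (swap x y ↭-refl)

  ∈⇒picks : ∀ {x : A} {xs} → x ∈ xs → ∃[ r ] (x , r) ∈ picks xs
  ∈⇒picks (here refl) = _ , here refl
  ∈⇒picks (there x∈) with ∈⇒picks x∈
  ... | r , p = _ , there (∈-map⁺ (map₂ (_ ∷_)) p)

  ↭⇒picks : ∀ {x r} {xs : List A} → xs ↭ x ∷ r → ∃[ r′ ] (x , r′) ∈ picks xs × r′ ↭ r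
  ↭⇒picks {xs = xs} xs↭ with ∈⇒picks (∈-resp-↭ (↭-sym xs↭) (here refl))
  ... | r′ , p = r′ , p , drop-∷ (↭-trans (↭-sym (picks⇒↭ xs p)) xs↭)

least : List ℤ → ℤ
least []       = + 0
least (x ∷ xs) = foldr _⊓_ x xs

least-≤ : ∀ {x xs} → x ∈ xs → least xs ≤ x
least-≤ {xs = x ∷ xs} (here refl) = go xs
  where
  go : ∀ xs → foldr _⊓_ x xs ≤ x
  go []       = ≤-refl
  go (y ∷ xs) = ≤-trans (i⊓j≤j y _) (go xs)
least-≤ {xs = x ∷ xs} (there p) = go p
  where
  go : ∀ {y xs} → y ∈ xs → foldr _⊓_ x xs ≤ y
  go {xs = y ∷ _} (here refl) = i⊓j≤i y _
  go {xs = y ∷ _} (there p)   = ≤-trans (i⊓j≤j y _) (go p)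

least-∈ : ∀ x xs → least (x ∷ xs) ∈ x ∷ xs
least-∈ x []       = here refl
least-∈ x (y ∷ xs) with ⊓-sel y (foldr _⊓_ x xs) | least-∈ x xs
... | inj₁ eq | _       rewrite eq = there (here refl)
... | inj₂ eq | here p  rewrite eq = here p
... | inj₂ eq | there p rewrite eq = there (there p)

-- The first argument of W′ bounds the number of components that can still be opened.
W′ : ℕ → List Component → ℤ
W′ zero    G = + 0
W′ (suc f) G = least (map (λ (c , G′) → opened c (W′ f G′)) (picks G))

W : List Component → ℤ
W G = W′ (length G) G

W′-≤ : ∀ f {G c G′} → (c , G′) ∈ picks G → W′ (suc f) G ≤ opened c (W′ f G′)
W′-≤ f p = least-≤ (∈-map⁺ (λ (c , G′) → opened c (W′ f G′)) p)

W′-attained : ∀ f c G → ∃[ c′ ] ∃[ G′ ]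
  (c′ , G′) ∈ picks (c ∷ G) × W′ (suc f) (c ∷ G) ≡ opened c′ (W′ f G′)
W′-attained f c G with ∈-map⁻ _ (least-∈ _ (map (λ (c , G′) → opened c (W′ f G′)) (map (map₂ (c ∷_)) (picks G))))
... | (c′ , G′) , p , eq = c′ , G′ , p , eq

-- The list `picks` depends on the order of its argument, so the best opening on one side is located
-- on the other. One inequality suffices: the converse comes from the inverse permutation, and this
-- also supplies the equality for the two remainders.
W′-resp-≤ : ∀ f {G G₁} → G ↭ G₁ → W′ f G ≤ W′ f G₁
W′-resp-≤ zero G↭ = ≤-refl
W′-resp-≤ (suc f) {[]} {[]} G↭ = ≤-refl
W′-resp-≤ (suc f) {c ∷ G} {[]} G↭ = ⊥-elim (¬x∷xs↭[] G↭)
W′-resp-≤ (suc f) {G} {c ∷ G₁} G↭ with W′-attained f c G₁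
... | c′ , G′ , p , eq with ↭⇒picks (↭-trans G↭ (picks⇒↭ (c ∷ G₁) p))
... | G″ , q , G″↭ = ≤-trans (W′-≤ f q) (≤-reflexive
  (trans (cong (opened c′) (≤-antisym (W′-resp-≤ f G″↭) (W′-resp-≤ f (↭-sym G″↭)))) (sym eq)))

W-resp-↭ : ∀ {G G₁} → G ↭ G₁ → W G ≡ W G₁
W-resp-↭ {G} {G₁} G↭ rewrite ↭-length G↭ =
  ≤-antisym (W′-resp-≤ (length G₁) G↭) (W′-resp-≤ (length G₁) (↭-sym G↭))

W-≤ : ∀ {G c G′} → G ↭ c ∷ G′ → W G ≤ opened c (W G′)
W-≤ {c = c} {G′} G↭ = ≤-trans (≤-reflexive (W-resp-↭ G↭)) (W′-≤ (length G′) {c ∷ G′} (here refl))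

W-attained : ∀ c G → ∃[ c′ ] ∃[ G′ ] c ∷ G ↭ c′ ∷ G′ × W (c ∷ G) ≡ opened c′ (W G′)
W-attained c G with W′-attained (length G) c G
... | c′ , G′ , p , eq = c′ , G′ , picks⇒↭ (c ∷ G) p , trans eq
  (cong (λ f → opened c′ (W′ f G′)) (suc-injective (↭-length (picks⇒↭ (c ∷ G) p))))

-- Cutting rows and cycles of boxes

-- path l n r is a row of n + 1 boxes with its n inner lines; l and r tell whether
-- the outer lines at its two ends are undrawn.  cycle n has n + 1 boxes.
data Shape : Set where
  path : (l : Bool) (n : ℕ) (r : Bool) → Shape
  cycle : (n : ℕ) → Shape

data Cut : Shape → List Shape → Set where
  left  : ∀ {n r} → Cut (path true n r) (path false n r ∷ [])
  right : ∀ {l n} → Cut (path l n true) (path l n false ∷ [])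
  mid   : ∀ {l r} m n → Cut (path l (suc (m + n)) r) (path l m false ∷ path false n r ∷ [])
  unroll : ∀ {n} → Cut (cycle n) (path false n false ∷ [])

-- A lone box without inner or outer lines is a claimed box. It is kept as a shape of its own, so
-- that a cut preserves the boxes involved, as `cut-boxes` states.
deads : Shape → ℕ
deads (path true  n       r)     = 0
deads (path false n       true)  = 0
deads (path false zero    false) = 1
deads (path false (suc n) false) = 0
deads (cycle n)                  = 0

path-injective : ∀ {l l′ m n r r′} → Shape.path l m r ≡ path l′ n r′ → l ≡ l′ × m ≡ n × r ≡ r′
path-injective refl = refl , refl , refl

module _ {A : Set} where

  data Block : Set where
    path : (l : Bool) (b : A) (bs : List A) (r : Bool) → Block
    cycle : (b : A) (bs : List A) → Block

  shape : Block → Shape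
  shape (path l b bs r) = path l (length bs) r
  shape (cycle b bs)     = cycle (length bs)

  boxes : Block → List A
  boxes (path l b bs r) = b ∷ bs
  boxes (cycle b bs)     = b ∷ bs

  last : A → List A → A
  last b []       = b
  last b (c ∷ bs) = last c bs

  links : A → List A → List (List A)
  links b []       = []
  links b (c ∷ bs) = (b ∷ c ∷ []) ∷ links c bs

  outerEdge : Bool → A → List (List A)
  outerEdge true  b = (b ∷ []) ∷ []
  outerEdge false b = []

  -- An edge is represented by the list of boxes it borders.
  edges : Block → List (List A)
  edges (path l b bs r) = outerEdge l b ++ links b bs ++ outerEdge r (last b bs)
  edges (cycle b bs)     = links b (bs ++ b ∷ [])

  deadBoxes : Block → List A
  deadBoxes (path false b [] false) = b ∷ []
  deadBoxes _                       = []

  data BlockCut : Block → List A → List Block → Set where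
    left  : ∀ {b bs r} → BlockCut (path true b bs r) (b ∷ []) (path false b bs r ∷ [])
    right : ∀ {l b bs} → BlockCut (path l b bs true) (last b bs ∷ []) (path l b bs false ∷ [])
    mid   : ∀ {l b r} xs y ys → BlockCut (path l b (xs ++ y ∷ ys) r) (last b xs ∷ y ∷ [])
              (path l b xs false ∷ path false y ys r ∷ [])
    -- The cycle is read as a closed walk from `b` back to `b`. When it is cut just before `y`, the
    -- part `y ∷ ys` ends in `b`, so the boxes `xs`, which follow `b` on the walk, continue it.
    unroll : ∀ {b bs xs y ys} → bs ++ b ∷ [] ≡ xs ++ y ∷ ys →
            BlockCut (cycle b bs) (last b xs ∷ y ∷ []) (path false y (ys ++ xs) false ∷ [])

  links-++ : ∀ b xs y ys → links b (xs ++ y ∷ ys) ≡ links b xs ++ (last b xs ∷ y ∷ []) ∷ links y ys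
  links-++ b []       y ys = refl
  links-++ b (x ∷ xs) y ys = cong (_ ∷_) (links-++ x xs y ys)

  last-++ : ∀ b xs y ys → last b (xs ++ y ∷ ys) ≡ last y ys
  last-++ b []       y ys = refl
  last-++ b (x ∷ xs) y ys = last-++ x xs y ys

  links-join : ∀ y ys xs → links y ys ++ links (last y ys) xs ≡ links y (ys ++ xs)
  links-join y []       xs = refl
  links-join y (_ ∷ ys) xs = cong (_ ∷_) (links-join _ ys xs)

  ∈-links : ∀ {e} b bs → e ∈ links b bs → ∃[ xs ] ∃[ y ] ∃[ ys ]
            bs ≡ xs ++ y ∷ ys × e ≡ last b xs ∷ y ∷ []
  ∈-links b (c ∷ bs) (here refl) = [] , c , bs , refl , refl
  ∈-links b (c ∷ bs) (there p) with ∈-links c bs p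
  ... | xs , y , ys , refl , refl = c ∷ xs , y , ys , refl , refl

  cut-shape : ∀ {p e qs} → BlockCut p e qs → Cut (shape p) (map shape qs)
  cut-shape left  = left
  cut-shape right = right
  cut-shape (mid {l} {_} {r} xs y ys)
    rewrite length-++ xs {y ∷ ys} | +-suc (length xs) (length ys) = mid (length xs) (length ys)
  cut-shape (unroll {b} {bs} {xs} {y} {ys} eq) =
    subst (λ n → Cut (cycle (length bs)) (path false n false ∷ [])) same unroll
    where
    open ≡-Reasoning
    same : length bs ≡ length (ys ++ xs)
    same = suc-injective (begin
      suc (length bs)             ≡⟨ +-comm 1 (length bs) ⟩
      length bs + 1               ≡⟨ length-++ bs ⟨
      length (bs ++ b ∷ [])       ≡⟨ cong length eq ⟩
      length (xs ++ y ∷ ys)       ≡⟨ length-++ xs ⟩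
      length xs + suc (length ys) ≡⟨ +-suc (length xs) (length ys) ⟩
      suc (length xs + length ys) ≡⟨ cong suc (+-comm (length xs) (length ys)) ⟩
      suc (length ys + length xs) ≡⟨ cong suc (length-++ ys) ⟨
      suc (length (ys ++ xs))     ∎)

  cut-edges : ∀ {p e qs} → BlockCut p e qs → edges p ↭ e ∷ concatMap edges qs
  cut-edges (left {b} {bs} {r}) = prep _ (↭-reflexive (sym (++-identityʳ _)))
  cut-edges (right {l} {b} {bs}) rewrite ++-identityʳ (links b bs) | ++-identityʳ (outerEdge l b ++ links b bs)
    | sym (++-assoc (outerEdge l b) (links b bs) ((last b bs ∷ []) ∷ [])) = ++-comm (outerEdge l b ++ links b bs) _
  cut-edges (mid {l} {b} {r} xs y ys)
    rewrite links-++ b xs y ys | last-++ b xs y ys | ++-identityʳ (links b xs)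
          | ++-identityʳ (links y ys ++ outerEdge r (last y ys))
          | ++-assoc (links b xs) ((last b xs ∷ y ∷ []) ∷ links y ys) (outerEdge r (last y ys))
          | sym (++-assoc (outerEdge l b) (links b xs) ((last b xs ∷ y ∷ []) ∷ links y ys ++ outerEdge r (last y ys)))
          = shift _ (outerEdge l b ++ links b xs) _
  cut-edges (unroll {b} {bs} {xs} {y} {ys} eq)
    rewrite ++-identityʳ (links y (ys ++ xs)) | ++-identityʳ (links y (ys ++ xs))
          | eq | links-++ b xs y ys | sym (links-join y ys xs)
          | trans (sym (last-++ b xs y ys)) (trans (cong (last b) (sym eq)) (last-++ b bs b []))
          = ↭-trans (shift _ (links b xs) (links y ys)) (prep _ (++-comm (links b xs) (links y ys)))

  cut-boxes : ∀ {p e qs} → BlockCut p e qs → boxes p ↭ concatMap boxes qs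
  cut-boxes (left {b} {bs}) = ↭-reflexive (sym (++-identityʳ _))
  cut-boxes right = ↭-reflexive (sym (++-identityʳ _))
  cut-boxes (mid {b = b} xs y ys) = ↭-reflexive (sym (cong (λ zs → b ∷ xs ++ y ∷ zs) (++-identityʳ ys)))
  cut-boxes (unroll {b} {bs} {xs} {y} {ys} eq) rewrite ++-identityʳ (ys ++ xs) =
    ↭-trans (++-comm (b ∷ []) bs) (↭-trans (↭-reflexive eq) (↭-trans (shift y xs ys) (prep y (++-comm xs ys))))

  ∈-edges⇒cut : ∀ {e} p → e ∈ edges p → ∃[ qs ] BlockCut p e qs
  ∈-edges⇒cut (path l b bs r) e∈ with ∈-++⁻ (outerEdge l b) e∈
  ∈-edges⇒cut (path true b bs r) e∈ | inj₁ (here refl) = _ , left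
  ... | inj₂ e∈′ with ∈-++⁻ (links b bs) e∈′
  ...   | inj₁ q with ∈-links b bs q
  ...     | xs , y , ys , refl , refl = _ , mid xs y ys
  ∈-edges⇒cut (path l b bs true) e∈ | inj₂ e∈′ | inj₂ (here refl) = _ , right
  ∈-edges⇒cut (cycle b bs) e∈ with ∈-links b (bs ++ b ∷ []) e∈
  ... | xs , y , ys , eq , refl = _ , unroll eq

  splitAt-length : ∀ m n (bs : List A) → length bs ≡ suc (m + n) →
    ∃[ xs ] ∃[ y ] ∃[ ys ] bs ≡ xs ++ y ∷ ys × length xs ≡ m × length ys ≡ n
  splitAt-length zero    n (b ∷ bs) eq = [] , b , bs , refl , refl , suc-injective eq
  splitAt-length (suc m) n (b ∷ bs) eq with splitAt-length m n bs (suc-injective eq)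
  ... | xs , y , ys , refl , refl , refl = b ∷ xs , y , ys , refl , refl , refl

  -- Strategies are described on shapes, where labels are lost; this recovers an actual line that
  -- produces the wanted pieces. The shape enters through an equation because in the case `mid` the
  -- number of boxes is only known to equal a sum.
  shape⇒cut : ∀ {P Qs} p → shape p ≡ P → Cut P Qs → ∃[ e ] ∃[ qs ] BlockCut p e qs × map shape qs ≡ Qs
  shape⇒cut (path l b bs r) eq left with path-injective eq
  ... | refl , refl , refl = _ , _ , left , refl
  shape⇒cut (path l b bs r) eq right with path-injective eq
  ... | refl , refl , refl = _ , _ , right , refl
  shape⇒cut (path l b bs r) eq (mid m n) with path-injective eq
  ... | refl , len , refl with splitAt-length m n bs len
  ...   | xs , y , ys , refl , refl , refl = _ , _ , mid xs y ys , refl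
  -- All lines of a cycle leave the same shape; the closing line is chosen.
  shape⇒cut (cycle b bs) refl unroll = _ , _ , unroll {xs = bs} {ys = []} refl , refl

  ∈-link⇒ : ∀ {a} b bs {x} → x ∈ links b bs → a ∈ x → a ∈ b ∷ bs
  ∈-link⇒ b (c ∷ bs) (here refl) (here refl)         = here refl
  ∈-link⇒ b (c ∷ bs) (here refl) (there (here refl)) = there (here refl)
  ∈-link⇒ b (c ∷ bs) (there p) q = there (∈-link⇒ c bs p q)

  last∈ : ∀ b bs → last b bs ∈ b ∷ bs
  last∈ b []       = here refl
  last∈ b (c ∷ bs) = there (last∈ c bs)

  ∈-edge⇒∈-boxes : ∀ {a e} p → e ∈ edges p → a ∈ e → a ∈ boxes p
  ∈-edge⇒∈-boxes (path l b bs r) e∈ a∈ with ∈-++⁻ (outerEdge l b) e∈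
  ∈-edge⇒∈-boxes (path true b bs r) e∈ (here refl) | inj₁ (here refl) = here refl
  ... | inj₂ e∈′ with ∈-++⁻ (links b bs) e∈′
  ...   | inj₁ q = ∈-link⇒ b bs q a∈
  ∈-edge⇒∈-boxes (path l b bs true) e∈ (here refl) | inj₂ e∈′ | inj₂ (here refl) = last∈ b bs
  ∈-edge⇒∈-boxes (cycle b bs) e∈ a∈ with ∈-++⁻ (b ∷ bs) (∈-link⇒ b (bs ++ b ∷ []) e∈ a∈)
  ... | inj₁ q           = q
  ... | inj₂ (here refl) = here refl

  linked : ∀ {a} b c bs → a ∈ b ∷ c ∷ bs → Any (a ∈_) (links b (c ∷ bs))
  linked b c bs       (here refl)          = here (here refl)
  linked b c bs       (there (here refl))  = here (there (here refl))
  linked b c (d ∷ bs) (there (there p))    = there (linked c d bs (there p))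

  covered : ∀ {a} p → a ∈ boxes p → a ∈ deadBoxes p ⊎ Any (a ∈_) (edges p)
  covered (path false b [] false) a∈          = inj₁ a∈
  covered (path true  b [] r)     (here refl) = inj₂ (here (here refl))
  covered (path false b [] true)  (here refl) = inj₂ (here (here refl))
  covered (path l b (c ∷ bs) r)   a∈          = inj₂ (Anyₚ.++⁺ʳ (outerEdge l b) (Anyₚ.++⁺ˡ (linked b c bs a∈)))
  covered (cycle b [])             (here refl) = inj₂ (here (here refl))
  covered (cycle b (c ∷ bs))       a∈          = inj₂ (linked b c (bs ++ b ∷ []) (∈-++⁺ˡ a∈))

  dead⇒no-edges : ∀ {a} p → a ∈ deadBoxes p → edges p ≡ []
  dead⇒no-edges (path false b [] false) _ = refl

  dead⇒∈ : ∀ {a} p → a ∈ deadBoxes p → a ∈ boxes p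
  dead⇒∈ (path false b [] false) a∈ = a∈

  length-dead : ∀ p → length (deadBoxes p) ≡ deads (shape p)
  length-dead (path false b [] false) = refl
  length-dead (path false b [] true) = refl
  length-dead (path false b (_ ∷ _) false) = refl
  length-dead (path false b (_ ∷ _) true) = refl
  length-dead (path true b bs r) = refl
  length-dead (cycle b bs) = refl

concatMap-↭ : ∀ {A B : Set} (f : A → List B) {xs ys} → xs ↭ ys → concatMap f xs ↭ concatMap f ys
concatMap-↭ f refl         = refl
concatMap-↭ f (prep x p)   = ++⁺ˡ (f x) (concatMap-↭ f p)
concatMap-↭ f (swap x y p) = trans↭ (++⁺ˡ (f x) (++⁺ˡ (f y) (concatMap-↭ f p))) (shifts (f x) (f y))
concatMap-↭ f (trans↭ p q)  = trans↭ (concatMap-↭ f p) (concatMap-↭ f q)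

Unique-resp : ∀ {A : Set} {xs ys : List A} → xs ↭ ys → Unique xs → Unique ys
Unique-resp p = Unique-resp-↭ (setoid _) (↭⇒↭ₛ p)

Unique-++⁻ : ∀ {A : Set} (xs : List A) {ys} → Unique (xs ++ ys) → Unique xs × Unique ys × Disjoint xs ys
Unique-++⁻ []       u = [] , u , λ ()
Unique-++⁻ (x ∷ xs) (x∉ ∷ u) with Unique-++⁻ xs u
... | uxs , uys , d = Allₚ.++⁻ˡ xs x∉ ∷ uxs , uys , λ where
  (here refl , q) → All.lookup (Allₚ.++⁻ʳ xs x∉) q refl
  (there p   , q) → d (p , q)

-- Positions as vectors of lines

private variable
  j k m n : ℕ

ends : Line n → List (Fin n)
ends (outer b)     = b ∷ []
ends (inner b c _) = b ∷ c ∷ []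

edgeList : Vec (Line n) k → List (List (Fin n))
edgeList ls = map ends (toList ls)

borders⇒∈ : ∀ {b : Fin n} l → Borders l b → b ∈ ends l
borders⇒∈ (outer _)     refl        = here refl
borders⇒∈ (inner _ _ _) (inj₁ refl) = here refl
borders⇒∈ (inner _ _ _) (inj₂ refl) = there (here refl)

∈⇒borders : ∀ {b : Fin n} l → b ∈ ends l → Borders l b
∈⇒borders (outer _)     (here refl)         = refl
∈⇒borders (inner _ _ _) (here refl)         = inj₁ refl
∈⇒borders (inner _ _ _) (there (here refl)) = inj₂ refl

degree≡0⇒ : ∀ {b : Fin n} (ls : Vec (Line n) k) → degree b ls ≡ 0 → ¬ Any (b ∈_) (edgeList ls)
degree≡0⇒ {b = b} (l ∷ ls) eq p with borders? b l
degree≡0⇒ (l ∷ ls) eq (here p)  | no ¬b = ¬b (∈⇒borders l p)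
degree≡0⇒ (l ∷ ls) eq (there p) | no ¬b = degree≡0⇒ ls eq p

⇒degree≡0 : ∀ {b : Fin n} (ls : Vec (Line n) k) → ¬ Any (b ∈_) (edgeList ls) → degree b ls ≡ 0
⇒degree≡0 [] _ = refl
⇒degree≡0 {b = b} (l ∷ ls) ¬p with borders? b l
... | yes q = ⊥-elim (¬p (here (borders⇒∈ l q)))
... | no _  = ⇒degree≡0 ls (¬p ∘ there)

edgeList-removeAt : ∀ (ls : Vec (Line n) (suc k)) i →
                    edgeList ls ↭ ends (lookup ls i) ∷ edgeList (removeAt ls i)
edgeList-removeAt (l ∷ ls)         zero    = refl
edgeList-removeAt (l ∷ ls@(_ ∷ _)) (suc i) = trans↭ (prep _ (edgeList-removeAt ls i)) (swap _ _ refl)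

∈-edgeList : ∀ {e} (ls : Vec (Line n) k) → e ∈ edgeList ls → ∃[ i ] ends (lookup ls i) ≡ e
∈-edgeList (l ∷ ls) (here refl) = zero , refl
∈-edgeList (l ∷ ls) (there p) with ∈-edgeList ls p
... | i , eq = suc i , eq

-- Two duplicate-free lists with the same members are permutations of each other. This turns the
-- count in `claimed` into the length of a list of dead boxes.
length-filter-allFin : ∀ {P : Fin n → Set} (P? : ∀ b → Dec (P b)) {bs} → Unique bs →
                       (∀ {b} → P b → b ∈ bs) → (∀ {b} → b ∈ bs → P b) →
                       length (filter P? (allFin n)) ≡ length bs
length-filter-allFin {n} P? u to from = ↭-length (∼bag⇒↭ (unique∧set⇒bag
  (Unique.filter⁺ P? (Unique.allFin⁺ n)) u
  (mk⇔ (λ b∈ → to (proj₂ (∈-filter⁻ P? {xs = allFin n} b∈))) (λ b∈ → ∈-filter⁺ P? (∈-allFin _) (from b∈)))))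

module _ {A : Set} where

  ∈-edges⇒∈-boxes : ∀ {a : A} S → Any (a ∈_) (concatMap edges S) → a ∈ concatMap boxes S
  ∈-edges⇒∈-boxes (p ∷ S) q with Anyₚ.++⁻ (edges p) q
  ... | inj₂ q′ = ∈-++⁺ʳ (boxes p) (∈-edges⇒∈-boxes S q′)
  ... | inj₁ q′ with find q′
  ...   | e , e∈ , a∈ = ∈-++⁺ˡ (∈-edge⇒∈-boxes p e∈ a∈)

  covered* : ∀ {a : A} S → a ∈ concatMap boxes S →
             a ∈ concatMap deadBoxes S ⊎ Any (a ∈_) (concatMap edges S)
  covered* (p ∷ S) a∈ with ∈-++⁻ (boxes p) a∈
  ... | inj₁ q = [ inj₁ ∘ ∈-++⁺ˡ , inj₂ ∘ Anyₚ.++⁺ˡ ] (covered p q)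
  ... | inj₂ q = [ inj₁ ∘ ∈-++⁺ʳ (deadBoxes p) , inj₂ ∘ Anyₚ.++⁺ʳ (edges p) ] (covered* S q)

  dead*⇒∈ : ∀ {a : A} S → a ∈ concatMap deadBoxes S → a ∈ concatMap boxes S
  dead*⇒∈ (p ∷ S) a∈ with ∈-++⁻ (deadBoxes p) a∈
  ... | inj₁ q = ∈-++⁺ˡ (dead⇒∈ p q)
  ... | inj₂ q = ∈-++⁺ʳ (boxes p) (dead*⇒∈ S q)

  -- A dead block has no edges of its own, and since labels are distinct across blocks, no other
  -- block can have an edge at its box.
  dead*-no-edges : ∀ {a : A} S → Unique (concatMap boxes S) →
                   a ∈ concatMap deadBoxes S → ¬ Any (a ∈_) (concatMap edges S)
  dead*-no-edges (p ∷ S) u a∈ q with Unique-++⁻ (boxes p) u | ∈-++⁻ (deadBoxes p) a∈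
  ... | _ , _ , disj | inj₁ d rewrite dead⇒no-edges p d = disj (dead⇒∈ p d , ∈-edges⇒∈-boxes S q)
  ... | _ , u′ , disj | inj₂ d with Anyₚ.++⁻ (edges p) q
  ...   | inj₂ q′ = dead*-no-edges S u′ d q′
  ...   | inj₁ q′ with find q′
  ...     | e , e∈ , a∈ = disj (∈-edge⇒∈-boxes p e∈ a∈ , dead*⇒∈ S d)

  unique-dead : ∀ {S : List (Block {A})} → Unique (concatMap boxes S) → Unique (concatMap deadBoxes S)
  unique-dead {[]}    u = []
  unique-dead {p ∷ S} u with Unique-++⁻ (boxes p) u
  ... | _ , u′ , disj = Unique.++⁺ (single p) (unique-dead {S} u′) λ (x , y) → disj (dead⇒∈ p x , dead*⇒∈ S y)
    where
    single : ∀ p → Unique (deadBoxes p)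
    single (path false b [] false)    = [] ∷ []
    single (path false b [] true)     = []
    single (path false b (_ ∷ _) _)   = []
    single (path true b bs r)         = []
    single (cycle b bs)                = []

  length-dead* : ∀ (S : List (Block {A})) → length (concatMap deadBoxes S) ≡ sum (map deads (map shape S))
  length-dead* []      = refl
  length-dead* (p ∷ S) = trans (length-++ (deadBoxes p)) (cong₂ _+_ (length-dead p) (length-dead* S))

-- Shapes are given up to order and edges as a multiset of bordered boxes, so any component can be
-- brought to the front without reordering the vector of lines.
record Depicts (ls : Vec (Line n) k) (T : List Shape) : Set where
  field
    blocks   : List (Block {Fin n})
    shapes   : map shape blocks ↭ T
    edges↭   : edgeList ls ↭ concatMap edges blocks
    distinct : Unique (concatMap boxes blocks)

depicts-resp : ∀ {ls : Vec (Line n) k} {T T′} → T ↭ T′ → Depicts ls T → Depicts ls T′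
depicts-resp p D = record { Depicts D; shapes = ↭-trans (Depicts.shapes D) p }

record Move (ls : Vec (Line n) (suc k)) (i : Fin (suc k)) (P : Shape) (R : List Shape) (Qs : List Shape) : Set where
  field
    cut     : Cut P Qs
    gained  : claimed (lookup ls i) (removeAt ls i) ≡ sum (map deads Qs)
    depicts : Depicts (removeAt ls i) (Qs ++ R)

module _ {ls : Vec (Line n) (suc k)} S {p qs} (i : Fin (suc k))
  (edges↭ : edgeList ls ↭ concatMap edges (p ∷ S)) (distinct : Unique (concatMap boxes (p ∷ S)))
  (c : BlockCut p (ends (lookup ls i)) qs) where

  private
    e : List (Fin n)
    e = ends (lookup ls i)

    rest : Vec (Line n) k
    rest = removeAt ls i

    edges′ : edgeList rest ↭ concatMap edges (qs ++ S)
    edges′ = drop-∷ (↭-trans (↭-sym (edgeList-removeAt ls i)) (↭-trans edges↭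
      (↭-trans (++⁺ʳ _ (cut-edges c)) (prep e (↭-reflexive (sym (concatMap-++ edges qs _)))))))

    distinct′ : Unique (concatMap boxes (qs ++ S))
    distinct′ = Unique-resp (↭-trans (++⁺ʳ _ (cut-boxes c)) (↭-reflexive (sym (concatMap-++ boxes qs _)))) distinct

    dead∈ : ∀ {b} → b ∈ concatMap deadBoxes qs → b ∈ concatMap deadBoxes (qs ++ S)
    dead∈ b∈ rewrite concatMap-++ deadBoxes qs S = ∈-++⁺ˡ b∈

    e∈p : e ∈ edges p
    e∈p = ∈-resp-↭ (↭-sym (cut-edges c)) (here refl)

    toDead : ∀ {b} → Borders (lookup ls i) b × degree b rest ≡ 0 → b ∈ concatMap deadBoxes qs
    toDead (bd , deg0)
      with covered* qs (∈-resp-↭ (cut-boxes c) (∈-edge⇒∈-boxes p e∈p (borders⇒∈ (lookup ls i) bd)))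
    ... | inj₁ d = d
    ... | inj₂ q = ⊥-elim (degree≡0⇒ rest deg0 (Any-resp-↭ (↭-sym edges′)
                     (subst (Any _) (sym (concatMap-++ edges qs _)) (Anyₚ.++⁺ˡ q))))

    fromDead : ∀ {b} → b ∈ concatMap deadBoxes qs → Borders (lookup ls i) b × degree b rest ≡ 0
    fromDead {b} b∈ = ∈⇒borders (lookup ls i) b∈e , ⇒degree≡0 rest (free ∘ Any-resp-↭ edges′)
      where
      free : ¬ Any (b ∈_) (concatMap edges (qs ++ S))
      free = dead*-no-edges (qs ++ S) distinct′ (dead∈ b∈)
      -- Before the move the box lay on some edge of its block; afterwards it lies on none, so that
      -- edge is the one that was drawn.
      b∈e : b ∈ e
      b∈e with covered p (∈-resp-↭ (↭-sym (cut-boxes c)) (dead*⇒∈ qs b∈))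
      ... | inj₁ d = ⊥-elim (nothing (subst (e ∈_) (dead⇒no-edges p d) e∈p))
        where
        nothing : ¬ e ∈ []
        nothing ()
      ... | inj₂ q with Any-resp-↭ (cut-edges c) q
      ...   | here q′  = q′
      ...   | there q′ = ⊥-elim (free (subst (Any _) (sym (concatMap-++ edges qs _)) (Anyₚ.++⁺ˡ q′)))

    claimed≡ : claimed (lookup ls i) rest ≡ sum (map deads (map shape qs))
    claimed≡ = trans
      (length-filter-allFin (λ b → borders? b (lookup ls i) ×-dec (degree b rest ≟ 0))
        (unique-dead {S = qs} (proj₁ (Unique-++⁻ (concatMap boxes qs) (subst Unique (concatMap-++ boxes qs _) distinct′))))
        toDead fromDead)
      (length-dead* qs)

  blockCut⇒move : Move ls i (shape p) (map shape S) (map shape qs)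
  blockCut⇒move = record
    { cut     = cut-shape c
    ; gained  = claimed≡
    ; depicts = record
      { blocks = qs ++ S ; shapes = ↭-reflexive (map-++ shape qs S) ; edges↭ = edges′ ; distinct = distinct′ }
    }

-- Lower bounds on `value` must examine every line, and this classifies them all. Upper bounds need
-- only one line with the wanted pieces, which `move-complete` provides.
move-sound : ∀ {ls : Vec (Line n) (suc k)} {T} → Depicts ls T → ∀ i →
             ∃[ P ] ∃[ R ] ∃[ Qs ] T ↭ P ∷ R × Move ls i P R Qs
move-sound {ls = ls} D i = go
  where
  open Depicts D
  go : _
  go with find (∈-concatMap⁻ edges {xs = blocks}
            (∈-resp-↭ (↭-trans (↭-sym (edgeList-removeAt ls i)) edges↭) (here refl)))
  ... | p , p∈ , e∈ with ∈-∃++ p∈ | ∈-edges⇒cut p e∈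
  ... | S₁ , S₂ , eq | qs , c = shape p , map shape (S₁ ++ S₂) , map shape qs ,
        ↭-trans (↭-sym shapes) (map⁺ shape front) , blockCut⇒move (S₁ ++ S₂) i
          (↭-trans edges↭ (concatMap-↭ edges front)) (Unique-resp (concatMap-↭ boxes front) distinct) c
    where
    front : blocks ↭ p ∷ S₁ ++ S₂
    front = ↭-trans (↭-reflexive eq) (shift p S₁ S₂)

no-lines : ∀ {ls : Vec (Line n) 0} {P R Qs} → Depicts ls (P ∷ R) → ¬ Cut P Qs
no-lines {ls = []} D c with ↭-map-inv shape (Depicts.shapes D)
... | p ∷ S , refl , bl↭ with shape⇒cut p refl c
... | e , qs , c′ , _ = nothing (∈-resp-↭ (↭-sym (↭-trans edges↭ (↭-trans (concatMap-↭ edges bl↭) (++⁺ʳ _ (cut-edges c′))))) (here refl))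
  where
  open Depicts D
  nothing : ¬ e ∈ []
  nothing ()

move-complete : ∀ {ls : Vec (Line n) (suc k)} {P R Qs} → Depicts ls (P ∷ R) → Cut P Qs →
                ∃[ i ] Move ls i P R Qs
move-complete {ls = ls} D c with ↭-map-inv shape (Depicts.shapes D)
... | p ∷ S , refl , bl↭ with shape⇒cut p refl c
... | e , qs , c′ , refl with ∈-edgeList ls (∈-resp-↭ (↭-sym (↭-trans (Depicts.edges↭ D)
                            (↭-trans (concatMap-↭ edges bl↭) (++⁺ʳ _ (cut-edges c′))))) (here refl))
... | i , refl = i , blockCut⇒move S i
          (↭-trans (Depicts.edges↭ D) (concatMap-↭ edges bl↭))
          (Unique-resp (concatMap-↭ boxes bl↭) (Depicts.distinct D)) c′

-- Relabelling, disjoint unions and the starting position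

module _ {A B : Set} (f : A → B) where

  mapBlock : Block {A} → Block {B}
  mapBlock (path l b bs r) = path l (f b) (map f bs) r
  mapBlock (cycle b bs)     = cycle (f b) (map f bs)

  shape-map : ∀ p → shape (mapBlock p) ≡ shape p
  shape-map (path l b bs r) = cong (λ n → path l n r) (length-map f bs)
  shape-map (cycle b bs)     = cong cycle (length-map f bs)

  boxes-map : ∀ p → boxes (mapBlock p) ≡ map f (boxes p)
  boxes-map (path _ _ _ _) = refl
  boxes-map (cycle _ _)     = refl

  links-map : ∀ b bs → links (f b) (map f bs) ≡ map (map f) (links b bs)
  links-map b []       = refl
  links-map b (c ∷ bs) = cong (_ ∷_) (links-map c bs)

  last-map : ∀ b bs → last (f b) (map f bs) ≡ f (last b bs)
  last-map b []       = refl
  last-map b (c ∷ bs) = last-map c bs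

  outerEdge-map : ∀ l b → outerEdge l (f b) ≡ map (map f) (outerEdge l b)
  outerEdge-map true  b = refl
  outerEdge-map false b = refl

  edges-map : ∀ p → edges (mapBlock p) ≡ map (map f) (edges p)
  edges-map (path l b bs r)
    rewrite map-++ (map f) (outerEdge l b) (links b bs ++ outerEdge r (last b bs))
          | map-++ (map f) (links b bs) (outerEdge r (last b bs))
          | outerEdge-map l b | links-map b bs | last-map b bs | outerEdge-map r (last b bs) = refl
  edges-map (cycle b bs) = trans (cong (links (f b)) (sym (map-++ f bs (b ∷ [])))) (links-map b (bs ++ b ∷ []))

  concatMap-map-blocks : ∀ {C D : Set} {g : Block → List C} {g′ : Block → List D} {h : D → C} →
    (∀ p → g (mapBlock p) ≡ map h (g′ p)) → ∀ S → concatMap g (map mapBlock S) ≡ map h (concatMap g′ S)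
  concatMap-map-blocks eq []      = refl
  concatMap-map-blocks {g′ = g′} {h} eq (p ∷ S) =
    trans (cong₂ _++_ (eq p) (concatMap-map-blocks eq S)) (sym (map-++ h (g′ p) (concatMap g′ S)))

  shapes-map : ∀ S → map shape (map mapBlock S) ≡ map shape S
  shapes-map S = trans (sym (map-∘ S)) (map-cong shape-map S)

ends-relabel : ∀ (f : Fin m → Fin n) .(inj : Injective _≡_ _≡_ f) l → ends (relabel f inj l) ≡ map f (ends l)
ends-relabel f inj (outer b)     = refl
ends-relabel f inj (inner b c _) = refl

edgeList-relabel : ∀ (f : Fin m → Fin n) .(inj : Injective _≡_ _≡_ f) (ls : Vec (Line m) k) →
                   edgeList (mapᵛ (relabel f inj) ls) ≡ map (map f) (edgeList ls)
edgeList-relabel f inj []       = refl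
edgeList-relabel f inj (l ∷ ls) = cong₂ _∷_ (ends-relabel f inj l) (edgeList-relabel f inj ls)

depicts-relabel : ∀ (f : Fin m → Fin n) (inj : Injective _≡_ _≡_ f) {ls : Vec (Line m) k} {T} →
                  Depicts ls T → Depicts (mapᵛ (relabel f inj) ls) T
depicts-relabel f inj {ls} D = record
  { blocks   = map (mapBlock f) blocks
  ; shapes   = ↭-trans (↭-reflexive (shapes-map f blocks)) shapes
  ; edges↭   = ↭-trans (↭-reflexive (edgeList-relabel f inj ls)) (↭-trans (map⁺ (map f) edges↭)
                 (↭-reflexive (sym (concatMap-map-blocks f (edges-map f) blocks))))
  ; distinct = subst Unique (sym (concatMap-map-blocks f (boxes-map f) blocks)) (Unique.map⁺ inj distinct)
  }
  where open Depicts D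

↑ˡ≢↑ʳ : (b : Fin m) (c : Fin n) → b ↑ˡ n ≢ m ↑ʳ c
↑ˡ≢↑ʳ {m} {n} b c eq
  with trans (sym (splitAt-↑ˡ m b n)) (trans (cong (splitAt m) eq) (splitAt-↑ʳ m n c))
... | ()

depicts-⊕ : ∀ {ls : Vec (Line m) j} {ls′ : Vec (Line n) k} {T T′} →
            Depicts ls T → Depicts ls′ T′ → Depicts (ls ⊕ˡ ls′) (T ++ T′)
depicts-⊕ {m = m} {n = n} {ls = ls} {ls′} D D′ = record
  { blocks   = L ++ R
  ; shapes   = ↭-trans (↭-reflexive (map-++ shape L R)) (++⁺ (Depicts.shapes Dˡ) (Depicts.shapes Dʳ))
  ; edges↭   = ↭-trans (↭-reflexive (trans (cong (map ends) (toList-++ (mapᵛ _ ls) _)) (map-++ ends (toList (mapᵛ _ ls)) _)))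
                 (↭-trans (++⁺ (Depicts.edges↭ Dˡ) (Depicts.edges↭ Dʳ)) (↭-reflexive (sym (concatMap-++ edges L _))))
  ; distinct = subst Unique (sym (concatMap-++ boxes L _)) (Unique.++⁺ (Depicts.distinct Dˡ) (Depicts.distinct Dʳ)
      λ (p , q) → disjoint (subst (_ ∈_) (concatMap-map-blocks (_↑ˡ n) (boxes-map (_↑ˡ n)) (Depicts.blocks D)) p)
                           (subst (_ ∈_) (concatMap-map-blocks (m ↑ʳ_) (boxes-map (m ↑ʳ_)) (Depicts.blocks D′)) q))
  }
  where
  Dˡ = depicts-relabel (_↑ˡ n) (↑ˡ-injective n _ _) D
  Dʳ = depicts-relabel (m ↑ʳ_) (↑ʳ-injective m _ _) D′
  L = Depicts.blocks Dˡ
  R = Depicts.blocks Dʳ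
  disjoint : ∀ {x xs ys} → x ∈ map (_↑ˡ n) xs → x ∈ map (m ↑ʳ_) ys → ⊥
  disjoint p q with ∈-map⁻ _ p | ∈-map⁻ _ q
  ... | b , _ , refl | c , _ , eq = ↑ˡ≢↑ʳ b c eq

links-tabulate : ∀ {A : Set} (f : Fin (suc k) → A) →
                 links (f zero) (tabulate (f ∘ suc)) ≡ tabulate (λ i → f (inject₁ i) ∷ f (suc i) ∷ [])
links-tabulate {zero}  f = refl
links-tabulate {suc k} f = cong (_ ∷_) (links-tabulate (f ∘ suc))

last-tabulate : ∀ {A : Set} (f : Fin (suc k) → A) → last (f zero) (tabulate (f ∘ suc)) ≡ f (fromℕ k)
last-tabulate {zero}  f = refl
last-tabulate {suc k} f = last-tabulate (f ∘ suc)

links-∷ʳ : ∀ {A : Set} (b : A) bs c → links b (bs ++ c ∷ []) ≡ links b bs ++ (last b bs ∷ c ∷ []) ∷ []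
links-∷ʳ b bs c = links-++ b bs c []

edgeList-tabulate : (f : Fin k → Line n) → edgeList (tabulateᵛ f) ≡ tabulate (ends ∘ f)
edgeList-tabulate {zero}  f = refl
edgeList-tabulate {suc k} f = cong (ends (f zero) ∷_) (edgeList-tabulate (f ∘ suc))

edgeList-∷ʳ : ∀ (ls : Vec (Line n) k) l → edgeList (ls ∷ʳ l) ≡ edgeList ls ++ ends l ∷ []
edgeList-∷ʳ ls l = trans (cong (map ends) (toList-∷ʳ l ls)) (map-++ ends (toList ls) (l ∷ []))

row : ∀ m → List (Fin (suc m))
row m = tabulate suc

unique-row : ∀ m → Unique (zero ∷ row m)
unique-row m = Unique.allFin⁺ (suc m)

row-edges : ∀ m l → edgeList (tabulateᵛ link ∷ʳ l) ≡ links zero (row m) ++ ends l ∷ []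
row-edges m l = trans (edgeList-∷ʳ (tabulateᵛ (link {m})) l)
  (cong (_++ ends l ∷ []) (trans (edgeList-tabulate link) (sym (links-tabulate (λ i → i)))))

depicts-chain : ∀ m → Depicts (chainLines m) (path true m true ∷ [])
depicts-chain m = record
  { blocks   = path true zero (row m) true ∷ []
  ; shapes   = ↭-reflexive (cong (λ n → path true n true ∷ []) (length-tabulate suc))
  ; edges↭   = ↭-reflexive (trans (cong ((zero ∷ []) ∷_) (trans (row-edges m (outer (fromℕ m)))
                 (cong (λ c → links zero (row m) ++ (c ∷ []) ∷ []) (sym (last-tabulate (λ i → i)))))) (sym (++-identityʳ _)))
  ; distinct = subst Unique (sym (++-identityʳ _)) (unique-row m)
  }

depicts-loop : ∀ m → Depicts (loopLines m) (cycle (suc m) ∷ [])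
depicts-loop m = record
  { blocks   = cycle zero (row (suc m)) ∷ []
  ; shapes   = ↭-reflexive (cong (λ n → cycle n ∷ []) (length-tabulate suc))
  ; edges↭   = ↭-reflexive (trans (row-edges (suc m) (inner (fromℕ (suc m)) zero (λ ()))) (trans
                 (trans (cong (λ c → links zero (row (suc m)) ++ (c ∷ zero ∷ []) ∷ []) (sym (last-tabulate (λ i → i))))
                   (sym (links-∷ʳ zero (row (suc m)) zero))) (sym (++-identityʳ _))))
  ; distinct = subst Unique (sym (++-identityʳ _)) (unique-row (suc m))
  }

depicts-∅ : Depicts (lines ∅) []
depicts-∅ = record { blocks = [] ; shapes = ↭-refl ; edges↭ = ↭-refl ; distinct = [] }

chainShape loopShape : ℕ → Shape
chainShape c = path true (pred c) true
loopShape  ℓ = cycle (pred ℓ)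

depicts-⟦⟧ : ∀ G → Depicts (lines ⟦ G ⟧) (map chainShape (chains G) ++ map loopShape (loops G))
depicts-⟦⟧ G = depicts-chains (chains≥ G)
  where
  depicts-loops : ∀ {ls} (ls≥ : All (λ ℓ → 4 ≤ᴺ ℓ × 2 ∣ᴺ ℓ) ls) →
    Depicts (lines (foldr _⊕_ ∅ (reduce (λ {ℓ} p → loop ℓ (proj₁ p)) ls≥))) (map loopShape ls)
  depicts-loops []               = depicts-∅
  depicts-loops {suc (suc m) ∷ _} ((s≤s (s≤s p) , _) ∷ ls≥) = depicts-⊕ (depicts-loop m) (depicts-loops ls≥)
  depicts-chains : ∀ {cs} (cs≥ : All (3 ≤ᴺ_) cs) →
    Depicts (lines (foldr _⊕_ ∅ (reduce (λ {c} 3≤c → chain c (ℕ.≤-trans (s≤s z≤n) 3≤c)) cs≥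
      ++ reduce (λ {ℓ} p → loop ℓ (proj₁ p)) (loops≥ G)))) (map chainShape cs ++ map loopShape (loops G))
  depicts-chains []               = depicts-loops (loops≥ G)
  depicts-chains {suc m ∷ _} (s≤s p ∷ cs≥) = depicts-⊕ (depicts-chain m) (depicts-chains cs≥)

-- Evaluation of positions

minimum-≤ : ∀ {k} (f : Fin (suc k) → ℤ) i → minimum f ≤ f i
minimum-≤ {zero}  f zero          = ≤-refl
-- The fold starts from `f zero`, so splitting off `f (suc zero)` leaves the minimum of `f` with the
-- entry at index one omitted.
minimum-≤ {suc k} f zero          = ≤-trans (i⊓j≤j (f (suc zero)) _) (minimum-≤ (λ { zero → f zero ; (suc i) → f (suc (suc i)) }) zero)
minimum-≤ {suc k} f (suc zero)    = i⊓j≤i _ _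
minimum-≤ {suc k} f (suc (suc i)) = ≤-trans (i⊓j≤j (f (suc zero)) _) (minimum-≤ (λ { zero → f zero ; (suc i) → f (suc (suc i)) }) (suc i))

minimum-glb : ∀ {k x} (f : Fin (suc k) → ℤ) → (∀ i → x ≤ f i) → x ≤ minimum f
minimum-glb {zero}  f below = below zero
minimum-glb {suc k} f below = ⊓-glb (below (suc zero))
  (minimum-glb (λ { zero → f zero ; (suc i) → f (suc (suc i)) }) λ { zero → below zero ; (suc i) → below (suc (suc i)) })

-- Chains are ended by an offer of two boxes and loops by an offer of four, a swing of 4 and 8.
closed : Shape → List Component
closed (path true n true) = (4 , suc n) ∷ []
closed (cycle n)          = (8 , suc n) ∷ []
closed _                  = []

-- The unclaimed boxes outside intact chains and loops.
live : Shape → ℕ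
live (path true  n       true)  = 0
live (path true  n       false) = suc n
live (path false n       true)  = suc n
live (path false zero    false) = 0
live (path false (suc n) false) = suc (suc n)
live (cycle n)                  = 0

closed* : List Shape → List Component
closed* = concatMap closed

live* deads* : List Shape → ℕ
live*  T = sum (map live T)
deads* T = sum (map deads T)

-- Shapes that allow the turn to be passed by offering two, respectively four, boxes.
data Half : Shape → Set where
  halfˡ : ∀ {n} → Half (path true (suc n) false)
  halfʳ : ∀ {n} → Half (path false (suc n) true)

data Bare : Shape → Set where
  bareˡʳ : ∀ {n} → Bare (path false (suc (suc (suc n))) false)

-- With `suc n` boxes these are chains of length at least 3 and loops of length at least 4. A
-- 2-chain cut in the middle, or a 3-loop cut anywhere, would leave the replier without an offer.
Loony : Shape → Set
Loony (path true n true) = 2 ≤ᴺ n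
Loony (cycle n)          = 3 ≤ᴺ n
Loony _                  = ⊤

-- The last argument of `four` is essential: if two boxes could be offered after a loop is opened,
-- the replier would obtain n - 4 + w, which exceeds `opened (8 , n) w` as soon as w > 2.
data Released (d : ℕ) (Qs : List Shape) : Set where
  two  : d ≡ 4 → Any Half Qs → Released d Qs
  four : d ≡ 8 → Any Bare Qs → ¬ Any Half Qs → Released d Qs

record Opening (d n : ℕ) (Qs : List Shape) : Set where
  field
    no-deads  : deads* Qs ≡ 0
    all-live  : live* Qs ≡ n
    no-closed : closed* Qs ≡ []
    loony     : All Loony Qs
    released  : Released d Qs

-- By `captures`, capturing never creates a new offer. By `quiet`, a cut that claims nothing exists
-- only in a shape that can still make an offer and has at least as many boxes as the offer gives
-- away. Together these show that no line of a broken shape beats the standard options.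
record Breaking (P : Shape) (Qs : List Shape) : Set where
  field
    shrinks   : live* Qs + deads* Qs ≡ live P
    no-closed : closed* Qs ≡ []
    loony     : All Loony Qs
    captures  : ∀ {c} → deads* Qs ≡ suc c → (Any Half Qs → Half P) × (Any Bare Qs → Bare P)
    quiet     : deads* Qs ≡ 0 → (Half P × 2 ≤ᴺ live P) ⊎ (Bare P × 4 ≤ᴺ live P)

data CutKind (P : Shape) (Qs : List Shape) : Set where
  opens  : ∀ d n → closed P ≡ (d , n) ∷ [] → live P ≡ 0 → Opening d n Qs → CutKind P Qs
  breaks : closed P ≡ [] → Breaking P Qs → CutKind P Qs

cut-kind : ∀ {P Qs} → Loony P → Cut P Qs → CutKind P Qs
cut-kind {path true (suc n) true} p left = opens 4 _ refl refl record
  { no-deads = refl ; all-live = +-identityʳ _ ; no-closed = refl ; loony = tt ∷ [] ; released = two refl (here halfʳ) }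
cut-kind {path true (suc n) true} p right = opens 4 _ refl refl record
  { no-deads = refl ; all-live = +-identityʳ _ ; no-closed = refl ; loony = tt ∷ [] ; released = two refl (here halfˡ) }
cut-kind {path true _ true} p (mid (suc m) n) = opens 4 _ refl refl record
  { no-deads = refl
  ; all-live = cong (λ k → suc (suc m + k)) (+-identityʳ (suc n))  ⟨ trans ⟩ cong (λ k → suc (suc k)) (+-suc m n)
  ; no-closed = refl ; loony = tt ∷ tt ∷ [] ; released = two refl (here halfˡ) }
cut-kind {path true _ true} (s≤s p) (mid zero (suc n)) = opens 4 _ refl refl record
  { no-deads = refl ; all-live = cong suc (+-identityʳ _) ; no-closed = refl ; loony = tt ∷ tt ∷ []
  ; released = two refl (there (here halfʳ)) }
cut-kind {path true _ true} (s≤s ()) (mid zero zero)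
cut-kind {cycle (suc (suc (suc n)))} p unroll = opens 8 _ refl refl record
  { no-deads = refl ; all-live = +-identityʳ _ ; no-closed = refl ; loony = tt ∷ [] ; released = four refl (here bareˡʳ)
    λ { (here ()) ; (there ()) } }
cut-kind {cycle (suc (suc zero))} (s≤s (s≤s ())) unroll
cut-kind {cycle (suc zero)} (s≤s ()) unroll
cut-kind {path true zero false} _ left = breaks refl record
  { shrinks = refl ; no-closed = refl ; loony = tt ∷ []
  ; captures = λ _ → (λ { (here ()) ; (there ()) }) , λ { (here ()) ; (there ()) } ; quiet = λ () }
cut-kind {path true (suc n) false} _ left = breaks refl record
  { shrinks = trans (+-identityʳ _) (+-identityʳ _) ; no-closed = refl ; loony = tt ∷ []
  ; captures = λ () ; quiet = λ _ → inj₁ (halfˡ , s≤s (s≤s z≤n)) }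
cut-kind {path true _ false} _ (mid m zero) = breaks refl record
  { shrinks = +-comm (suc m + 0) 1 ; no-closed = refl ; loony = tt ∷ tt ∷ []
  ; captures = λ _ → (λ { (here halfˡ) → halfˡ ; (there (here ())) ; (there (there ())) })
                    , (λ { (here ()) ; (there (here ())) ; (there (there ())) })
  ; quiet = λ () }
cut-kind {path true _ false} _ (mid m (suc n)) = breaks refl record
  { shrinks = trans (+-identityʳ _) (cong (λ k → suc (m + k)) (+-identityʳ _) ⟨ trans ⟩ cong suc (+-suc m (suc n)))
  ; no-closed = refl ; loony = tt ∷ tt ∷ []
  ; captures = λ () ; quiet = λ _ → inj₁ (halfˡ , s≤s (s≤s z≤n)) }
cut-kind {path false zero true} _ right = breaks refl record
  { shrinks = refl ; no-closed = refl ; loony = tt ∷ []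
  ; captures = λ _ → (λ { (here ()) ; (there ()) }) , λ { (here ()) ; (there ()) } ; quiet = λ () }
cut-kind {path false (suc n) true} _ right = breaks refl record
  { shrinks = trans (+-identityʳ _) (+-identityʳ _) ; no-closed = refl ; loony = tt ∷ []
  ; captures = λ () ; quiet = λ _ → inj₁ (halfʳ , s≤s (s≤s z≤n)) }
cut-kind {path false _ true} _ (mid zero n) = breaks refl record
  { shrinks = trans (cong (_+ 1) (+-identityʳ (suc n))) (+-comm (suc n) 1) ; no-closed = refl ; loony = tt ∷ tt ∷ []
  ; captures = λ _ → (λ { (here ()) ; (there (here halfʳ)) → halfʳ ; (there (there ())) })
                    , (λ { (here ()) ; (there (here ())) ; (there (there ())) })
  ; quiet = λ () }
cut-kind {path false _ true} _ (mid (suc m) n) = breaks refl record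
  { shrinks = trans (+-identityʳ _) (cong (λ k → suc (suc (m + k))) (+-identityʳ (suc n)) ⟨ trans ⟩ cong (λ k → suc (suc k)) (+-suc m n))
  ; no-closed = refl ; loony = tt ∷ tt ∷ []
  ; captures = λ () ; quiet = λ _ → inj₁ (halfʳ , s≤s (s≤s z≤n)) }
cut-kind {path false _ false} _ (mid zero zero) = breaks refl record
  { shrinks = refl ; no-closed = refl ; loony = tt ∷ tt ∷ []
  ; captures = λ _ → (λ { (here ()) ; (there (here ())) ; (there (there ())) })
                    , (λ { (here ()) ; (there (here ())) ; (there (there ())) })
  ; quiet = λ () }
cut-kind {path false _ false} _ (mid zero (suc n)) = breaks refl record
  { shrinks = trans (cong (_+ 1) (+-identityʳ (suc (suc n)))) (+-comm (suc (suc n)) 1) ; no-closed = refl ; loony = tt ∷ tt ∷ []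
  ; captures = λ _ → (λ { (here ()) ; (there (here ())) ; (there (there ())) })
                    , (λ { (here ()) ; (there (here bareˡʳ)) → bareˡʳ ; (there (there ())) })
  ; quiet = λ () }
cut-kind {path false _ false} _ (mid (suc m) zero) = breaks refl record
  { shrinks = +-comm (suc (suc m) + 0) 1 ; no-closed = refl ; loony = tt ∷ tt ∷ []
  ; captures = λ _ → (λ { (here ()) ; (there (here ())) ; (there (there ())) })
                    , (λ { (here bareˡʳ) → bareˡʳ ; (there (here ())) ; (there (there ())) })
  ; quiet = λ () }
cut-kind {path false _ false} _ (mid (suc m) (suc n)) rewrite +-suc m n = breaks refl record
  { shrinks = trans (+-identityʳ _) (cong (λ k → suc (suc (m + k))) (+-identityʳ (suc (suc n)))
      ⟨ trans ⟩ cong (λ k → suc (suc k)) (trans (+-suc m (suc n)) (cong suc (+-suc m n))))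
  ; no-closed = refl ; loony = tt ∷ tt ∷ []
  ; captures = λ () ; quiet = λ _ → inj₂ (bareˡʳ , s≤s (s≤s (s≤s (s≤s z≤n)))) }


-- This is the minimum of up to three numbers, given by its universal property: the available ones
-- bound `V` from above, and whatever lies below all of them lies below `V`. Thus it never has to be
-- decided which offers exist. The parameters `w` and `k` are separate from `T` so that they can be
-- rewritten independently of it.
record EvaluatedAt (V w k : ℤ) (T : List Shape) : Set where
  field
    take  : V ≤ w -ℤ k
    half  : Any Half T → V ≤ + 4 -ℤ w -ℤ k
    bare  : Any Bare T → V ≤ + 8 -ℤ w -ℤ k
    above : ∀ x → x ≤ w -ℤ k → (Any Half T → x ≤ + 4 -ℤ w -ℤ k) → (Any Bare T → x ≤ + 8 -ℤ w -ℤ k) → x ≤ V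

Evaluated : ℤ → List Shape → Set
Evaluated V T = EvaluatedAt V (W (closed* T)) (+ live* T) T

live*-++ : ∀ Qs R → live* (Qs ++ R) ≡ live* Qs + live* R
live*-++ Qs R = trans (cong sum (map-++ live Qs R)) (sum-++ (map live Qs) (map live R))

live*-↭ : ∀ {T T′} → T ↭ T′ → live* T ≡ live* T′
live*-↭ p = sum-↭ (map⁺ live p)

closed*-++ : ∀ {Qs} R → closed* Qs ≡ [] → closed* (Qs ++ R) ≡ closed* R
closed*-++ {Qs} R eq = trans (concatMap-++ closed Qs _) (cong (_++ closed* R) eq)

half⇒live : ∀ {P} → Half P → ∃[ l ] live P ≡ suc l
half⇒live halfˡ = _ , refl
half⇒live halfʳ = _ , refl

bare⇒live : ∀ {P} → Bare P → ∃[ l ] live P ≡ suc l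
bare⇒live bareˡʳ = _ , refl

no-live : ∀ {X : Shape → Set} → (∀ {P} → X P → ∃[ l ] live P ≡ suc l) → ∀ {T} → live* T ≡ 0 → ¬ Any X T
no-live f {P ∷ T} eq (here p) with f p
... | l , eq′ with trans (sym eq′) (m+n≡0⇒m≡0 (live P) eq)
...   | ()
no-live f {P ∷ T} eq (there q) = no-live f (m+n≡0⇒n≡0 (live P) eq) q

no-half : ∀ {T} → live* T ≡ 0 → ¬ Any Half T
no-half = no-live half⇒live

no-bare : ∀ {T} → live* T ≡ 0 → ¬ Any Bare T
no-bare = no-live bare⇒live

∈⇒↭ : ∀ {A : Set} {x : A} {xs} → x ∈ xs → ∃[ r ] xs ↭ x ∷ r
∈⇒↭ x∈ with ∈-∃++ x∈
... | S₁ , S₂ , refl = S₁ ++ S₂ , shift _ S₁ S₂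

live⇒∈ : ∀ {l} T → live* T ≡ suc l → ∃[ P ] P ∈ T × ∃[ m ] live P ≡ suc m
live⇒∈ (P ∷ T) eq with live P in lp
... | suc m = P , here refl , m , lp
... | zero with live⇒∈ T eq
...   | Q , Q∈ , m = Q , there Q∈ , m

dead-or-cut : ∀ P → P ≡ path false 0 false ⊎ ∃[ Qs ] Cut P Qs
dead-or-cut (path true n r)            = inj₂ (_ , left)
dead-or-cut (path false n true)        = inj₂ (_ , right)
dead-or-cut (path false zero false)    = inj₁ refl
dead-or-cut (path false (suc n) false) = inj₂ (_ , mid 0 n)
dead-or-cut (cycle n)                  = inj₂ (_ , unroll)

lastBox : ∀ l n → Cut (path l (suc n) false) (path l n false ∷ path false 0 false ∷ [])
lastBox l n = subst (λ m → Cut (path l (suc m) false) (path l n false ∷ path false 0 false ∷ [])) (+-identityʳ n) (mid n 0)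

capture : ∀ P {m} → live P ≡ suc m → ∃[ Qs ] ∃[ c ] Cut P Qs × deads* Qs ≡ suc c
capture (path true zero false)     _ = _ , _ , left , refl
capture (path true (suc n) false)  _ = _ , _ , lastBox true n , refl
capture (path false zero true)     _ = _ , _ , right , refl
capture (path false (suc n) true)  _ = _ , _ , mid 0 n , refl
capture (path false (suc n) false) _ = _ , _ , mid 0 n , refl

-- As long as the shape is longer than necessary, one box is captured and the offer stays possible.
-- At the minimal length the remaining `h` boxes are handed over as pieces of two boxes joined by a
-- line, from which no counter-offer can be made.
data Offer (X : Shape → Set) (h : ℕ) (P : Shape) : Set where
  approach : ∀ {Qs c} → Cut P Qs → deads* Qs ≡ suc c → Any X Qs → Offer X h P
  hand     : ∀ {Qs} → Cut P Qs → deads* Qs ≡ 0 → live* Qs ≡ h → closed P ≡ [] → ¬ Any Half Qs → ¬ Any Bare Qs → Offer X h P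

offer-half : ∀ {P} → Half P → Offer Half 2 P
offer-half (halfˡ {zero})  = hand left refl refl refl (λ { (here ()) ; (there ()) }) (λ { (here ()) ; (there ()) })
offer-half (halfˡ {suc n}) = approach (lastBox true (suc n)) refl (here halfˡ)
offer-half (halfʳ {zero})  = hand right refl refl refl (λ { (here ()) ; (there ()) }) (λ { (here ()) ; (there ()) })
offer-half (halfʳ {suc n}) = approach (mid 0 (suc n)) refl (there (here halfʳ))

offer-bare : ∀ {P} → Bare P → Offer Bare 4 P
offer-bare (bareˡʳ {zero})  = hand (mid 1 1) refl refl refl
  (λ { (here ()) ; (there (here ())) ; (there (there ())) }) (λ { (here ()) ; (there (here ())) ; (there (there ())) })
offer-bare (bareˡʳ {suc n}) = approach (mid 0 (3 + n)) refl (there (here bareˡʳ))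

closed-release : ∀ P {c} → closed P ≡ c ∷ [] → ∃[ Qs ] Cut P Qs
closed-release (path true n true) _ = _ , left
closed-release (cycle n) _ = _ , unroll

breaking-at : ∀ {V P Qs R} → closed P ≡ [] → Breaking P Qs → Evaluated V (Qs ++ R) →
              EvaluatedAt V (W (closed* (P ∷ R))) (+ (live* Qs + live* R)) (Qs ++ R)
breaking-at {V} {P} {Qs} {R} eq B = subst₂ (λ G k → EvaluatedAt V (W G) (+ k) (Qs ++ R))
  (trans (closed*-++ {Qs} R (Breaking.no-closed B)) (cong (_++ closed* R) (sym eq))) (live*-++ Qs R)

opening-at : ∀ {V d n Qs R} → Opening d n Qs → Evaluated V (Qs ++ R) →
             EvaluatedAt V (W (closed* R)) (+ (n + live* R)) (Qs ++ R)
opening-at {V} {d} {n} {Qs} {R} O = subst₂ (λ G k → EvaluatedAt V (W G) (+ k) (Qs ++ R))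
  (closed*-++ {Qs} R (Opening.no-closed O)) (trans (live*-++ Qs R) (cong (_+ live* R) (Opening.all-live O)))

capture-shift : ∀ a V k c {l} → k + c ≡ l → V ≤ a -ℤ + k → V -ℤ + c ≤ a -ℤ + l
capture-shift a V k c refl V≤ = ≤-by V≤ (lemma a (+ k) V (+ c))
  where
  lemma : ∀ a k V c → (a -ℤ (k +ℤ c)) -ℤ (V -ℤ c) ≡ (a -ℤ k) -ℤ V
  lemma = solve-∀

capture-shift⁻ : ∀ a x k c {l} → k + c ≡ l → x ≤ a -ℤ + l → x +ℤ + c ≤ a -ℤ + k
capture-shift⁻ a x k c refl x≤ = ≤-by x≤ (lemma a (+ k) x (+ c))
  where
  lemma : ∀ a k x c → (a -ℤ k) -ℤ (x +ℤ c) ≡ (a -ℤ (k +ℤ c)) -ℤ x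
  lemma = solve-∀

shrinks+ : ∀ {P Qs} c R → Breaking P Qs → deads* Qs ≡ c → live* Qs + live* R + c ≡ live* (P ∷ R)
shrinks+ {P} {Qs} c R B refl = begin
  live* Qs + live* R + deads* Qs   ≡⟨ +-assoc (live* Qs) (live* R) (deads* Qs) ⟩
  live* Qs + (live* R + deads* Qs) ≡⟨ cong (λ m → live* Qs + m) (+-comm (live* R) (deads* Qs)) ⟩
  live* Qs + (deads* Qs + live* R) ≡⟨ +-assoc (live* Qs) (deads* Qs) (live* R) ⟨
  live* Qs + deads* Qs + live* R   ≡⟨ cong (_+ live* R) (Breaking.shrinks B) ⟩
  live P + live* R                 ∎
  where open ≡-Reasoning

opened-≥ˡ : ∀ d n w → + n -ℤ w ≤ opened (d , n) w
opened-≥ˡ d n w = i≤i⊔j _ _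

opened-≥ʳ : ∀ d n w → + n -ℤ + d +ℤ w ≤ opened (d , n) w
opened-≥ʳ d n w = i≤j⊔i _ _

flip-≤ : ∀ {a b c} → a ≤ b → c ≡ - a → - b ≤ c
flip-≤ {a} {b} a≤b refl = ≤-by a≤b (lemma a b)
  where
  lemma : ∀ a b → - a -ℤ - b ≡ b -ℤ a
  lemma = solve-∀

-- V′ below is the value after a component (d , n) has been opened next to kR live boxes.
opened-reply : ∀ {x w d n w′ V′} kR → x ≤ w -ℤ + kR → w ≤ opened (d , n) w′ →
               V′ ≤ w′ -ℤ + (n + kR) → V′ ≤ + d -ℤ w′ -ℤ + (n + kR) → x ≤ - V′
opened-reply {x} {w} {d} {n} {w′} {V′} kR x≤ w≤ t r
  with ⊔-sel (+ n -ℤ w′) (+ n -ℤ + d +ℤ w′)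
... | inj₁ eq = ≤-by (+-mono-≤ (+-mono-≤ x≤ (subst (w ≤_) eq w≤)) (+-mono-≤ t (+≤+ (z≤n {kR + kR}))))
                     (lemma x w (+ kR) (+ n) w′ V′)
  where
  lemma : ∀ x w k n w′ V → - V -ℤ x ≡
    (w -ℤ k +ℤ (n -ℤ w′) +ℤ (w′ -ℤ (n +ℤ k) +ℤ (k +ℤ k))) -ℤ (x +ℤ w +ℤ (V +ℤ + 0))
  lemma = solve-∀
... | inj₂ eq = ≤-by (+-mono-≤ (+-mono-≤ x≤ (subst (w ≤_) eq w≤)) (+-mono-≤ r (+≤+ (z≤n {kR + kR}))))
                     (lemma x w (+ kR) (+ n) (+ d) w′ V′)
  where
  lemma : ∀ x w k n d w′ V → - V -ℤ x ≡
    (w -ℤ k +ℤ (n -ℤ d +ℤ w′) +ℤ (d -ℤ w′ -ℤ (n +ℤ k) +ℤ (k +ℤ k))) -ℤ (x +ℤ w +ℤ (V +ℤ + 0))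
  lemma = solve-∀

-- Induction on the number of undrawn lines

module _ {n k} (ls : Vec (Line n) (suc k))
  (ih : ∀ (ls′ : Vec (Line n) k) {T} → Depicts ls′ T → All Loony T → Evaluated (value ls′) T) where

  private
    score : Fin (suc k) → ℤ
    score i = moveValue (claimed (lookup ls i) (removeAt ls i)) (value (removeAt ls i))

  after : ∀ {i P R Qs} → All Loony (P ∷ R) → Move ls i P R Qs → Evaluated (value (removeAt ls i)) (Qs ++ R)
  after {i} (p ∷ r) M with cut-kind p (Move.cut M)
  ... | opens _ _ _ _ O = ih (removeAt ls i) (Move.depicts M) (Allₚ.++⁺ (Opening.loony O) r)
  ... | breaks _ B      = ih (removeAt ls i) (Move.depicts M) (Allₚ.++⁺ (Breaking.loony B) r)

  value-≤ : ∀ {P R Qs c x} → Depicts ls (P ∷ R) → All Loony (P ∷ R) → Cut P Qs → deads* Qs ≡ c →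
            (∀ V → Evaluated V (Qs ++ R) → moveValue c V ≤ x) → value ls ≤ x
  value-≤ {x = x} D L c refl bound with move-complete {ls = ls} D c
  ... | i , M = ≤-trans (minimum-≤ score i)
    (subst (λ g → moveValue g (value (removeAt ls i)) ≤ x) (sym (Move.gained M)) (bound _ (after L M)))

  -- In use, `f w` is w, 4 - w or 8 - w. A capture lowers the value and the number of live boxes by
  -- the same amount, so all three bounds pass from the smaller position in the same way.
  capture-≤ : ∀ {P R Qs c} → Depicts ls (P ∷ R) → All Loony (P ∷ R) → Cut P Qs → deads* Qs ≡ suc c →
              ∀ (f : ℤ → ℤ) → (∀ {V k T w} → EvaluatedAt V w k T → T ≡ Qs ++ R → V ≤ f w -ℤ k) →
              value ls ≤ f (W (closed* (P ∷ R))) -ℤ + live* (P ∷ R)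
  capture-≤ {P} {R} {Qs} D L@(p ∷ _) c dead f field≤ with cut-kind p c
  ... | opens _ _ _ _ O with trans (sym dead) (Opening.no-deads O)
  ...   | ()
  capture-≤ {P} {R} {Qs} D L@(p ∷ _) c dead f field≤ | breaks eq B = value-≤ D L c dead λ V E →
    capture-shift (f (W (closed* (P ∷ R)))) V (live* Qs + live* R) _ (shrinks+ {P} {Qs} _ R B dead)
      (field≤ (breaking-at {P = P} {Qs} eq B E) refl)

  take-live : ∀ {P R m} → Depicts ls (P ∷ R) → All Loony (P ∷ R) → live P ≡ suc m →
              value ls ≤ W (closed* (P ∷ R)) -ℤ + live* (P ∷ R)
  take-live {P} D L lp with capture P lp
  ... | Qs , c , cut , dead = capture-≤ D L cut dead (λ w → w) λ { E refl → EvaluatedAt.take E }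

  take-open : ∀ {P R c G} → Depicts ls (P ∷ R) → All Loony (P ∷ R) → live* (P ∷ R) ≡ 0 →
              closed P ≡ c ∷ [] → closed* R ↭ G → value ls ≤ opened c (W G)
  take-open {P} {R} {G = G} D L@(p ∷ _) lk cl R↭ with closed-release P cl
  ... | Qs , cut with cut-kind p cut
  ...   | breaks eq _ with trans (sym eq) cl
  ...     | ()
  take-open {P} {R} {G = G} D L@(p ∷ _) lk cl R↭ | Qs , cut | opens d m eq l0 O with trans (sym eq) cl
  ... | refl = value-≤ D L cut (Opening.no-deads O) λ V E → flip-reply V (opening-at O E)
    where
    o : ℤ
    o = opened (d , m) (W G)

    lR : live* R ≡ 0
    lR = m+n≡0⇒n≡0 (live P) lk

    half-bound : ∀ {Qs} → Released d Qs → Any Half (Qs ++ R) → + m -ℤ + 4 +ℤ W G ≤ o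
    half-bound (two refl _) _ = opened-≥ʳ 4 m (W G)
    half-bound {Qs} (four _ _ ¬half) h with Anyₚ.++⁻ Qs h
    ... | inj₁ q = ⊥-elim (¬half q)
    ... | inj₂ q = ⊥-elim (no-half lR q)

    bare-bound : ∀ {Qs} → Released d Qs → + m -ℤ + 8 +ℤ W G ≤ o
    bare-bound (four refl _ _) = opened-≥ʳ 8 m (W G)
    bare-bound (two refl _) = ≤-trans (≤-by (+≤+ (z≤n {4})) (lemma (+ m) (W G))) (opened-≥ʳ 4 m (W G))
      where
      lemma : ∀ m w → m -ℤ + 4 +ℤ w -ℤ (m -ℤ + 8 +ℤ w) ≡ + 4 -ℤ + 0
      lemma = solve-∀

    -- The numbers listed by `above` are the negatives of m - w, m - 4 + w and m - 8 + w, and `o`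
    -- dominates each of these that is available to the replier. Hence - `o` is a lower bound of
    -- `V`.
    flip-reply : ∀ V → EvaluatedAt V (W (closed* R)) (+ (m + live* R)) (Qs ++ R) → - V ≤ o
    flip-reply V E rewrite lR | +-identityʳ m | W-resp-↭ R↭ = ≤-by (EvaluatedAt.above E (- o)
        (flip-≤ (opened-≥ˡ d m (W G)) (lemma₁ (+ m) (W G)))
        (λ h → flip-≤ (half-bound (Opening.released O) h) (lemma₂ (+ 4) (+ m) (W G)))
        (λ _ → flip-≤ (bare-bound (Opening.released O)) (lemma₂ (+ 8) (+ m) (W G)))) (lemma₃ V o)
      where
      lemma₁ : ∀ m w → w -ℤ m ≡ - (m -ℤ w)
      lemma₁ = solve-∀
      lemma₂ : ∀ d m w → d -ℤ w -ℤ m ≡ - (m -ℤ d +ℤ w)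
      lemma₂ = solve-∀
      lemma₃ : ∀ V o → o -ℤ - V ≡ V -ℤ - o
      lemma₃ = solve-∀

  -- Some line is undrawn. Its cut either opens an intact component or breaks a shape without live
  -- boxes; the latter claims nothing, and `quiet` would demand at least two live boxes.
  take-none : ∀ {T} → Depicts ls T → All Loony T → live* T ≡ 0 → closed* T ≡ [] → ⊥
  take-none D L lk cl with move-sound D zero
  ... | P , R , Qs , T↭ , M with All-resp-↭ T↭ L
  ... | p ∷ _ with cut-kind p (Move.cut M)
  ...   | opens _ _ eq _ _ = nonempty (↭-empty-inv (↭-trans (↭-sym (concatMap-↭ closed T↭)) (↭-reflexive cl)))
    where
    nonempty : closed P ++ closed* R ≡ [] → ⊥
    nonempty e rewrite eq with e
    ... | ()
  ...   | breaks _ B = dead-cut (Breaking.quiet B (m+n≡0⇒n≡0 (live* Qs) (trans (Breaking.shrinks B) lP)))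
    where
    lP : live P ≡ 0
    lP = m+n≡0⇒m≡0 (live P) (trans (sym (live*-↭ T↭)) lk)
    dead-cut : (Half P × 2 ≤ᴺ live P) ⊎ (Bare P × 4 ≤ᴺ live P) → ⊥
    dead-cut q rewrite lP with q
    ... | inj₁ (_ , ())
    ... | inj₂ (_ , ())

  transport : ∀ {T T′} (f : ℤ → ℤ) → T ↭ T′ → value ls ≤ f (W (closed* T′)) -ℤ + live* T′ →
              value ls ≤ f (W (closed* T)) -ℤ + live* T
  transport f p = subst₂ (λ w k → value ls ≤ f w -ℤ + k)
    (W-resp-↭ (concatMap-↭ closed (↭-sym p))) (live*-↭ (↭-sym p))

  take≤ : ∀ {T} → Depicts ls T → All Loony T → value ls ≤ W (closed* T) -ℤ + live* T
  take≤ {T} D L with live* T in lk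
  ... | suc _ with live⇒∈ T lk
  ...   | P , P∈ , _ , lp with ∈⇒↭ P∈
  ...     | R , T↭ = subst (λ l → value ls ≤ W (closed* T) -ℤ + l) lk
              (transport (λ w → w) T↭ (take-live (depicts-resp T↭ D) (All-resp-↭ T↭ L) lp))
  take≤ {T} D L | zero with closed* T in cl
  ... | [] = ⊥-elim (take-none D L lk cl)
  ... | c ∷ G with W-attained c G
  ...   | c′ , G′ , G↭ , eq
    with find (∈-concatMap⁻ closed {xs = T} (subst (c′ ∈_) (sym cl) (∈-resp-↭ (↭-sym G↭) (here refl))))
  ...     | P , P∈ , c′∈ with ∈⇒↭ P∈
  ...       | R , T↭ = ≤-trans
    (take-open (depicts-resp T↭ D) (All-resp-↭ T↭ L) (trans (live*-↭ (↭-sym T↭)) lk) (singleton P c′∈)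
      (drop-∷ (↭-trans (↭-reflexive (cong (_++ closed* R) (sym (singleton P c′∈))))
        (↭-trans (concatMap-↭ closed (↭-sym T↭)) (↭-trans (↭-reflexive cl) G↭)))))
    (≤-by {a = 0ℤ} {0ℤ} ≤-refl (trans (cong (λ w → w -ℤ + 0 -ℤ opened c′ (W G′)) eq) (lemma (opened c′ (W G′)))))
    where
    singleton : ∀ P {c} → c ∈ closed P → closed P ≡ c ∷ []
    singleton (path true n true) (here refl) = refl
    singleton (cycle n)          (here refl) = refl
    lemma : ∀ o → o -ℤ + 0 -ℤ o ≡ 0ℤ -ℤ 0ℤ
    lemma = solve-∀

  offer-≤ : ∀ {X : Shape → Set} h → (∀ {P} → X P → Offer X h P) →
            (∀ {V w k T} → EvaluatedAt V w k T → Any X T → V ≤ + (h + h) -ℤ w -ℤ k) →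
            ∀ {T} → Depicts ls T → All Loony T → Any X T → value ls ≤ + (h + h) -ℤ W (closed* T) -ℤ + live* T
  offer-≤ {X} h offer bound {T} D L x with find x
  ... | P , P∈ , xP with ∈⇒↭ P∈
  ... | R , T↭ = transport (λ w → + (h + h) -ℤ w) T↭ (front (depicts-resp T↭ D) (All-resp-↭ T↭ L))
    where
    front : Depicts ls (P ∷ R) → All Loony (P ∷ R) →
            value ls ≤ + (h + h) -ℤ W (closed* (P ∷ R)) -ℤ + live* (P ∷ R)
    front D L with live* R in lR
    -- Live boxes elsewhere are captured first, which leaves `P` and its offer intact. Handing over
    -- is done only when nothing else is live.
    ... | suc _ with live⇒∈ R lR
    ...   | Q , Q∈ , _ , lq with ∈⇒↭ Q∈ | capture Q lq
    ...     | R′ , R↭ | Qs , c , cut , dead = subst (λ l → value ls ≤ + (h + h) -ℤ W (closed* (P ∷ R)) -ℤ + (live P + l)) lR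
        (transport (λ w → + (h + h) -ℤ w) PR↭ (capture-≤ (depicts-resp PR↭ D) (All-resp-↭ PR↭ L) cut dead
          (λ w → + (h + h) -ℤ w) λ { E refl → bound E (Anyₚ.++⁺ʳ Qs (here xP)) }))
      where
      PR↭ : P ∷ R ↭ Q ∷ P ∷ R′
      PR↭ = ↭-trans (prep P R↭) (swap P Q ↭-refl)
    front D L@(p ∷ _) | zero with offer xP
    ... | approach cut dead xQs = subst (λ l → value ls ≤ + (h + h) -ℤ W (closed* (P ∷ R)) -ℤ + (live P + l)) lR
          (capture-≤ D L cut dead (λ w → + (h + h) -ℤ w) λ { E refl → bound E (Anyₚ.++⁺ˡ xQs) })
    ... | hand {Qs} cut dead lQs cl ¬h ¬b with cut-kind p cut
    ...   | breaks eq B = value-≤ D L cut dead λ V E → reply V (breaking-at {P = P} {Qs} eq B E)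
      where
      w : ℤ
      w = W (closed* (P ∷ R))
      lP : live P ≡ h
      lP = trans (sym (Breaking.shrinks B)) (trans (cong₂ _+_ lQs dead) (+-identityʳ h))
      none : ∀ {X : Shape → Set} → ¬ Any X Qs → ¬ Any X R → ¬ Any X (Qs ++ R)
      none q r a with Anyₚ.++⁻ Qs a
      ... | inj₁ a′ = q a′
      ... | inj₂ a′ = r a′
      reply : ∀ V → EvaluatedAt V w (+ (live* Qs + live* R)) (Qs ++ R) →
              - V ≤ + (h + h) -ℤ w -ℤ + (live P + 0)
      reply V E rewrite lQs | lR | lP | +-identityʳ h = ≤-by
        (EvaluatedAt.above E (w -ℤ + h) ≤-refl (⊥-elim ∘ none ¬h (no-half lR)) (⊥-elim ∘ none ¬b (no-bare lR)))
        (lemma (+ h) w V)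
        where
        lemma : ∀ h w V → h +ℤ h -ℤ w -ℤ h -ℤ - V ≡ V -ℤ (w -ℤ h)
        lemma = solve-∀
    ...   | opens _ _ eq _ _ with trans (sym eq) cl
    ...     | ()

  above≤ : ∀ {T} → Depicts ls T → All Loony T → ∀ x → x ≤ W (closed* T) -ℤ + live* T →
           (Any Half T → x ≤ + 4 -ℤ W (closed* T) -ℤ + live* T) →
           (Any Bare T → x ≤ + 8 -ℤ W (closed* T) -ℤ + live* T) → x ≤ value ls
  above≤ {T} D L x t h b = minimum-glb score below
    where
    below : ∀ i → x ≤ score i
    below i with move-sound D i
    ... | P , R , Qs , T↭ , M = subst (λ g → x ≤ moveValue g V) (sym (Move.gained M)) (reply (cut-kind p (Move.cut M)))
      where
      V : ℤ
      V = value (removeAt ls i)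
      L′ : All Loony (P ∷ R)
      L′ = All-resp-↭ T↭ L
      p : Loony P
      p = All.head L′
      E : Evaluated V (Qs ++ R)
      E = after L′ M
      w : ℤ
      w = W (closed* (P ∷ R))
      to-front : ∀ (f : ℤ → ℤ) → x ≤ f (W (closed* T)) -ℤ + live* T → x ≤ f w -ℤ + live* (P ∷ R)
      to-front f = subst₂ (λ w k → x ≤ f w -ℤ + k) (W-resp-↭ (concatMap-↭ closed T↭)) (live*-↭ T↭)
      t′ : x ≤ w -ℤ + live* (P ∷ R)
      t′ = to-front (λ w → w) t
      h′ : Any Half (P ∷ R) → x ≤ + 4 -ℤ w -ℤ + live* (P ∷ R)
      h′ = to-front (λ w → + 4 -ℤ w) ∘ h ∘ Any-resp-↭ (↭-sym T↭)
      b′ : Any Bare (P ∷ R) → x ≤ + 8 -ℤ w -ℤ + live* (P ∷ R)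
      b′ = to-front (λ w → + 8 -ℤ w) ∘ b ∘ Any-resp-↭ (↭-sym T↭)

      grow : ∀ {X : Shape → Set} → (Any X Qs → X P) → Any X (Qs ++ R) → Any X (P ∷ R)
      grow f a with Anyₚ.++⁻ Qs a
      ... | inj₁ q = here (f q)
      ... | inj₂ q = there q

      reply : CutKind P Qs → x ≤ moveValue (deads* Qs) V
      reply (opens d n eq l0 O) rewrite Opening.no-deads O = opened-reply {d = d} {n} {W (closed* R)} (live* R)
        (subst (λ l → x ≤ w -ℤ + (l + live* R)) l0 t′)
        (W-≤ (↭-reflexive (cong (_++ closed* R) eq)))
        (EvaluatedAt.take at) (release (Opening.released O))
        where
        at : EvaluatedAt V (W (closed* R)) (+ (n + live* R)) (Qs ++ R)
        at = opening-at O E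
        release : Released d Qs → V ≤ + d -ℤ W (closed* R) -ℤ + (n + live* R)
        release (two refl q)    = EvaluatedAt.half at (Anyₚ.++⁺ˡ q)
        release (four refl q _) = EvaluatedAt.bare at (Anyₚ.++⁺ˡ q)
      reply (breaks eq B) with deads* Qs in dead
      ... | suc c = ≤-by (EvaluatedAt.above at (x +ℤ + suc c)
              (shift⁻ w t′)
              (λ q → shift⁻ (+ 4 -ℤ w) (h′ (grow (proj₁ (Breaking.captures B dead)) q)))
              (λ q → shift⁻ (+ 8 -ℤ w) (b′ (grow (proj₂ (Breaking.captures B dead)) q)))) (lemma x V (+ suc c))
        where
        at : EvaluatedAt V w (+ (live* Qs + live* R)) (Qs ++ R)
        at = breaking-at {P = P} {Qs} eq B E
        shift⁻ : ∀ a → x ≤ a -ℤ + live* (P ∷ R) → x +ℤ + suc c ≤ a -ℤ + (live* Qs + live* R)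
        shift⁻ a = capture-shift⁻ a x (live* Qs + live* R) (suc c) (shrinks+ {P} {Qs} (suc c) R B dead)
        lemma : ∀ x V c → V -ℤ c -ℤ x ≡ V -ℤ (x +ℤ c)
        lemma = solve-∀
      ... | zero = quiet (Breaking.quiet B dead)
        where
        at : EvaluatedAt V w (+ (live* Qs + live* R)) (Qs ++ R)
        at = breaking-at {P = P} {Qs} eq B E
        V≤ : V ≤ w -ℤ + live* (P ∷ R)
        V≤ = subst (λ l → V ≤ w -ℤ + l) (trans (sym (+-identityʳ _)) (shrinks+ {P} {Qs} 0 R B dead)) (EvaluatedAt.take at)
        -- After a move that claims nothing the opponent can take all l live boxes, so - `V` is at
        -- least l - w. This is at least d - w - l because d is at most 2l: the offer would have
        -- been as good.
        balance : ∀ d → d ≤ᴺ live P + live P → x ≤ + d -ℤ w -ℤ + live* (P ∷ R) → x ≤ - V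
        balance d d≤ x≤ = ≤-by (+-mono-≤ (+-mono-≤ x≤ V≤) (+≤+ (ℕ.≤-trans d≤ (ℕ.+-mono-≤ (m≤m+n (live P) (live* R)) (m≤m+n (live P) (live* R))))))
          (lemma x w V (+ live* (P ∷ R)) (+ d))
          where
          lemma : ∀ x w V l d → - V -ℤ x ≡ (d -ℤ w -ℤ l +ℤ (w -ℤ l) +ℤ (l +ℤ l)) -ℤ (x +ℤ V +ℤ d)
          lemma = solve-∀
        quiet : (Half P × 2 ≤ᴺ live P) ⊎ (Bare P × 4 ≤ᴺ live P) → x ≤ - V
        quiet (inj₁ (hP , 2≤)) = balance 4 (ℕ.+-mono-≤ 2≤ 2≤) (h′ (here hP))
        quiet (inj₂ (bP , 4≤)) = balance 8 (ℕ.+-mono-≤ 4≤ 4≤) (b′ (here bP))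

evaluate : ∀ {n k} (ls : Vec (Line n) k) {T} → Depicts ls T → All Loony T → Evaluated (value ls) T
evaluate {k = suc k} ls D L = record
  { take  = take≤ ls evaluate D L
  ; half  = offer-≤ ls evaluate 2 offer-half EvaluatedAt.half D L
  ; bare  = offer-≤ ls evaluate 4 offer-bare EvaluatedAt.bare D L
  ; above = above≤ ls evaluate D L
  }
evaluate {k = zero} [] {T} D L = record
  { take  = subst₂ (λ G l → + 0 ≤ W G -ℤ + l) (sym closed≡) (sym live≡) ≤-refl
  ; half  = ⊥-elim ∘ no-half live≡
  ; bare  = ⊥-elim ∘ no-bare live≡
  ; above = λ x x≤ _ _ → subst₂ (λ G l → x ≤ W G -ℤ + l) closed≡ live≡ x≤
  }
  where
  dead : ∀ {P} → P ∈ T → P ≡ path false 0 false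
  dead {P} P∈ with dead-or-cut P | ∈⇒↭ P∈
  ... | inj₁ eq      | _      = eq
  ... | inj₂ (_ , c) | _ , T↭ = ⊥-elim (no-lines (depicts-resp T↭ D) c)
  stats : ∀ {S} → (∀ {P} → P ∈ S → P ≡ path false 0 false) → closed* S ≡ [] × live* S ≡ 0
  stats {[]}    _ = refl , refl
  stats {P ∷ S} d with d (here refl)
  ... | refl = stats (d ∘ there)
  closed≡ : closed* T ≡ []
  closed≡ = proj₁ (stats dead)
  live≡ : live* T ≡ 0
  live≡ = proj₂ (stats dead)

components : List ℕ → List ℕ → List Component
components cs ls = map (4 ,_) cs ++ map (8 ,_) ls

-- At the start no box is live and no offer can be made, so `take` and `above` leave only the first
-- of the three numbers, with nothing subtracted.
v≡W : ∀ G → v ⟦ G ⟧ ≡ W (components (chains G) (loops G))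
v≡W G = ≤-antisym
  (≤-trans take (≤-reflexive (trans (cong₂ (λ G l → W G -ℤ + l) closed≡ live≡) (minus-0 _))))
  (above _ (≤-reflexive (sym (trans (cong₂ (λ G l → W G -ℤ + l) closed≡ live≡) (minus-0 _))))
    (⊥-elim ∘ no-half live≡) (⊥-elim ∘ no-bare live≡))
  where
  T : List Shape
  T = map chainShape (chains G) ++ map loopShape (loops G)

  chains-ok : ∀ {cs} → All (3 ≤ᴺ_) cs →
    All Loony (map chainShape cs) × closed* (map chainShape cs) ≡ map (4 ,_) cs × live* (map chainShape cs) ≡ 0
  chains-ok [] = [] , refl , refl
  chains-ok {suc _ ∷ _} (s≤s p ∷ cs≥) with chains-ok cs≥
  ... | L , eq , eq′ = p ∷ L , cong (_ ∷_) eq , eq′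

  loops-ok : ∀ {ls} → All (λ ℓ → 4 ≤ᴺ ℓ × 2 ∣ᴺ ℓ) ls →
    All Loony (map loopShape ls) × closed* (map loopShape ls) ≡ map (8 ,_) ls × live* (map loopShape ls) ≡ 0
  loops-ok [] = [] , refl , refl
  loops-ok {suc _ ∷ _} ((s≤s p , _) ∷ ls≥) with loops-ok ls≥
  ... | L , eq , eq′ = p ∷ L , cong (_ ∷_) eq , eq′

  C = chains-ok (chains≥ G)
  O = loops-ok (loops≥ G)

  closed≡ : closed* T ≡ components (chains G) (loops G)
  closed≡ = trans (concatMap-++ closed (map chainShape (chains G)) _) (cong₂ _++_ (proj₁ (proj₂ C)) (proj₁ (proj₂ O)))

  live≡ : live* T ≡ 0
  live≡ = trans (live*-++ (map chainShape (chains G)) _) (cong₂ _+_ (proj₂ (proj₂ C)) (proj₂ (proj₂ O)))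

  minus-0 : ∀ w → w -ℤ + 0 ≡ w
  minus-0 = solve-∀

  open EvaluatedAt (evaluate (lines ⟦ G ⟧) (depicts-⟦⟧ G) (Allₚ.++⁺ (proj₁ C) (proj₁ O)))

-- Controlled value

V : List ℕ → List ℕ → ℤ
V cs ls = W (components cs ls)

V-chain : ∀ {cs ls c cs′} → cs ↭ c ∷ cs′ → V cs ls ≤ opened (4 , c) (V cs′ ls)
V-chain {ls = ls} p = W-≤ (++⁺ʳ (map (8 ,_) ls) (map⁺ (4 ,_) p))

V-loop : ∀ {cs ls ℓ ls′} → ls ↭ ℓ ∷ ls′ → V cs ls ≤ opened (8 , ℓ) (V cs ls′)
V-loop {cs} {ℓ = ℓ} {ls′} p = W-≤ (↭-trans (++⁺ˡ (map (4 ,_) cs) (map⁺ (8 ,_) p)) (shift (8 , ℓ) (map (4 ,_) cs) (map (8 ,_) ls′)))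

data Best (cs ls : List ℕ) : Set where
  none : cs ≡ [] → ls ≡ [] → Best cs ls
  openChain : ∀ {c cs′} → cs ↭ c ∷ cs′ → V cs ls ≡ opened (4 , c) (V cs′ ls) → Best cs ls
  openLoop : ∀ {ℓ ls′} → ls ↭ ℓ ∷ ls′ → V cs ls ≡ opened (8 , ℓ) (V cs ls′) → Best cs ls

best : ∀ cs ls → Best cs ls
best cs ls with components cs ls in eq
... | [] = empty cs ls eq
  where
  empty : ∀ cs ls → components cs ls ≡ [] → Best cs ls
  empty [] [] _ = none refl refl
... | x ∷ G with W-attained x G
...   | y , G′ , p , W≡ with ∈-++⁻ (map (4 ,_) cs) (subst (y ∈_) (sym eq) (∈-resp-↭ (↭-sym p) (here refl)))
...     | inj₁ y∈ with ∈-map⁻ _ y∈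
...       | c , c∈ , refl with ∈⇒↭ c∈
...         | cs′ , q = openChain q (trans (cong W eq) (trans W≡ (cong (opened (4 , c)) (W-resp-↭
              (drop-∷ (↭-trans (↭-sym p) (↭-trans (↭-reflexive (sym eq)) (++⁺ʳ (map (8 ,_) ls) (map⁺ (4 ,_) q)))))))))
best cs ls | x ∷ G | y , G′ , p , W≡ | inj₂ y∈ with ∈-map⁻ _ y∈
...       | ℓ , ℓ∈ , refl with ∈⇒↭ ℓ∈
...         | ls′ , q = openLoop q (trans (cong W eq) (trans W≡ (cong (opened (8 , ℓ)) (W-resp-↭
              (drop-∷ (↭-trans (↭-sym p) (↭-trans (↭-reflexive (sym eq)) (↭-trans (++⁺ˡ (map (4 ,_) cs) (map⁺ (8 ,_) q))
                (shift (8 , ℓ) (map (4 ,_) cs) (map (8 ,_) ls′))))))))))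

Fair : List ℕ → List ℕ → Set
Fair cs ls = All (3 ≤ᴺ_) cs × All (λ ℓ → 4 ≤ᴺ ℓ × 2 ∣ᴺ ℓ) ls

fair-chain : ∀ {cs ls c cs′} → cs ↭ c ∷ cs′ → Fair cs ls → Fair cs′ ls
fair-chain p (C , L) = All.tail (All-resp-↭ p C) , L

fair-loop : ∀ {cs ls ℓ ls′} → ls ↭ ℓ ∷ ls′ → Fair cs ls → Fair cs ls′
fair-loop p (C , L) = C , All.tail (All-resp-↭ p L)

-- The best component to open can stand anywhere in its list, so the hypothesis must cover the
-- removal of every component and any ordering of the rest. The recursion runs on the total number
-- of components.
endgame-rec : (P : List ℕ → List ℕ → Set) →
  (∀ cs ls → Fair cs ls → (∀ {c cs′} → cs ↭ c ∷ cs′ → P cs′ ls) → (∀ {ℓ ls′} → ls ↭ ℓ ∷ ls′ → P cs ls′) → P cs ls) →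
  ∀ cs ls → Fair cs ls → P cs ls
endgame-rec P step cs ls = go _ cs ls refl
  where
  go : ∀ n cs ls → length cs + length ls ≡ n → Fair cs ls → P cs ls
  go zero [] [] eq F = step [] [] F (⊥-elim ∘ ¬x∷xs↭[] ∘ ↭-sym) (⊥-elim ∘ ¬x∷xs↭[] ∘ ↭-sym)
  go (suc n) cs ls eq F = step cs ls F
    (λ p → go n _ ls (suc-injective (trans (sym (cong (_+ length ls) (↭-length p))) eq)) (fair-chain {ls = ls} p F))
    (λ p → go n cs _ (suc-injective (trans (sym (trans (cong (λ m → length cs + m) (↭-length p)) (+-suc _ _))) eq))
             (fair-loop {cs} p F))

-- The larger of n - w and n - d + w is at least their mean n - d/2. The bound holds for every value
-- w of the rest, so it needs no induction.
opened-≥ : ∀ m d n w → m + m + d ≤ᴺ n + n → + m ≤ opened (d , n) w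
opened-≥ m d n w h with ≤-total (+ m) (+ n -ℤ w)
... | inj₁ m≤ = ≤-trans m≤ (opened-≥ˡ d n w)
... | inj₂ ≤m = ≤-trans (≤-by (+-mono-≤ (+≤+ h) ≤m) (lemma (+ m) (+ d) (+ n) w)) (opened-≥ʳ d n w)
  where
  lemma : ∀ m d n w → n -ℤ d +ℤ w -ℤ m ≡ (n +ℤ n +ℤ m) -ℤ (m +ℤ m +ℤ d +ℤ (n -ℤ w))
  lemma = solve-∀

opened-≤ : ∀ d n w {x} → + n -ℤ w ≤ x → + n -ℤ + d +ℤ w ≤ x → opened (d , n) w ≤ x
opened-≤ d n w = ⊔-lub

head↭ : ∀ {P : ℕ → Set} {xs x ys} → xs ↭ x ∷ ys → All P xs → P x
head↭ p ps = All.head (All-resp-↭ p ps)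

double-mono : ∀ {m n} → m ≤ᴺ n → m + m ≤ᴺ n + n
double-mono h = ℕ.+-mono-≤ h h

V-≥0 : ∀ {cs ls} → Fair cs ls → + 0 ≤ V cs ls
V-≥0 {cs} {ls} (C , L) with best cs ls
... | none refl refl = ≤-refl
... | openChain {c} {cs′} p eq = subst (+ 0 ≤_) (sym eq) (opened-≥ 0 4 c (V cs′ ls)
        (ℕ.≤-trans (s≤s (s≤s (s≤s (s≤s z≤n)))) (double-mono (head↭ p C))))
... | openLoop {ℓ} {ls′} p eq = subst (+ 0 ≤_) (sym eq) (opened-≥ 0 8 ℓ (V cs ls′) (double-mono (proj₁ (head↭ p L))))

-- Controlled value and the terminal bonus

chainSum loopSum : List ℕ → ℤ
chainSum cs = sumℤ (map (λ c → + c -ℤ + 4) cs)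
loopSum  ls = sumℤ (map (λ ℓ → + ℓ -ℤ + 8) ls)

control : List ℕ → List ℕ → ℤ
control cs ls = chainSum cs +ℤ loopSum ls +ℤ terminalBonus cs ls

sumℤ-↭ : ∀ {xs ys} → xs ↭ ys → sumℤ xs ≡ sumℤ ys
sumℤ-↭ refl         = refl
sumℤ-↭ (prep x p)   = cong (x +ℤ_) (sumℤ-↭ p)
sumℤ-↭ {ys = _ ∷ _ ∷ zs} (swap x y p) = trans (cong (λ s → x +ℤ (y +ℤ s)) (sumℤ-↭ p)) (lemma x y (sumℤ zs))
  where
  lemma : ∀ x y s → x +ℤ (y +ℤ s) ≡ y +ℤ (x +ℤ s)
  lemma = solve-∀
sumℤ-↭ (trans↭ p q)  = trans (sumℤ-↭ p) (sumℤ-↭ q)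

bonus-big : ∀ {cs} ls → Any (4 ≤ᴺ_) cs → terminalBonus cs ls ≡ + 4
bonus-big {_ ∷ _} [] b = refl
bonus-big {cs@(_ ∷ _)} (_ ∷ _) b = cong (if_then + 4 else + 6) (dec-true (any? (4 ≤?_) cs) b)

bonus-small : ∀ c {cs} ℓ ls → ¬ Any (4 ≤ᴺ_) (c ∷ cs) → terminalBonus (c ∷ cs) (ℓ ∷ ls) ≡ + 6
bonus-small c {cs} ℓ ls ¬b = cong (if_then + 4 else + 6) (dec-false (any? (4 ≤?_) (c ∷ cs)) ¬b)

bonus-resp : ∀ {cs cs′ ls ls′} → cs ↭ cs′ → ls ↭ ls′ → terminalBonus cs ls ≡ terminalBonus cs′ ls′
bonus-resp {[]}    {_ ∷ _} p q = ⊥-elim (¬x∷xs↭[] (↭-sym p))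
bonus-resp {_ ∷ _} {[]}    p q = ⊥-elim (¬x∷xs↭[] p)
bonus-resp {ls = []}    {_ ∷ _} p q = ⊥-elim (¬x∷xs↭[] (↭-sym q))
bonus-resp {ls = _ ∷ _} {[]}    p q = ⊥-elim (¬x∷xs↭[] q)
bonus-resp {[]}    {[]}    {[]}    {[]}    p q = refl
bonus-resp {[]}    {[]}    {_ ∷ _} {_ ∷ _} p q = refl
bonus-resp {_ ∷ _} {_ ∷ _} {[]}    {[]}    p q = refl
bonus-resp {c ∷ cs} {c′ ∷ cs′} {ℓ ∷ ls} {ℓ′ ∷ ls′} p q with any? (4 ≤?_) (c ∷ cs)
... | yes b = trans (bonus-big (ℓ ∷ ls) b) (sym (bonus-big (ℓ′ ∷ ls′) (Any-resp-↭ p b)))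
... | no ¬b = trans (bonus-small c ℓ ls ¬b) (sym (bonus-small c′ ℓ′ ls′ (¬b ∘ Any-resp-↭ (↭-sym p))))

control-resp : ∀ {cs cs′ ls ls′} → cs ↭ cs′ → ls ↭ ls′ → control cs ls ≡ control cs′ ls′
control-resp p q = cong₂ _+ℤ_ (cong₂ _+ℤ_ (sumℤ-↭ (map⁺ _ p)) (sumℤ-↭ (map⁺ _ q))) (bonus-resp p q)

control-chain : ∀ c cs ls → control (c ∷ cs) ls ≡
  (+ c -ℤ + 4 +ℤ control cs ls) +ℤ (terminalBonus (c ∷ cs) ls -ℤ terminalBonus cs ls)
control-chain c cs ls = lemma (+ c) (chainSum cs) (loopSum ls) (terminalBonus cs ls) (terminalBonus (c ∷ cs) ls)
  where
  lemma : ∀ c s l t t′ → c -ℤ + 4 +ℤ s +ℤ l +ℤ t′ ≡ (c -ℤ + 4 +ℤ (s +ℤ l +ℤ t)) +ℤ (t′ -ℤ t)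
  lemma = solve-∀

control-loop : ∀ ℓ cs ls → control cs (ℓ ∷ ls) ≡
  (+ ℓ -ℤ + 8 +ℤ control cs ls) +ℤ (terminalBonus cs (ℓ ∷ ls) -ℤ terminalBonus cs ls)
control-loop ℓ cs ls = lemma (+ ℓ) (chainSum cs) (loopSum ls) (terminalBonus cs ls) (terminalBonus cs (ℓ ∷ ls))
  where
  lemma : ∀ c s l t t′ → s +ℤ (c -ℤ + 8 +ℤ l) +ℤ t′ ≡ (c -ℤ + 8 +ℤ (s +ℤ l +ℤ t)) +ℤ (t′ -ℤ t)
  lemma = solve-∀

Big : List ℕ → Set
Big = Any (4 ≤ᴺ_)

big? : ∀ cs → Big cs ⊎ ¬ Big cs
big? cs with any? (4 ≤?_) cs
... | yes b = inj₁ b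
... | no ¬b = inj₂ ¬b

bonus-≤8 : ∀ cs ls → terminalBonus cs ls ≤ + 8
bonus-≤8 []       []       = +≤+ z≤n
bonus-≤8 []       (_ ∷ _)  = ≤-refl
bonus-≤8 (c ∷ cs) []       = +≤+ (s≤s (s≤s (s≤s (s≤s z≤n))))
bonus-≤8 (c ∷ cs) (ℓ ∷ ls) with big? (c ∷ cs)
... | inj₁ b  = subst (_≤ + 8) (sym (bonus-big (ℓ ∷ ls) b)) (+≤+ (s≤s (s≤s (s≤s (s≤s z≤n)))))
... | inj₂ ¬b = subst (_≤ + 8) (sym (bonus-small c ℓ ls ¬b)) (+≤+ (s≤s (s≤s (s≤s (s≤s (s≤s (s≤s z≤n)))))))

-- Beside other components a further chain can only lower the bonus: from 8 when it is the first
-- chain, from 6 when it is the first long one.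
bonus-chain : ∀ c cs ls → (cs ≡ [] × ls ≡ []) ⊎ terminalBonus (c ∷ cs) ls ≤ terminalBonus cs ls
bonus-chain c []       []      = inj₁ (refl , refl)
bonus-chain c []       (ℓ ∷ ls) = inj₂ (bonus-≤8 (c ∷ []) (ℓ ∷ ls))
bonus-chain c (_ ∷ _)  []       = inj₂ ≤-refl
bonus-chain c (c′ ∷ cs) (ℓ ∷ ls) with big? (c ∷ c′ ∷ cs) | big? (c′ ∷ cs)
... | _       | inj₁ b  = inj₂ (≤-reflexive (trans (bonus-big {c ∷ c′ ∷ cs} (ℓ ∷ ls) (there b)) (sym (bonus-big (ℓ ∷ ls) b))))
... | inj₁ b  | inj₂ ¬b = inj₂ (subst₂ _≤_ (sym (bonus-big (ℓ ∷ ls) b)) (sym (bonus-small c′ ℓ ls ¬b)) (+≤+ (s≤s (s≤s (s≤s (s≤s z≤n))))))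
... | inj₂ ¬b | inj₂ ¬b′ = inj₂ (≤-reflexive (trans (bonus-small c ℓ ls ¬b) (sym (bonus-small c′ ℓ ls ¬b′))))

¬big⇒≤3 : ∀ {cs} → ¬ Big cs → All (_≤ᴺ 3) cs
¬big⇒≤3 ¬b = All.map (λ ¬p → s≤s⁻¹ (≰⇒> ¬p)) (Allₚ.¬Any⇒All¬ _ ¬b)

-- Opening a 3-chain turns a rest of value w between 0 and 3 into max (3 - w, w - 1), which is again
-- at most 3. This bounds what remains beside the last loop in `control≤V`.
threes-V : ∀ cs → All (3 ≤ᴺ_) cs → All (_≤ᴺ 3) cs → V cs [] ≤ + 3
threes-V []       _       _       = +≤+ z≤n
threes-V (c ∷ cs) C@(_ ∷ C′) (p ∷ ps) = ≤-trans (V-chain {c ∷ cs} {[]} ↭-refl) (opened-≤ 4 c _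
  (≤-by (+-mono-≤ (+≤+ p) (V-≥0 {cs} {[]} (C′ , []))) (lemma₁ (+ c) (V cs [])))
  (≤-by (+-mono-≤ (+-mono-≤ (+≤+ p) (threes-V cs C′ ps)) (+≤+ (z≤n {1}))) (lemma₂ (+ c) (V cs []))))
  where
  lemma₁ : ∀ c w → + 3 -ℤ (c -ℤ w) ≡ (+ 3 +ℤ w) -ℤ (c +ℤ + 0)
  lemma₁ = solve-∀
  lemma₂ : ∀ c w → + 3 -ℤ (c -ℤ + 4 +ℤ w) ≡ (+ 3 +ℤ + 3 +ℤ + 1) -ℤ (c +ℤ w +ℤ + 0)
  lemma₂ = solve-∀

threes-sum : ∀ {cs} → All (_≤ᴺ 3) cs → chainSum cs ≤ + 0
threes-sum []       = ≤-refl
threes-sum {c ∷ cs} (p ∷ ps) = ≤-by (+-mono-≤ (+-mono-≤ (+≤+ p) (threes-sum ps)) (+≤+ (z≤n {1}))) (lemma (+ c) (chainSum cs))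
  where
  lemma : ∀ c s → + 0 -ℤ (c -ℤ + 4 +ℤ s) ≡ (+ 3 +ℤ + 0 +ℤ + 1) -ℤ (c +ℤ s +ℤ + 0)
  lemma = solve-∀

-- Keeping control earns n - d + w, which suffices unless the bonus drops when the component is
-- removed. It drops in two cases, and there taking everything suffices: when the component is the
-- last one, and when it is the last loop beside 3-chains only, where the bonus falls from 6 to 4.
control≤V : ∀ cs ls → Fair cs ls → control cs ls ≤ V cs ls
control≤V = endgame-rec _ step
  where
  step : ∀ cs ls → Fair cs ls → (∀ {c cs′} → cs ↭ c ∷ cs′ → control cs′ ls ≤ V cs′ ls) →
         (∀ {ℓ ls′} → ls ↭ ℓ ∷ ls′ → control cs ls′ ≤ V cs ls′) → control cs ls ≤ V cs ls
  step cs ls F ihᶜ ihˡ with best cs ls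
  ... | none refl refl = ≤-refl
  ... | openChain {c} {cs′} p eq = subst₂ _≤_ (control-resp (↭-sym p) (↭-refl {x = ls})) (sym eq) (go (bonus-chain c cs′ ls))
    where
    go : (cs′ ≡ [] × ls ≡ []) ⊎ terminalBonus (c ∷ cs′) ls ≤ terminalBonus cs′ ls →
         control (c ∷ cs′) ls ≤ opened (4 , c) (V cs′ ls)
    go (inj₁ (refl , refl)) = ≤-trans (≤-reflexive (lemma (+ c))) (opened-≥ˡ 4 c (+ 0))
      where
      lemma : ∀ c → c -ℤ + 4 +ℤ + 0 +ℤ + 0 +ℤ + 4 ≡ c -ℤ + 0
      lemma = solve-∀
    go (inj₂ t≤) = ≤-trans (≤-reflexive (control-chain c cs′ ls)) (≤-trans
      (≤-by (+-mono-≤ (ihᶜ p) t≤) (lemma (+ c) (control cs′ ls) (V cs′ ls) (terminalBonus cs′ ls) (terminalBonus (c ∷ cs′) ls)))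
      (opened-≥ʳ 4 c (V cs′ ls)))
      where
      lemma : ∀ c κ w t t′ → c -ℤ + 4 +ℤ w -ℤ (c -ℤ + 4 +ℤ κ +ℤ (t′ -ℤ t)) ≡ (w +ℤ t) -ℤ (κ +ℤ t′)
      lemma = solve-∀
  ... | openLoop {ℓ} {ls′} p eq = subst₂ _≤_ (control-resp (↭-refl {x = cs}) (↭-sym p)) (sym eq) (go cs ls′ F (ihˡ p))
    where
    plain : ∀ cs ls → control cs ls ≤ V cs ls → terminalBonus cs (ℓ ∷ ls) ≤ terminalBonus cs ls →
            control cs (ℓ ∷ ls) ≤ opened (8 , ℓ) (V cs ls)
    plain cs ls ih t≤ = ≤-trans (≤-reflexive (control-loop ℓ cs ls)) (≤-trans
      (≤-by (+-mono-≤ ih t≤) (lemma (+ ℓ) (control cs ls) (V cs ls) (terminalBonus cs ls) (terminalBonus cs (ℓ ∷ ls))))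
      (opened-≥ʳ 8 ℓ (V cs ls)))
      where
      lemma : ∀ c κ w t t′ → c -ℤ + 8 +ℤ w -ℤ (c -ℤ + 8 +ℤ κ +ℤ (t′ -ℤ t)) ≡ (w +ℤ t) -ℤ (κ +ℤ t′)
      lemma = solve-∀
    go : ∀ cs ls → Fair cs _ → control cs ls ≤ V cs ls → control cs (ℓ ∷ ls) ≤ opened (8 , ℓ) (V cs ls)
    go [] [] F ih = ≤-trans (≤-reflexive (lemma (+ ℓ))) (opened-≥ˡ 8 ℓ (+ 0))
      where
      lemma : ∀ ℓ → + 0 +ℤ (ℓ -ℤ + 8 +ℤ + 0) +ℤ + 8 ≡ ℓ -ℤ + 0
      lemma = solve-∀
    go [] (ℓ′ ∷ ls) F ih = plain [] (ℓ′ ∷ ls) ih ≤-refl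
    go (c ∷ cs) (ℓ′ ∷ ls) F ih = plain (c ∷ cs) (ℓ′ ∷ ls) ih ≤-refl
    go (c ∷ cs) [] F ih with big? (c ∷ cs)
    ... | inj₁ b  = plain (c ∷ cs) [] ih (≤-reflexive (bonus-big (ℓ ∷ []) b))
    ... | inj₂ ¬b = ≤-trans (≤-reflexive (cong (chainSum (c ∷ cs) +ℤ loopSum (ℓ ∷ []) +ℤ_) (bonus-small c ℓ [] ¬b)))
      (≤-trans (≤-by (+-mono-≤ (+-mono-≤ (threes-V (c ∷ cs) (proj₁ F) ≤3) (+≤+ (All.head ≤3))) (threes-sum (All.tail ≤3)))
                     (lemma (+ c) (chainSum cs) (+ ℓ) (V (c ∷ cs) [])))
               (opened-≥ˡ 8 ℓ (V (c ∷ cs) [])))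
      where
      ≤3 : All (_≤ᴺ 3) (c ∷ cs)
      ≤3 = ¬big⇒≤3 ¬b
      lemma : ∀ c s ℓ w → ℓ -ℤ w -ℤ (c -ℤ + 4 +ℤ s +ℤ (ℓ -ℤ + 8 +ℤ + 0) +ℤ + 6) ≡ (+ 3 +ℤ + 3 +ℤ + 0) -ℤ (w +ℤ c +ℤ s)
      lemma = solve-∀

-- Since w is at least `κ`, which is at least 2, the replier gains no less from c - 4 + w than from
-- c - w. For loops the same balance needs w at least 4; in both cases the threshold is d/2.
controlled-chain : ∀ {cs ls c cs′} → cs ↭ c ∷ cs′ → Fair cs ls → terminalBonus (c ∷ cs′) ls ≡ terminalBonus cs′ ls →
  + 2 ≤ control cs′ ls → V cs′ ls ≤ control cs′ ls → V cs ls ≤ control cs ls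
controlled-chain {cs} {ls} {c} {cs′} p F t 2≤ ≤k = ≤-trans (V-chain p) (subst (opened (4 , c) w ≤_) (sym k≡) (opened-≤ 4 c _
    (≤-by (+-mono-≤ (+-mono-≤ 2≤ 2≤) (control≤V cs′ ls (fair-chain {ls = ls} p F))) (lemma₁ (+ c) κ w))
    (≤-by ≤k (lemma₂ (+ c) κ w))))
  where
  w κ : ℤ
  w = V cs′ ls
  κ = control cs′ ls
  k≡ : control cs ls ≡ + c -ℤ + 4 +ℤ κ
  k≡ = trans (control-resp p (↭-refl {x = ls})) (trans (control-chain c cs′ ls)
    (trans (cong (λ s → + c -ℤ + 4 +ℤ κ +ℤ (s -ℤ terminalBonus cs′ ls)) t) (lemma (+ c -ℤ + 4 +ℤ κ) (terminalBonus cs′ ls))))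
    where
    lemma : ∀ x t → x +ℤ (t -ℤ t) ≡ x
    lemma = solve-∀
  lemma₁ : ∀ c κ w → c -ℤ + 4 +ℤ κ -ℤ (c -ℤ w) ≡ (κ +ℤ κ +ℤ w) -ℤ (+ 2 +ℤ + 2 +ℤ κ)
  lemma₁ = solve-∀
  lemma₂ : ∀ c κ w → c -ℤ + 4 +ℤ κ -ℤ (c -ℤ + 4 +ℤ w) ≡ κ -ℤ w
  lemma₂ = solve-∀

controlled-loop : ∀ {cs ls ℓ ls′} → ls ↭ ℓ ∷ ls′ → Fair cs ls → terminalBonus cs (ℓ ∷ ls′) ≡ terminalBonus cs ls′ →
  + 4 ≤ control cs ls′ → V cs ls′ ≤ control cs ls′ → V cs ls ≤ control cs ls
controlled-loop {cs} {ls} {ℓ} {ls′} p F t 4≤ ≤k = ≤-trans (V-loop {cs} p) (subst (opened (8 , ℓ) w ≤_) (sym k≡) (opened-≤ 8 ℓ _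
    (≤-by (+-mono-≤ (+-mono-≤ 4≤ 4≤) (control≤V cs ls′ (fair-loop {cs} p F))) (lemma₁ (+ ℓ) κ w))
    (≤-by ≤k (lemma₂ (+ ℓ) κ w))))
  where
  w κ : ℤ
  w = V cs ls′
  κ = control cs ls′
  k≡ : control cs ls ≡ + ℓ -ℤ + 8 +ℤ κ
  k≡ = trans (control-resp (↭-refl {x = cs}) p) (trans (control-loop ℓ cs ls′)
    (trans (cong (λ s → + ℓ -ℤ + 8 +ℤ κ +ℤ (s -ℤ terminalBonus cs ls′)) t) (lemma (+ ℓ -ℤ + 8 +ℤ κ) (terminalBonus cs ls′))))
    where
    lemma : ∀ x t → x +ℤ (t -ℤ t) ≡ x
    lemma = solve-∀
  lemma₁ : ∀ c κ w → c -ℤ + 8 +ℤ κ -ℤ (c -ℤ w) ≡ (κ +ℤ κ +ℤ w) -ℤ (+ 4 +ℤ + 4 +ℤ κ)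
  lemma₁ = solve-∀
  lemma₂ : ∀ c κ w → c -ℤ + 8 +ℤ κ -ℤ (c -ℤ + 8 +ℤ w) ≡ κ -ℤ w
  lemma₂ = solve-∀

control-chain-≤4 : ∀ {cs ls c cs′} → cs ↭ c ∷ cs′ → c ≤ᴺ 4 → terminalBonus (c ∷ cs′) ls ≤ terminalBonus cs′ ls →
                   control cs ls ≤ control cs′ ls
control-chain-≤4 {cs} {ls} {c} {cs′} p c≤ t≤ = ≤-trans (≤-reflexive (trans (control-resp p (↭-refl {x = ls})) (control-chain c cs′ ls)))
  (≤-by (+-mono-≤ (+≤+ c≤) t≤) (lemma (+ c) (control cs′ ls) (terminalBonus (c ∷ cs′) ls) (terminalBonus cs′ ls)))
  where
  lemma : ∀ c κ t′ t → κ -ℤ (c -ℤ + 4 +ℤ κ +ℤ (t′ -ℤ t)) ≡ (+ 4 +ℤ t) -ℤ (c +ℤ t′)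
  lemma = solve-∀

-- A loop of length at most 6 contributes at most -2. Removing it therefore lifts a controlled value
-- of at least 2 to the threshold 4 of `controlled-loop`.
control-loop-≤6 : ∀ {cs ls ℓ ls′} → ls ↭ ℓ ∷ ls′ → ℓ ≤ᴺ 6 → terminalBonus cs (ℓ ∷ ls′) ≤ terminalBonus cs ls′ →
                  control cs ls +ℤ + 2 ≤ control cs ls′
control-loop-≤6 {cs} {ls} {ℓ} {ls′} p ℓ≤ t≤ = ≤-trans (≤-reflexive (cong (_+ℤ + 2) (trans (control-resp (↭-refl {x = cs}) p) (control-loop ℓ cs ls′))))
  (≤-by (+-mono-≤ (+≤+ ℓ≤) t≤) (lemma (+ ℓ) (control cs ls′) (terminalBonus cs (ℓ ∷ ls′)) (terminalBonus cs ls′)))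
  where
  lemma : ∀ c κ t′ t → κ -ℤ (c -ℤ + 8 +ℤ κ +ℤ (t′ -ℤ t) +ℤ + 2) ≡ (+ 6 +ℤ t) -ℤ (c +ℤ t′)
  lemma = solve-∀

chains≥4-sum : ∀ {cs} → All (4 ≤ᴺ_) cs → + 0 ≤ chainSum cs
chains≥4-sum []       = ≤-refl
chains≥4-sum {c ∷ cs} (p ∷ ps) = ≤-by (+-mono-≤ (+≤+ p) (chains≥4-sum ps)) (lemma (+ c) (chainSum cs))
  where
  lemma : ∀ c s → c -ℤ + 4 +ℤ s -ℤ + 0 ≡ (c +ℤ s) -ℤ (+ 4 +ℤ + 0)
  lemma = solve-∀

loops≥8-sum : ∀ {ls} → All (8 ≤ᴺ_) ls → + 0 ≤ loopSum ls
loops≥8-sum []       = ≤-refl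
loops≥8-sum {ℓ ∷ ls} (p ∷ ps) = ≤-by (+-mono-≤ (+≤+ p) (loops≥8-sum ps)) (lemma (+ ℓ) (loopSum ls))
  where
  lemma : ∀ c s → c -ℤ + 8 +ℤ s -ℤ + 0 ≡ (c +ℤ s) -ℤ (+ 8 +ℤ + 0)
  lemma = solve-∀

control-≥ : ∀ {x y t} cs ls → x ≤ chainSum cs → y ≤ loopSum ls → terminalBonus cs ls ≡ t → x +ℤ y +ℤ t ≤ control cs ls
control-≥ cs ls x≤ y≤ refl = +-mono-≤ (+-mono-≤ x≤ y≤) ≤-refl

data Small (b : ℕ) (xs : List ℕ) : Set where
  small : ∀ {x ys} → xs ↭ x ∷ ys → x ≤ᴺ b → Small b xs
  large : All (¬_ ∘ (_≤ᴺ b)) xs → Small b xs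

small? : ∀ b xs → Small b xs
small? b xs with any? (_≤? b) xs
... | no ¬p = large (Allₚ.¬Any⇒All¬ xs ¬p)
... | yes p with find p
...   | x , x∈ , x≤ with ∈⇒↭ x∈
...     | ys , q = small q x≤

large-chains : ∀ {cs} → All (¬_ ∘ (_≤ᴺ 3)) cs → All (4 ≤ᴺ_) cs
large-chains = All.map ≰⇒>

large-loops : ∀ {ls} → All (λ ℓ → 4 ≤ᴺ ℓ × 2 ∣ᴺ ℓ) ls → All (¬_ ∘ (_≤ᴺ 6)) ls → All (8 ≤ᴺ_) ls
large-loops []             []         = []
large-loops ((_ , e) ∷ es) (¬p ∷ ¬ps) = even (≰⇒> ¬p) e ∷ large-loops es ¬ps
  where
  even : ∀ {ℓ} → 7 ≤ᴺ ℓ → 2 ∣ᴺ ℓ → 8 ≤ᴺ ℓ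
  even {ℓ} 7≤ e with 8 ≤? ℓ
  ... | yes q = q
  ... | no ¬q with ℕ.≤-antisym 7≤ (s≤s⁻¹ (≰⇒> ¬q))
  ...   | refl = ⊥-elim (from-no (2 ∣? 7) e)

big-tail : ∀ {cs c cs′} → cs ↭ c ∷ cs′ → c ≤ᴺ 3 → Big cs → Big cs′
big-tail p c≤ b with Any-resp-↭ p b
... | here q  = ⊥-elim (1+n≰n (ℕ.≤-trans q c≤))
... | there q = q

-- The component to open is one whose removal keeps the bonus: preferably a 3-chain, then a loop of
-- length at most 6, since neither removal lowers the controlled value. If there is none of these to
-- open, the rest contributes at least 0, or -1 for a single 3-chain, and the bonus alone reaches
-- the threshold. A lone chain, a lone loop, and a 3-chain with one loop are computed directly.
V≤control : ∀ cs ls → Fair cs ls → + 2 ≤ control cs ls → V cs ls ≤ control cs ls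
V≤control = endgame-rec (λ cs ls → + 2 ≤ control cs ls → V cs ls ≤ control cs ls) step
  where
  last-chain : ∀ c → V (c ∷ []) [] ≤ control (c ∷ []) []
  last-chain c = opened-≤ 4 c _ (≤-by {a = 0ℤ} {0ℤ} ≤-refl (lemma₁ (+ c))) (≤-by (+≤+ (z≤n {4})) (lemma₂ (+ c)))
    where
    lemma₁ : ∀ c → c -ℤ + 4 +ℤ + 0 +ℤ + 0 +ℤ + 4 -ℤ (c -ℤ + 0) ≡ 0ℤ -ℤ 0ℤ
    lemma₁ = solve-∀
    lemma₂ : ∀ c → c -ℤ + 4 +ℤ + 0 +ℤ + 0 +ℤ + 4 -ℤ (c -ℤ + 4 +ℤ + 0) ≡ + 4 -ℤ + 0
    lemma₂ = solve-∀

  last-loop : ∀ ℓ → V [] (ℓ ∷ []) ≤ control [] (ℓ ∷ [])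
  last-loop ℓ = opened-≤ 8 ℓ _ (≤-by {a = 0ℤ} {0ℤ} ≤-refl (lemma₁ (+ ℓ))) (≤-by (+≤+ (z≤n {8})) (lemma₂ (+ ℓ)))
    where
    lemma₁ : ∀ c → + 0 +ℤ (c -ℤ + 8 +ℤ + 0) +ℤ + 8 -ℤ (c -ℤ + 0) ≡ 0ℤ -ℤ 0ℤ
    lemma₁ = solve-∀
    lemma₂ : ∀ c → + 0 +ℤ (c -ℤ + 8 +ℤ + 0) +ℤ + 8 -ℤ (c -ℤ + 8 +ℤ + 0) ≡ + 8 -ℤ + 0
    lemma₂ = solve-∀

  three-loop : ∀ ℓ → V (3 ∷ []) (ℓ ∷ []) ≤ control (3 ∷ []) (ℓ ∷ [])
  three-loop ℓ = ≤-trans (V-loop {3 ∷ []} {ℓ ∷ []} ↭-refl) (opened-≤ 8 ℓ _ (≤-by {a = 0ℤ} {0ℤ} ≤-refl (lemma₁ (+ ℓ))) (≤-by (+≤+ (z≤n {2})) (lemma₂ (+ ℓ))))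
    where
    lemma₁ : ∀ c → -[1+ 0 ] +ℤ (c -ℤ + 8 +ℤ + 0) +ℤ + 6 -ℤ (c -ℤ + 3) ≡ 0ℤ -ℤ 0ℤ
    lemma₁ = solve-∀
    lemma₂ : ∀ c → -[1+ 0 ] +ℤ (c -ℤ + 8 +ℤ + 0) +ℤ + 6 -ℤ (c -ℤ + 8 +ℤ + 3) ≡ + 2 -ℤ + 0
    lemma₂ = solve-∀

  step : ∀ cs ls → Fair cs ls →
    (∀ {c cs′} → cs ↭ c ∷ cs′ → + 2 ≤ control cs′ ls → V cs′ ls ≤ control cs′ ls) →
    (∀ {ℓ ls′} → ls ↭ ℓ ∷ ls′ → + 2 ≤ control cs ls′ → V cs ls′ ≤ control cs ls′) →
    + 2 ≤ control cs ls → V cs ls ≤ control cs ls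
  step cs ls F ihᶜ ihˡ 2≤ = go cs ls refl refl
    where
    drop-chain : ∀ {c cs′} → cs ↭ c ∷ cs′ → c ≤ᴺ 3 → terminalBonus (c ∷ cs′) ls ≡ terminalBonus cs′ ls → V cs ls ≤ control cs ls
    drop-chain p c≤ t = controlled-chain {cs} {ls} p F t 2≤′ (ihᶜ p 2≤′)
      where 2≤′ = ≤-trans 2≤ (control-chain-≤4 {cs} {ls} p (m≤n⇒m≤1+n c≤) (≤-reflexive t))
    drop-loop : ∀ {ℓ ls′} → ls ↭ ℓ ∷ ls′ → ℓ ≤ᴺ 6 → terminalBonus cs (ℓ ∷ ls′) ≡ terminalBonus cs ls′ → V cs ls ≤ control cs ls
    drop-loop p ℓ≤ t = controlled-loop {cs} {ls} p F t 4≤′ (ihˡ p (≤-trans (+≤+ (s≤s (s≤s z≤n))) 4≤′))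
      where 4≤′ = ≤-trans (+-mono-≤ 2≤ (≤-refl {+ 2})) (control-loop-≤6 {cs} {ls} p ℓ≤ (≤-reflexive t))
    drop-loop′ : ∀ {ℓ ls′} → ls ↭ ℓ ∷ ls′ → terminalBonus cs (ℓ ∷ ls′) ≡ terminalBonus cs ls′ → + 4 ≤ control cs ls′ → V cs ls ≤ control cs ls
    drop-loop′ p t 4≤ = controlled-loop {cs} {ls} p F t 4≤ (ihˡ p (≤-trans (+≤+ (s≤s (s≤s z≤n))) 4≤))

    big : Big cs → V cs ls ≤ control cs ls
    big b with small? 3 cs
    ... | small p c≤ = drop-chain p c≤ (trans (bonus-big ls (Any-resp-↭ p b)) (sym (bonus-big ls (big-tail p c≤ b))))
    ... | large C with small? 6 ls
    ...   | small {ℓ} {ls′} p ℓ≤ = drop-loop p ℓ≤ (trans (bonus-big (ℓ ∷ ls′) b) (sym (bonus-big ls′ b)))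
    ...   | large L = front cs ls refl refl
      where
      front : ∀ cs′ ls′ → cs′ ≡ cs → ls′ ≡ ls → V cs ls ≤ control cs ls
      front _ (ℓ ∷ ls′) refl refl = drop-loop′ ↭-refl (trans (bonus-big (ℓ ∷ ls′) b) (sym (bonus-big ls′ b)))
        (control-≥ cs ls′ (chains≥4-sum (large-chains C)) (loops≥8-sum (All.tail (large-loops (proj₂ F) L))) (bonus-big ls′ b))
      front (c ∷ []) [] refl refl = last-chain c
      front (c ∷ cs′@(_ ∷ _)) [] refl refl = controlled-chain {cs} {[]} ↭-refl F refl 2≤′ (ihᶜ ↭-refl 2≤′)
        where
        2≤′ : + 2 ≤ control cs′ []
        2≤′ = ≤-trans (+≤+ (s≤s (s≤s (z≤n {2})))) (control-≥ cs′ [] (chains≥4-sum (All.tail (large-chains C))) ≤-refl refl)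
      front [] [] refl refl = ⊥-elim (none-big b)
        where
        none-big : ¬ Big []
        none-big ()

    -- The lists are split through equal copies, so that the helpers above, stated for `cs` and
    -- `ls`, apply in every case.
    go : ∀ cs′ ls′ → cs′ ≡ cs → ls′ ≡ ls → V cs ls ≤ control cs ls
    go [] [] refl refl = +≤+ z≤n
    go [] (ℓ ∷ []) refl refl = last-loop ℓ
    go [] (ℓ ∷ ls′@(_ ∷ _)) refl refl with small? 6 ls
    ... | small {ys = []} p _ with ↭-length p
    ...   | ()
    go [] (ℓ ∷ ls′@(_ ∷ _)) refl refl | small {ys = _ ∷ _} p ℓ≤ = drop-loop p ℓ≤ refl
    go [] (ℓ ∷ ls′@(_ ∷ _)) refl refl | large L = drop-loop′ ↭-refl refl
      (≤-trans (+≤+ (s≤s (s≤s (s≤s (s≤s (z≤n {4})))))) (control-≥ [] ls′ ≤-refl (loops≥8-sum (All.tail (large-loops (proj₂ F) L))) refl))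
    go (c ∷ cs′) _ refl refl with big? cs
    ... | inj₁ b = big b
    ... | inj₂ ¬b = flat cs′ ls refl refl
      where
      flat : ∀ cs″ ls′ → cs″ ≡ cs′ → ls′ ≡ ls → V cs ls ≤ control cs ls
      flat (_ ∷ _) [] refl refl = drop-chain ↭-refl (All.head (¬big⇒≤3 ¬b)) refl
      flat (c′ ∷ _) (ℓ ∷ ls′) refl refl = drop-chain ↭-refl (All.head (¬big⇒≤3 ¬b))
        (trans (bonus-small c ℓ ls′ ¬b) (sym (bonus-small c′ ℓ ls′ (¬b ∘ there))))
      flat [] [] refl refl = last-chain c
      flat [] (ℓ ∷ ls′) refl refl with ℕ.≤-antisym (All.head (proj₁ F)) (All.head (¬big⇒≤3 ¬b))
      flat [] (ℓ ∷ []) refl refl | refl = three-loop ℓ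
      flat [] (ℓ ∷ ls′@(_ ∷ _)) refl refl | refl with small? 6 ls
      ... | small {ys = []} p _ with ↭-length p
      ...   | ()
      flat [] (ℓ ∷ ls′@(_ ∷ _)) refl refl | refl | small {ys = _ ∷ _} p ℓ≤ = drop-loop p ℓ≤ refl
      -- The 3-chain gives -1, the remaining loops at least 0, and the bonus is 6: the rest is
      -- controlled with at least 5.
      flat [] (ℓ ∷ ls′@(_ ∷ _)) refl refl | refl | large L = drop-loop′ ↭-refl refl
        (≤-trans (+≤+ (s≤s (s≤s (s≤s (s≤s (z≤n {1})))))) (control-≥ (3 ∷ []) ls′ (≤-refl { -[1+ 0 ] })
          (loops≥8-sum (All.tail (large-loops (proj₂ F) L))) refl))

V≡control : ∀ cs ls → Fair cs ls → + 2 ≤ control cs ls → V cs ls ≡ control cs ls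
V≡control cs ls F 2≤ = ≤-antisym (V≤control cs ls F 2≤) (control≤V cs ls F)

-- Upper bounds for small controlled value

bonus-3 : ∀ cs ls → terminalBonus cs ls ≤ terminalBonus (3 ∷ cs) ls +ℤ + 2
bonus-3 []       []       = +≤+ z≤n
bonus-3 (_ ∷ _)  []       = +≤+ (s≤s (s≤s (s≤s (s≤s z≤n))))
bonus-3 []       (_ ∷ _)  = ≤-refl
bonus-3 (c ∷ cs) (ℓ ∷ ls) with big? (c ∷ cs)
... | inj₁ b  = subst₂ (λ s t → s ≤ t +ℤ + 2) (sym (bonus-big (ℓ ∷ ls) b)) (sym (bonus-big {3 ∷ c ∷ cs} (ℓ ∷ ls) (there b)))
                  (+≤+ (s≤s (s≤s (s≤s (s≤s z≤n)))))
... | inj₂ ¬b = subst₂ (λ s t → s ≤ t +ℤ + 2) (sym (bonus-small c ℓ ls ¬b)) (sym (bonus-small 3 ℓ ls ¬3b))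
                  (+≤+ (s≤s (s≤s (s≤s (s≤s (s≤s (s≤s z≤n)))))))
  where
  ¬3b : ¬ Big (3 ∷ c ∷ cs)
  ¬3b (here (s≤s (s≤s (s≤s ()))))
  ¬3b (there b) = ¬b b

-- Removing the 3-chain adds 1 to the sum and at most 2 to the bonus, the extreme case being the
-- last chain beside loops (6 to 8). So the rest has controlled value at most 4, and 0 ≤ w ≤ 4 makes
-- max (3 - w, w - 1) at most 3. The bound on the rest is an argument because it is an induction
-- hypothesis in `V≤4`.
threeChain-V≤3 : ∀ {cs ls cs′} → cs ↭ 3 ∷ cs′ → Fair cs ls → control cs ls ≤ + 1 →
                 (control cs′ ls ≤ + 4 → V cs′ ls ≤ + 4) → V cs ls ≤ + 3
threeChain-V≤3 {cs} {ls} {cs′} p F k≤1 ih = ≤-trans (V-chain p) (opened-≤ 4 3 w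
    (≤-by (V-≥0 (fair-chain {ls = ls} p F)) (lemma₁ w))
    (≤-by (ih (≤-by (+-mono-≤ (subst (_≤ + 1) k≡ k≤1) (bonus-3 cs′ ls)) (lemma₃ κ (terminalBonus (3 ∷ cs′) ls) (terminalBonus cs′ ls)))) (lemma₂ w)))
  where
  w κ : ℤ
  w = V cs′ ls
  κ = control cs′ ls
  k≡ : control cs ls ≡ -[1+ 0 ] +ℤ κ +ℤ (terminalBonus (3 ∷ cs′) ls -ℤ terminalBonus cs′ ls)
  k≡ = trans (control-resp p (↭-refl {x = ls})) (control-chain 3 cs′ ls)
  lemma₁ : ∀ w → + 3 -ℤ (+ 3 -ℤ w) ≡ w -ℤ + 0
  lemma₁ = solve-∀
  lemma₂ : ∀ w → + 3 -ℤ (-[1+ 0 ] +ℤ w) ≡ + 4 -ℤ w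
  lemma₂ = solve-∀
  lemma₃ : ∀ κ t′ t → + 4 -ℤ κ ≡ (+ 1 +ℤ (t′ +ℤ + 2)) -ℤ (-[1+ 0 ] +ℤ κ +ℤ (t′ -ℤ t) +ℤ t)
  lemma₃ = solve-∀

bonus-loop : ∀ ℓ cs ls → terminalBonus cs ls ≤ terminalBonus cs (ℓ ∷ ls)
bonus-loop ℓ []       []      = +≤+ z≤n
bonus-loop ℓ []       (_ ∷ _) = ≤-refl
bonus-loop ℓ (_ ∷ _)  (_ ∷ _) = ≤-refl
bonus-loop ℓ (c ∷ cs) []      with big? (c ∷ cs)
... | inj₁ b  = ≤-reflexive (sym (bonus-big (ℓ ∷ []) b))
... | inj₂ ¬b = subst (+ 4 ≤_) (sym (bonus-small c ℓ [] ¬b)) (+≤+ (s≤s (s≤s (s≤s (s≤s z≤n)))))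

control-loop-≤ : ∀ {cs ls ℓ ls′} → ls ↭ ℓ ∷ ls′ → control cs ls′ ≤ control cs ls +ℤ (+ 8 -ℤ + ℓ)
control-loop-≤ {cs} {ls} {ℓ} {ls′} p = subst (λ κ → control cs ls′ ≤ κ +ℤ (+ 8 -ℤ + ℓ))
    (sym (trans (control-resp (↭-refl {x = cs}) p) (control-loop ℓ cs ls′)))
    (≤-by (bonus-loop ℓ cs ls′) (lemma (+ ℓ) (control cs ls′) (terminalBonus cs (ℓ ∷ ls′)) (terminalBonus cs ls′)))
  where
  lemma : ∀ c κ t′ t → c -ℤ + 8 +ℤ κ +ℤ (t′ -ℤ t) +ℤ (+ 8 -ℤ c) -ℤ κ ≡ t′ -ℤ t
  lemma = solve-∀

≤1⊎≥2 : ∀ i → i ≤ + 1 ⊎ + 2 ≤ i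
≤1⊎≥2 (+ 0)           = inj₁ (+≤+ z≤n)
≤1⊎≥2 (+ 1)           = inj₁ (+≤+ (s≤s z≤n))
≤1⊎≥2 (+ suc (suc n)) = inj₂ (+≤+ (s≤s (s≤s z≤n)))
≤1⊎≥2 -[1+ n ]        = inj₁ -≤+

data Member (n : ℕ) (xs : List ℕ) : Set where
  present : ∀ {ys} → xs ↭ n ∷ ys → Member n xs
  absent  : All (¬_ ∘ (n ≡_)) xs → Member n xs

member? : ∀ n xs → Member n xs
member? n xs with any? (n ≟_) xs
... | no ¬p = absent (Allₚ.¬Any⇒All¬ xs ¬p)
... | yes n∈ with ∈⇒↭ n∈
...   | ys , q = present q

even-≢ : ∀ {ℓ m} → 2 ∣ᴺ ℓ → suc m ≤ᴺ ℓ → ¬ (2 ∣ᴺ suc m) → suc (suc m) ≤ᴺ ℓ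
even-≢ e m≤ ¬e = ≤∧≢⇒< m≤ λ { refl → ¬e e }

-- Open a 3-chain, else a 4-loop, else a 6-loop; without any of these only the bonus remains.
V≤4 : ∀ cs ls → Fair cs ls → control cs ls ≤ + 4 → V cs ls ≤ + 4
V≤4 = endgame-rec (λ cs ls → control cs ls ≤ + 4 → V cs ls ≤ + 4) step
  where
  step : ∀ cs ls → Fair cs ls →
    (∀ {c cs′} → cs ↭ c ∷ cs′ → control cs′ ls ≤ + 4 → V cs′ ls ≤ + 4) →
    (∀ {ℓ ls′} → ls ↭ ℓ ∷ ls′ → control cs ls′ ≤ + 4 → V cs ls′ ≤ + 4) →
    control cs ls ≤ + 4 → V cs ls ≤ + 4
  step cs ls F ihᶜ ihˡ k≤4 with ≤1⊎≥2 (control cs ls)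
  ... | inj₂ 2≤ = ≤-trans (V≤control cs ls F 2≤) k≤4
  ... | inj₁ k≤1 with member? 3 cs
  ...   | present p = ≤-trans (threeChain-V≤3 p F k≤1 (ihᶜ p)) (+≤+ (s≤s (s≤s (s≤s z≤n))))
  ...   | absent C with member? 4 ls
  ...     | present {ls′} p = ≤-trans (V-loop {cs} p) (opened-≤ 8 4 (V cs ls′)
              (≤-by (V-≥0 (fair-loop {cs} p F)) (lemma₁ (V cs ls′))) (≤-by (≤-trans w≤5 (+≤+ (m≤m+n 5 3))) (lemma₂ (V cs ls′))))
    where
    k≤5 : control cs ls′ ≤ + 5
    k≤5 = ≤-trans (control-loop-≤ {cs} p) (+-mono-≤ k≤1 (≤-refl {+ 4}))
    w≤5 : V cs ls′ ≤ + 5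
    w≤5 with ≤1⊎≥2 (control cs ls′)
    ... | inj₂ 2≤ = ≤-trans (V≤control cs ls′ (fair-loop {cs} p F) 2≤) k≤5
    ... | inj₁ ≤1 = ≤-trans (ihˡ p (≤-trans ≤1 (+≤+ (s≤s z≤n)))) (+≤+ (m≤m+n 4 1))
    lemma₁ : ∀ w → + 4 -ℤ (+ 4 -ℤ w) ≡ w -ℤ + 0
    lemma₁ = solve-∀
    lemma₂ : ∀ w → + 4 -ℤ (+ 4 -ℤ + 8 +ℤ w) ≡ + 8 -ℤ w
    lemma₂ = solve-∀
  ...     | absent L with member? 6 ls
  ...       | present {ls′} p = ≤-trans (V-loop {cs} p) (opened-≤ 8 6 (V cs ls′)
                (≤-by w≥2 (lemma₁ (V cs ls′))) (≤-by (≤-trans w≤4 (+≤+ (m≤m+n 4 2))) (lemma₂ (V cs ls′))))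
    where
    k≤3 : control cs ls′ ≤ + 3
    k≤3 = ≤-trans (control-loop-≤ {cs} p) (+-mono-≤ k≤1 (≤-refl {+ 2}))
    w≤4 : V cs ls′ ≤ + 4
    w≤4 = ihˡ p (≤-trans k≤3 (+≤+ (m≤m+n 3 1)))
    -- Opening the 6-loop is only cheap if 6 - w is at most 4. No 3-chain or 4-loop is left, so
    -- every further opening has mean at least 2; and the 6-loop is not alone, since by itself it
    -- has controlled value 6.
    w≥2 : + 2 ≤ V cs ls′
    w≥2 with best cs ls′
    ... | none refl refl = ⊥-elim (absurd (subst (_≤ + 1) (control-resp (↭-refl {x = []}) p) k≤1))
      where
      absurd : ¬ (+ 6 ≤ + 1)
      absurd (+≤+ (s≤s ()))
    ... | openChain {c} {cs′} q eq = subst (+ 2 ≤_) (sym eq) (opened-≥ 2 4 c (V cs′ ls′)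
            (double-mono (≤∧≢⇒< (head↭ q (proj₁ F)) (head↭ q C))))
    ... | openLoop {ℓ} {ls″} q eq = subst (+ 2 ≤_) (sym eq) (opened-≥ 2 8 ℓ (V cs ls″)
            (double-mono (even-≢ (proj₂ ok) (≤∧≢⇒< (proj₁ ok) (All.head (All-resp-↭ q (All.tail (All-resp-↭ p L))))) (from-no (2 ∣? 5)))))
      where
      ok : 4 ≤ᴺ ℓ × 2 ∣ᴺ ℓ
      ok = head↭ q (proj₂ (fair-loop {cs} p F))
    lemma₁ : ∀ w → + 4 -ℤ (+ 6 -ℤ w) ≡ w -ℤ + 2
    lemma₁ = solve-∀
    lemma₂ : ∀ w → + 4 -ℤ (+ 6 -ℤ + 8 +ℤ w) ≡ + 6 -ℤ w
    lemma₂ = solve-∀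
  ...       | absent L′ = bounded cs ls F C L L′ k≤1
    where
    chains-ok : ∀ {cs} → All (3 ≤ᴺ_) cs → All (¬_ ∘ (3 ≡_)) cs → All (4 ≤ᴺ_) cs
    chains-ok []       []       = []
    chains-ok (p ∷ ps) (q ∷ qs) = ≤∧≢⇒< p q ∷ chains-ok ps qs
    loops-ok : ∀ {ls} → All (λ ℓ → 4 ≤ᴺ ℓ × 2 ∣ᴺ ℓ) ls → All (¬_ ∘ (4 ≡_)) ls → All (¬_ ∘ (6 ≡_)) ls → All (8 ≤ᴺ_) ls
    loops-ok []             []       []       = []
    loops-ok ((p , e) ∷ ps) (q ∷ qs) (r ∷ rs) =
      even-≢ e (≤∧≢⇒< (even-≢ e (≤∧≢⇒< p q) (from-no (2 ∣? 5))) r) (from-no (2 ∣? 7)) ∷ loops-ok ps qs rs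
    absurd : ∀ {t} → + 2 ≤ t → ¬ (+ 0 +ℤ t ≤ + 1)
    absurd (+≤+ (s≤s (s≤s _))) (+≤+ (s≤s ()))
    bonus≥2 : ∀ c cs ls → + 2 ≤ terminalBonus (c ∷ cs) ls
    bonus≥2 c cs []       = +≤+ (s≤s (s≤s z≤n))
    bonus≥2 c cs (ℓ ∷ ls) with big? (c ∷ cs)
    ... | inj₁ b  = subst (+ 2 ≤_) (sym (bonus-big (ℓ ∷ ls) b)) (+≤+ (s≤s (s≤s z≤n)))
    ... | inj₂ ¬b = subst (+ 2 ≤_) (sym (bonus-small c ℓ ls ¬b)) (+≤+ (s≤s (s≤s z≤n)))
    bounded : ∀ cs ls → Fair cs ls → All (¬_ ∘ (3 ≡_)) cs → All (¬_ ∘ (4 ≡_)) ls → All (¬_ ∘ (6 ≡_)) ls →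
              control cs ls ≤ + 1 → V cs ls ≤ + 4
    bounded []       []       F C L L′ k≤ = +≤+ z≤n
    bounded []       (ℓ ∷ ls) F C L L′ k≤ = ⊥-elim (absurd (+≤+ (s≤s (s≤s z≤n)))
      (≤-trans (control-≥ [] (ℓ ∷ ls) ≤-refl (loops≥8-sum (loops-ok (proj₂ F) L L′)) refl) k≤))
    bounded (c ∷ cs) ls       F C L L′ k≤ = ⊥-elim (absurd (bonus≥2 c cs ls)
      (≤-trans (control-≥ (c ∷ cs) ls (chains≥4-sum (chains-ok (proj₁ F) C)) (loops≥8-sum (loops-ok (proj₂ F) L L′)) refl) k≤))

V≤3 : ∀ {cs ls cs′} → cs ↭ 3 ∷ cs′ → Fair cs ls → control cs ls ≤ + 1 → V cs ls ≤ + 3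
V≤3 {ls = ls} {cs′} p F k≤1 = threeChain-V≤3 p F k≤1 (V≤4 cs′ ls (fair-chain {ls = ls} p F))

-- Parity and the case of two 3-chains

bonus-even : ∀ cs ls → ∃[ t ] terminalBonus cs ls ≡ t +ℤ t
bonus-even []       []       = + 0 , refl
bonus-even []       (_ ∷ _)  = + 4 , refl
bonus-even (_ ∷ _)  []       = + 2 , refl
bonus-even (c ∷ cs) (ℓ ∷ ls) with big? (c ∷ cs)
... | inj₁ b  = + 2 , bonus-big (ℓ ∷ ls) b
... | inj₂ ¬b = + 3 , bonus-small c ℓ ls ¬b

-- Opening n boxes at cost d = e + e keeps the parity, as n − w and n − d + w agree modulo 2.
parity-step : ∀ e n {w k t t′} → (∃[ z ] w ≡ k +ℤ (z +ℤ z)) → (∃[ s ] t ≡ s +ℤ s) → (∃[ s ] t′ ≡ s +ℤ s) →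
              ∃[ z ] opened (e + e , n) w ≡ (+ n -ℤ + (e + e) +ℤ k +ℤ (t′ -ℤ t)) +ℤ (z +ℤ z)
parity-step e n {w} {k} (z , refl) (s , refl) (s′ , refl) with ⊔-sel (+ n -ℤ w) (+ n -ℤ + (e + e) +ℤ w)
... | inj₁ eq = + e -ℤ k -ℤ z +ℤ s -ℤ s′ , trans eq (lemma (+ n) (+ e) k z s s′)
  where
  lemma : ∀ n e k z s s′ → n -ℤ (k +ℤ (z +ℤ z)) ≡ (n -ℤ (e +ℤ e) +ℤ k +ℤ (s′ +ℤ s′ -ℤ (s +ℤ s)))
    +ℤ ((e -ℤ k -ℤ z +ℤ s -ℤ s′) +ℤ (e -ℤ k -ℤ z +ℤ s -ℤ s′))
  lemma = solve-∀
... | inj₂ eq = z +ℤ s -ℤ s′ , trans eq (lemma (+ n) (+ e) k z s s′)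
  where
  lemma : ∀ n e k z s s′ → n -ℤ (e +ℤ e) +ℤ (k +ℤ (z +ℤ z)) ≡ (n -ℤ (e +ℤ e) +ℤ k +ℤ (s′ +ℤ s′ -ℤ (s +ℤ s)))
    +ℤ ((z +ℤ s -ℤ s′) +ℤ (z +ℤ s -ℤ s′))
  lemma = solve-∀

V-parity : ∀ cs ls → Fair cs ls → ∃[ z ] V cs ls ≡ control cs ls +ℤ (z +ℤ z)
V-parity = endgame-rec (λ cs ls → ∃[ z ] V cs ls ≡ control cs ls +ℤ (z +ℤ z)) step
  where
  step : ∀ cs ls → Fair cs ls → (∀ {c cs′} → cs ↭ c ∷ cs′ → ∃[ z ] V cs′ ls ≡ control cs′ ls +ℤ (z +ℤ z)) →
         (∀ {ℓ ls′} → ls ↭ ℓ ∷ ls′ → ∃[ z ] V cs ls′ ≡ control cs ls′ +ℤ (z +ℤ z)) →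
         ∃[ z ] V cs ls ≡ control cs ls +ℤ (z +ℤ z)
  step cs ls F ihᶜ ihˡ with best cs ls
  ... | none refl refl = + 0 , refl
  ... | openChain {c} {cs′} p eq with parity-step 2 c (ihᶜ p) (bonus-even cs′ ls) (bonus-even (c ∷ cs′) ls)
  ...   | z , eq′ = z , trans eq (trans eq′ (cong (_+ℤ (z +ℤ z))
            (sym (trans (control-resp p (↭-refl {x = ls})) (control-chain c cs′ ls)))))
  step cs ls F ihᶜ ihˡ | openLoop {ℓ} {ls′} p eq with parity-step 4 ℓ (ihˡ p) (bonus-even cs ls′) (bonus-even cs (ℓ ∷ ls′))
  ...   | z , eq′ = z , trans eq (trans eq′ (cong (_+ℤ (z +ℤ z))
            (sym (trans (control-resp (↭-refl {x = cs}) p) (control-loop ℓ cs ls′)))))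

Even Odd : ℤ → Set
Even i = ∃[ y ] i ≡ y *ℤ + 2
Odd  i = ∃[ y ] i ≡ y *ℤ + 2 +ℤ + 1

even⊎oddᴺ : ∀ n → Even (+ n) ⊎ Odd (+ n)
even⊎oddᴺ zero  = inj₁ (+ 0 , refl)
even⊎oddᴺ (suc n) with even⊎oddᴺ n
... | inj₁ (y , eq) = inj₂ (y , trans (cong (+ 1 +ℤ_) eq) (lemma y))
  where
  lemma : ∀ y → + 1 +ℤ y *ℤ + 2 ≡ y *ℤ + 2 +ℤ + 1
  lemma = solve-∀
... | inj₂ (y , eq) = inj₁ (y +ℤ + 1 , trans (cong (+ 1 +ℤ_) eq) (lemma y))
  where
  lemma : ∀ y → + 1 +ℤ (y *ℤ + 2 +ℤ + 1) ≡ (y +ℤ + 1) *ℤ + 2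
  lemma = solve-∀

even⊎odd : ∀ i → Even i ⊎ Odd i
even⊎odd (+ n) = even⊎oddᴺ n
even⊎odd -[1+ n ] with even⊎oddᴺ (suc n)
... | inj₁ (y , eq) = inj₁ (- y , trans (cong -_ eq) (lemma y))
  where
  lemma : ∀ y → - (y *ℤ + 2) ≡ - y *ℤ + 2
  lemma = solve-∀
... | inj₂ (y , eq) = inj₂ (- y -ℤ + 1 , trans (cong -_ eq) (lemma y))
  where
  lemma : ∀ y → - (y *ℤ + 2 +ℤ + 1) ≡ (- y -ℤ + 1) *ℤ + 2 +ℤ + 1
  lemma = solve-∀

∣⇒even : ∀ {i} → + 2 ∣ i → Even i
∣⇒even 2∣i with Signed.∣ᵤ⇒∣ 2∣i
... | Signed.divides y eq = y , eq

even⇒∣ : ∀ {i} → Even i → + 2 ∣ i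
even⇒∣ (y , eq) = Signed.∣⇒∣ᵤ (Signed.divides y eq)

¬even∧odd : ∀ {i} → Even i → ¬ Odd i
¬even∧odd (y , refl) (z , eq) = from-no (2 ∣? 1) (even⇒∣ {+ 1} (y -ℤ z , trans (lemma z) (trans (cong (λ i → i -ℤ z *ℤ + 2) (sym eq)) (lemma′ y z))))
  where
  lemma : ∀ z → + 1 ≡ z *ℤ + 2 +ℤ + 1 -ℤ z *ℤ + 2
  lemma = solve-∀
  lemma′ : ∀ y z → y *ℤ + 2 -ℤ z *ℤ + 2 ≡ (y -ℤ z) *ℤ + 2
  lemma′ = solve-∀

V-even : ∀ {cs ls} → Fair cs ls → Even (control cs ls) → Even (V cs ls)
V-even {cs} {ls} F (y , eq) with V-parity cs ls F
... | z , eq′ = y +ℤ z , trans eq′ (trans (cong (_+ℤ (z +ℤ z)) eq) (lemma y z))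
  where
  lemma : ∀ y z → y *ℤ + 2 +ℤ (z +ℤ z) ≡ (y +ℤ z) *ℤ + 2
  lemma = solve-∀

V-odd : ∀ {cs ls} → Fair cs ls → Odd (control cs ls) → Odd (V cs ls)
V-odd {cs} {ls} F (y , eq) with V-parity cs ls F
... | z , eq′ = y +ℤ z , trans eq′ (trans (cong (_+ℤ (z +ℤ z)) eq) (lemma y z))
  where
  lemma : ∀ y z → y *ℤ + 2 +ℤ + 1 +ℤ (z +ℤ z) ≡ (y +ℤ z) *ℤ + 2 +ℤ + 1
  lemma = solve-∀

suc-even : ∀ {i} → Even i → Odd (i +ℤ + 1)
suc-even (y , refl) = y , refl

suc-odd : ∀ {i} → Odd i → Even (i +ℤ + 1)
suc-odd (y , refl) = y +ℤ + 1 , lemma y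
  where
  lemma : ∀ y → y *ℤ + 2 +ℤ + 1 +ℤ + 1 ≡ (y +ℤ + 1) *ℤ + 2
  lemma = solve-∀

even≤3 : ∀ {i} → + 0 ≤ i → i ≤ + 3 → Even i → i ≡ + 0 ⊎ i ≡ + 2
even≤3 {+ 0} _ _ e = inj₁ refl
even≤3 {+ 1} _ _ e = ⊥-elim (¬even∧odd e (+ 0 , refl))
even≤3 {+ 2} _ _ e = inj₂ refl
even≤3 {+ 3} _ _ e = ⊥-elim (¬even∧odd e (+ 1 , refl))
even≤3 {+ suc (suc (suc (suc _)))} _ (+≤+ (s≤s (s≤s (s≤s ())))) e

odd≤3 : ∀ {i} → + 0 ≤ i → i ≤ + 3 → Odd i → i ≡ + 1 ⊎ i ≡ + 3
odd≤3 {+ 0} _ _ e = ⊥-elim (¬even∧odd (+ 0 , refl) e)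
odd≤3 {+ 1} _ _ e = inj₁ refl
odd≤3 {+ 2} _ _ e = ⊥-elim (¬even∧odd (+ 1 , refl) e)
odd≤3 {+ 3} _ _ e = inj₂ refl
odd≤3 {+ suc (suc (suc (suc _)))} _ (+≤+ (s≤s (s≤s (s≤s ())))) e

odd≤1 : ∀ {i} → + 0 ≤ i → i ≤ + 1 → Odd i → i ≡ + 1
odd≤1 0≤ ≤1 o with odd≤3 0≤ (≤-trans ≤1 (+≤+ (s≤s z≤n))) o
... | inj₁ eq   = eq
... | inj₂ refl with ≤1
...   | +≤+ (s≤s ())

-- Endgames with two 3-chains

threes : ∀ {n} cs → suc n ≤ᴺ length (filter (_≟ 3) cs) → ∃[ cs′ ] cs ↭ 3 ∷ cs′ × n ≤ᴺ length (filter (_≟ 3) cs′)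
threes {n} cs n< with filter (_≟ 3) cs in eq
... | x ∷ xs with ∈-filter⁻ (_≟ 3) {xs = cs} (subst (x ∈_) (sym eq) (here refl))
...   | x∈ , refl with ∈⇒↭ x∈
...     | cs′ , p = cs′ , p , s≤s⁻¹ (subst (suc n ≤ᴺ_) (trans (sym (cong length eq)) (↭-length (filter-↭ (_≟ 3) p))) n<)

↭-─ : ∀ {A : Set} {x : A} {xs} (p : x ∈ xs) → xs ↭ x ∷ (xs ─ p)
↭-─ (here refl)     = ↭-refl
↭-─ (there {y} p)   = ↭-trans (prep y (↭-─ p)) (swap y _ ↭-refl)

-- The second 3-chain keeps the list of chains non-empty, and a 3-chain is never a long one, so the
-- bonus does not change. Only the contribution -1 disappears.
control-33 : ∀ {cs ls cs′ cs″} → cs ↭ 3 ∷ cs′ → cs′ ↭ 3 ∷ cs″ → control cs′ ls ≡ control cs ls +ℤ + 1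
control-33 {cs} {ls} {cs′} {cs″} p q = sym (trans (cong (_+ℤ + 1) (trans (control-resp p (↭-refl {x = ls}))
  (trans (control-chain 3 cs′ ls) (cong (λ t → -[1+ 0 ] +ℤ control cs′ ls +ℤ (t -ℤ terminalBonus cs′ ls)) same-bonus))))
  (lemma (control cs′ ls) (terminalBonus cs′ ls)))
  where
  same-bonus : terminalBonus (3 ∷ cs′) ls ≡ terminalBonus cs′ ls
  same-bonus = trans (bonus-resp (prep 3 q) (↭-refl {x = ls})) (trans (bonus-33 ls) (sym (bonus-resp q (↭-refl {x = ls}))))
    where
    bonus-33 : ∀ ls → terminalBonus (3 ∷ 3 ∷ cs″) ls ≡ terminalBonus (3 ∷ cs″) ls
    bonus-33 []      = refl
    bonus-33 (_ ∷ _) = refl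
  lemma : ∀ k t → -[1+ 0 ] +ℤ k +ℤ (t -ℤ t) +ℤ + 1 ≡ k
  lemma = solve-∀

-- By `opened-≥` every opening other than that of a 4-loop is worth at least 1. For a 4-loop, max (4
-- - w, w - 4) = 0 forces w = 4. As the remaining 3-chain would cap w at 3 if the controlled value
-- of the rest were at most 1, that controlled value is at least 2 and hence equals w.
zero⇒4-loop : ∀ {cs ls cs′} → cs ↭ 3 ∷ cs′ → Fair cs ls → V cs ls ≡ + 0 →
              ∃[ ls′ ] ls ↭ 4 ∷ ls′ × control cs ls′ ≡ + 4
zero⇒4-loop {cs} {ls} p3 F V≡0 with best cs ls
... | none refl refl = ⊥-elim (¬x∷xs↭[] (↭-sym p3))
... | openChain {c} {cs′} p eq = ⊥-elim (1≰0 (subst (+ 1 ≤_) (trans (sym eq) V≡0)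
        (opened-≥ 1 4 c (V cs′ ls) (double-mono (head↭ p (proj₁ F))))))
  where
  1≰0 : ¬ (+ 1 ≤ + 0)
  1≰0 (+≤+ ())
... | openLoop {ℓ} {ls′} p eq with 4 ≟ ℓ
...   | no 4≢ = ⊥-elim (1≰0 (subst (+ 1 ≤_) (trans (sym eq) V≡0)
          (opened-≥ 1 8 ℓ (V cs ls′) (double-mono (≤∧≢⇒< (proj₁ (head↭ p (proj₂ F))) 4≢)))))
  where
  1≰0 : ¬ (+ 1 ≤ + 0)
  1≰0 (+≤+ ())
...   | yes refl = ls′ , p , value-4 (≤1⊎≥2 (control cs ls′))
  where
  F′ : Fair cs ls′
  F′ = fair-loop {cs} p F
  V≡4 : V cs ls′ ≡ + 4
  V≡4 = ≤-antisym
    (≤-by (≤-trans (⊔ʳ (V cs ls′)) (≤-reflexive (trans (sym eq) V≡0))) (lemma₁ (V cs ls′)))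
    (≤-by (≤-trans (⊔ˡ (V cs ls′)) (≤-reflexive (trans (sym eq) V≡0))) (lemma₂ (V cs ls′)))
    where
    ⊔ˡ : ∀ w → + 4 -ℤ w ≤ opened (8 , 4) w
    ⊔ˡ w = i≤i⊔j _ _
    ⊔ʳ : ∀ w → -[1+ 3 ] +ℤ w ≤ opened (8 , 4) w
    ⊔ʳ w = i≤j⊔i _ _
    lemma₁ : ∀ w → + 4 -ℤ w ≡ + 0 -ℤ (-[1+ 3 ] +ℤ w)
    lemma₁ = solve-∀
    lemma₂ : ∀ w → w -ℤ + 4 ≡ + 0 -ℤ (+ 4 -ℤ w)
    lemma₂ = solve-∀
  4≰3 : ¬ (+ 4 ≤ + 3)
  4≰3 (+≤+ (s≤s (s≤s (s≤s ()))))
  value-4 : control cs ls′ ≤ + 1 ⊎ + 2 ≤ control cs ls′ → control cs ls′ ≡ + 4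
  value-4 (inj₁ ≤1) = ⊥-elim (4≰3 (subst (_≤ + 3) V≡4 (V≤3 p3 F′ ≤1)))
  value-4 (inj₂ 2≤) = trans (sym (V≡control cs ls′ F′ 2≤)) V≡4

-- The expression max (3 - w, w - 1) is 2 at both w = 1 and w = 3. Once w is a numeral, `opened`
-- computes and the hypothesis is already the conclusion; the same holds for the three evaluations
-- that follow.
three-odd : ∀ {x w} → x ≤ opened (4 , 3) w → w ≡ + 1 ⊎ w ≡ + 3 → x ≤ + 2
three-odd x≤ (inj₁ refl) = x≤
three-odd x≤ (inj₂ refl) = x≤

three-two : ∀ {x w} → x ≤ opened (4 , 3) w → w ≡ + 2 → x ≤ + 1
three-two x≤ refl = x≤

four-three : ∀ {x w} → x ≤ opened (8 , 4) w → w ≡ + 3 → x ≤ + 1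
four-three x≤ refl = x≤

four-four : ∀ {x w} → x ≤ opened (8 , 4) w → w ≡ + 4 → x ≤ + 0
four-four x≤ refl = x≤

module _ {cs ls cs′ cs″} (p : cs ↭ 3 ∷ cs′) (q : cs′ ↭ 3 ∷ cs″) (F : Fair cs ls) (k≤1 : control cs ls ≤ + 1) where

  private
    F₃ : Fair cs′ ls
    F₃ = fair-chain {ls = ls} p F

    w : ℤ
    w = V cs′ ls

    w≥0 : + 0 ≤ w
    w≥0 = V-≥0 {cs′} {ls} F₃

    w≤3 : w ≤ + 3
    w≤3 with ≤1⊎≥2 (control cs′ ls)
    ... | inj₁ ≤1 = V≤3 {cs′} {ls} q F₃ ≤1
    ... | inj₂ 2≤ = ≤-trans (V≤control cs′ ls F₃ 2≤) (≤-trans (≤-reflexive (control-33 {ls = ls} p q))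
                      (+-mono-≤ k≤2 (≤-refl {+ 1})))
      where
      k≤2 : control cs ls ≤ + 2
      k≤2 = ≤-trans k≤1 (+≤+ (s≤s z≤n))

  even-value : Even (control cs ls) → V cs ls ≡ + 0 ⊎ V cs ls ≡ + 2
  even-value e = even≤3 (V-≥0 {cs} {ls} F) (≤-trans ≤2 (+≤+ (s≤s (s≤s z≤n)))) (V-even {cs} {ls} F e)
    where
    ≤2 : V cs ls ≤ + 2
    ≤2 = three-odd (V-chain {cs} {ls} p)
      (odd≤3 w≥0 w≤3 (V-odd {cs′} {ls} F₃ (subst Odd (sym (control-33 {ls = ls} p q)) (suc-even e))))

  odd-value : Odd (control cs ls) → V cs ls ≡ + 1
  odd-value o = odd≤1 (V-≥0 {cs} {ls} F) (≤1 (even≤3 w≥0 w≤3 (V-even {cs′} {ls} F₃ (subst Even (sym (control-33 {ls = ls} p q)) (suc-odd o))))) (V-odd {cs} {ls} F o)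
    where
    ≤1 : w ≡ + 0 ⊎ w ≡ + 2 → V cs ls ≤ + 1
    ≤1 (inj₂ eq) = three-two (V-chain {cs} {ls} p) eq
    -- If the rest is worth 0, opening the 3-chain would cost 3. But a rest of value 0 has a 4-loop
    -- whose removal leaves controlled value 4. Opening that loop in the whole endgame leaves
    -- controlled value 3, hence value 3, and costs only max (1, -1) = 1.
    ≤1 (inj₁ eq) with zero⇒4-loop {cs′} {ls} q F₃ eq
    ... | ls′ , r , k≡4 = four-three (V-loop {cs} {ls} r) V≡3
      where
      k≡3 : control cs ls′ ≡ + 3
      k≡3 = trans (lemma (control cs ls′)) (cong (_-ℤ + 1) (trans (sym (control-33 {ls = ls′} p q)) k≡4))
        where
        lemma : ∀ k → k ≡ k +ℤ + 1 -ℤ + 1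
        lemma = solve-∀
      V≡3 : V cs ls′ ≡ + 3
      V≡3 = trans (V≡control cs ls′ (fair-loop {cs} r F) (subst (+ 2 ≤_) (sym k≡3) (+≤+ (s≤s (s≤s z≤n))))) k≡3

  exceptional-value : (r : 4 ∈ ls) → control cs (ls ─ r) ≡ + 4 → V cs ls ≡ + 0
  exceptional-value r k≡4 = ≤-antisym (four-four (V-loop {cs} {ls} (↭-─ r)) V≡4) (V-≥0 {cs} {ls} F)
    where
    V≡4 : V cs (ls ─ r) ≡ + 4
    V≡4 = trans (V≡control cs (ls ─ r) (fair-loop {cs} (↭-─ r) F) (subst (+ 2 ≤_) (sym k≡4) (+≤+ (s≤s (s≤s z≤n))))) k≡4

  ordinary-value : Even (control cs ls) → ¬ (∃[ r ] control cs (ls ─ r) ≡ + 4) → V cs ls ≡ + 2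
  ordinary-value e ¬ex = nonzero (even-value e)
    where
    nonzero : V cs ls ≡ + 0 ⊎ V cs ls ≡ + 2 → V cs ls ≡ + 2
    nonzero (inj₂ eq) = eq
    nonzero (inj₁ eq) with zero⇒4-loop {cs} {ls} p F eq
    -- The exception refers to a particular occurrence of 4 in the list. Removing any occurrence
    -- leaves the same multiset, hence the same controlled value.
    ... | ls′ , r , k≡4 = ⊥-elim (¬ex (four∈ ,
            trans (control-resp (↭-refl {x = cs}) (drop-∷ (↭-trans (↭-sym (↭-─ four∈)) r))) k≡4))
      where
      four∈ : 4 ∈ ls
      four∈ = ∈-resp-↭ (↭-sym r) (here refl)

<2⇒≤1 : ∀ {i} → i < + 2 → i ≤ + 1
<2⇒≤1 {i} i<2 with ≤1⊎≥2 i
... | inj₁ ≤1 = ≤1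
... | inj₂ 2≤ = ⊥-elim (<⇒≱ i<2 2≤)

¬∣⇒odd : ∀ {i} → ¬ (+ 2 ∣ i) → Odd i
¬∣⇒odd {i} ¬2∣i with even⊎odd i
... | inj₁ e = ⊥-elim (¬2∣i (even⇒∣ e))
... | inj₂ o = o

corollary30 : (G : SimpleLoonyEndgame) → 2 ≤ᴺ #3-chains G →
    (+ 2 ≤ cv G → v ⟦ G ⟧ ≡ cv G)
    × (cv G < + 2 → + 2 ∣ cv G →
    (Exceptional G → v ⟦ G ⟧ ≡ + 0) × (¬ Exceptional G → v ⟦ G ⟧ ≡ + 2))
    × (cv G < + 2 → ¬ (+ 2 ∣ cv G) → v ⟦ G ⟧ ≡ + 1)
corollary30 G two≤ =
  (λ 2≤ → trans (v≡W G) (V≡control (chains G) (loops G) F 2≤)) ,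
  (λ k<2 2∣k →
    (λ (r , k≡4) → trans (v≡W G) (exceptional-value p q F (<2⇒≤1 k<2) r k≡4)) ,
    (λ ¬ex → trans (v≡W G) (ordinary-value p q F (<2⇒≤1 k<2) (∣⇒even 2∣k) ¬ex))) ,
  (λ k<2 ¬2∣k → trans (v≡W G) (odd-value p q F (<2⇒≤1 k<2) (¬∣⇒odd ¬2∣k)))
  where
  F : Fair (chains G) (loops G)
  F = chains≥ G , loops≥ G
  first : ∃[ cs′ ] chains G ↭ 3 ∷ cs′ × 1 ≤ᴺ length (filter (_≟ 3) cs′)
  first = threes (chains G) two≤
  p : chains G ↭ 3 ∷ proj₁ first
  p = proj₁ (proj₂ first)
  q : proj₁ first ↭ 3 ∷ _
  q = proj₁ (proj₂ (threes (proj₁ first) (proj₂ (proj₂ first))))
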